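{- Let $\Gamma$ be a leaf-free bicyclic signed graph. Then $\eta(\Gamma)=2c(\Gamma)-1=3$ if and only if $\Gamma\cong \infty(l,k,x)$ or $\Gamma\cong\theta(l',x',k')$, where every cycle of $\Gamma$ has nullity $2$, and in the first case $x$ is odd, while in the second case $l',x',k'$ are all even.
   Context: A signed graph $\Gamma=(G,\sigma)$ is a simple finite graph $G$ with a map $\sigma:E(G)\to\{+,-\}$; its adjacency matrix has entry $\sigma(v_iv_j)$ if $v_i\sim v_j$ and $0$ otherwise; $\eta(\Gamma)$ is the multiplicity of the eigenvalue $0$ of this matrix. The nullity of a cycle of $\Gamma$ means the nullity of the signed cycle induced by it (with the signs inherited from $\Gamma$). $c(\Gamma)=|E(G)|-|V(G)|+\omega(G)$, where $\omega(G)$ is the number of connected components. Leaf-free means no vertex of degree one. A bicyclic (signed) graph is a connected one with $|E|=|V|+1$. The $\infty$-graph $\infty(p,q,l)$ is obtained from two vertex-disjoint cycles $C_p$ and $C_q$ by joining a vertex of $C_p$ and a vertex of $C_q$ by a path $P_l$ on $l$ vertices (length $l-1$; for $l=1$ the two vertices are identified). The $\theta$-graph $\theta(p,q,l)$ is the union of three internally disjoint paths of lengths $p,q,l$ with common end vertices, where $p,q,l\geq1$ and at most one of them equals $1$. Isomorphism here refers to the underlying graph, with arbitrary signs. -}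

module Defs where

open import Data.Nat using (ℕ; zero; suc; _+_; _∸_; _≤_; _<_; _%_; _<?_)
open import Data.Nat.Divisibility using (_∣_)
open import Data.Fin using (Fin; toℕ) renaming (zero to fz; suc to fs)
open import Data.Bool using (Bool; true; false; T; if_then_else_)
open import Data.Maybe using (Maybe; just; nothing; is-just)
open import Data.Sign using (Sign) renaming (+ to plus; - to minus)
open import Data.Rational using (ℚ; 0ℚ; 1ℚ; -_) renaming (_+_ to _+ℚ_; _*_ to _*ℚ_)
open import Data.List using (List; []; _∷_; _++_; map; upTo)
open import Data.List.Membership.Propositional using (_∈_)
open import Data.Product using (Σ; _×_; _,_; ∃)
open import Data.Sum using (_⊎_)
open import Relation.Binary.PropositionalEquality using (_≡_; _≢_)
open import Relation.Nullary using (¬_; yes; no)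
open import Relation.Nullary.Decidable using (⌊_⌋)
open import Function.Bundles using (_↔_; Inverse; _⇔_)
open import Data.Nat.Properties using (_≟_)

Even : ℕ → Set
Even m = 2 ∣ m

Odd : ℕ → Set
Odd m = ¬ (2 ∣ m)

record SignedGraph (n : ℕ) : Set where
  field
    edge     : Fin n → Fin n → Maybe Sign
    sym      : ∀ i j → edge i j ≡ edge j i
    loopless : ∀ i → edge i i ≡ nothing
open SignedGraph public

adj? : ∀ {n} → SignedGraph n → Fin n → Fin n → Bool
adj? Γ i j = is-just (edge Γ i j)

Adj : ∀ {n} → SignedGraph n → Fin n → Fin n → Set
Adj Γ i j = T (adj? Γ i j)

∑ℚ : ∀ {n} → (Fin n → ℚ) → ℚ
∑ℚ {zero}  f = 0ℚ
∑ℚ {suc n} f = f fz +ℚ ∑ℚ (λ i → f (fs i))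

count : ∀ {n} → (Fin n → Bool) → ℕ
count {zero}  f = 0
count {suc n} f = (if f fz then 1 else 0) + count (λ i → f (fs i))

degree : ∀ {n} → SignedGraph n → Fin n → ℕ
degree Γ i = count (adj? Γ i)

numEdges : ∀ {n} → SignedGraph n → ℕ
numEdges Γ = count′ (λ i → count (λ j → ⌊ toℕ i <? toℕ j ⌋ Data.Bool.∧ adj? Γ i j))
  where
  count′ : ∀ {n} → (Fin n → ℕ) → ℕ
  count′ {zero}  f = 0
  count′ {suc n} f = f fz + count′ (λ i → f (fs i))

data Reach {n} (Γ : SignedGraph n) : Fin n → Fin n → Set where
  here : ∀ {i} → Reach Γ i i
  step : ∀ {i j k} → Adj Γ i j → Reach Γ j k → Reach Γ i k

Connected : ∀ {n} → SignedGraph n → Set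
Connected Γ = ∀ i j → Reach Γ i j

LeafFree : ∀ {n} → SignedGraph n → Set
LeafFree Γ = ∀ i → degree Γ i ≢ 1

Bicyclic : ∀ {n} → SignedGraph n → Set
Bicyclic {n} Γ = Connected Γ × numEdges Γ ≡ suc n

-- Adjacency matrix and nullity (multiplicity of eigenvalue 0).
-- The adjacency matrix is real symmetric, so the multiplicity of the
-- eigenvalue 0 equals dim ker A; A has rational entries so the kernel
-- dimension may be computed over ℚ.

signℚ : Maybe Sign → ℚ
signℚ nothing      = 0ℚ
signℚ (just plus)  = 1ℚ
signℚ (just minus) = - 1ℚ

adjMatrix : ∀ {n} → SignedGraph n → Fin n → Fin n → ℚ
adjMatrix Γ i j = signℚ (edge Γ i j)

InKernel : ∀ {n} → (Fin n → Fin n → ℚ) → (Fin n → ℚ) → Set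
InKernel A v = ∀ i → ∑ℚ (λ j → A i j *ℚ v j) ≡ 0ℚ

LinIndep : ∀ {n k} → (Fin k → Fin n → ℚ) → Set
LinIndep {n} {k} w =
  (c : Fin k → ℚ) → (∀ j → ∑ℚ (λ i → c i *ℚ w i j) ≡ 0ℚ) → ∀ i → c i ≡ 0ℚ

KerDimAtLeast : ∀ {n} → (Fin n → Fin n → ℚ) → ℕ → Set
KerDimAtLeast {n} A k =
  Σ (Fin k → Fin n → ℚ) λ w → LinIndep w × (∀ i → InKernel A (w i))

MatrixNullity : ∀ {n} → (Fin n → Fin n → ℚ) → ℕ → Set
MatrixNullity A k = KerDimAtLeast A k × ¬ KerDimAtLeast A (suc k)

Nullity : ∀ {n} → SignedGraph n → ℕ → Set
Nullity Γ k = MatrixNullity (adjMatrix Γ) k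

IsCycleSucc : ∀ {k} → Fin k → Fin k → Bool
IsCycleSucc {k} i j = ⌊ (suc (toℕ i) % suc (k ∸ 1)) ≟ toℕ j ⌋

record Cycle {n} (Γ : SignedGraph n) : Set where
  field
    len    : ℕ
    len≥3  : 3 ≤ len
    vs     : Fin len → Fin n
    inj    : ∀ i j → vs i ≡ vs j → i ≡ j
    closed : ∀ i j → T (IsCycleSucc i j) → Adj Γ (vs i) (vs j)
open Cycle public

cycleEdge : ∀ {n} (Γ : SignedGraph n) (C : Cycle Γ) → Fin (len C) → Fin (len C) → Maybe Sign
cycleEdge Γ C i j =
  if IsCycleSucc i j Data.Bool.∨ IsCycleSucc j i
  then edge Γ (vs C i) (vs C j) else nothing

cycleMatrix : ∀ {n} (Γ : SignedGraph n) (C : Cycle Γ) → Fin (len C) → Fin (len C) → ℚ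
cycleMatrix Γ C i j = signℚ (cycleEdge Γ C i j)

CycleNullity : ∀ {n} (Γ : SignedGraph n) → Cycle Γ → ℕ → Set
CycleNullity Γ C k = MatrixNullity (cycleMatrix Γ C) k

range : ℕ → ℕ → List ℕ
range a k = map (a +_) (upTo k)

chain : List ℕ → List (ℕ × ℕ)
chain []           = []
chain (x ∷ [])     = []
chain (x ∷ y ∷ xs) = (x , y) ∷ chain (y ∷ xs)

-- ∞(p,q,l): C_p on 0..p-1, C_q, and a path on l vertices joining 0 and
-- the base vertex of C_q (identified with 0 when l = 1).
inftyVerts : ℕ → ℕ → ℕ → ℕ
inftyVerts p q l = p + q + l ∸ 2

inftyEdges : ℕ → ℕ → ℕ → List (ℕ × ℕ)
inftyEdges p q zero          = []   -- not used (l ≥ 1)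
inftyEdges p q (suc zero)    =
  chain (0 ∷ range 1 (p ∸ 1) ++ (0 ∷ [])) ++
  chain (0 ∷ range p (q ∸ 1) ++ (0 ∷ []))
inftyEdges p q (suc (suc l)) =
  chain (0 ∷ range 1 (p ∸ 1) ++ (0 ∷ [])) ++
  chain (p ∷ range (suc p) (q ∸ 1) ++ (p ∷ [])) ++
  chain (0 ∷ range (p + q) l ++ (p ∷ []))

InftyParams : ℕ → ℕ → ℕ → Set
InftyParams p q l = 3 ≤ p × 3 ≤ q × 1 ≤ l

-- θ(p,q,l): three internally disjoint paths of lengths p,q,l between 0 and 1
thetaVerts : ℕ → ℕ → ℕ → ℕ
thetaVerts p q l = p + q + l ∸ 1

thetaEdges : ℕ → ℕ → ℕ → List (ℕ × ℕ)
thetaEdges p q l =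
  chain (0 ∷ range 2 (p ∸ 1) ++ (1 ∷ [])) ++
  chain (0 ∷ range (suc p) (q ∸ 1) ++ (1 ∷ [])) ++
  chain (0 ∷ range (p + q) (l ∸ 1) ++ (1 ∷ []))

ThetaParams : ℕ → ℕ → ℕ → Set
ThetaParams p q l =
  1 ≤ p × 1 ≤ q × 1 ≤ l ×
  ¬ (p ≡ 1 × q ≡ 1) × ¬ (p ≡ 1 × l ≡ 1) × ¬ (q ≡ 1 × l ≡ 1)

EdgeIn : List (ℕ × ℕ) → ℕ → ℕ → Set
EdgeIn es a b = (a , b) ∈ es ⊎ (b , a) ∈ es

IsoTo : ∀ {n} → SignedGraph n → (m : ℕ) → List (ℕ × ℕ) → Set
IsoTo {n} Γ m es =
  Σ (Fin n ↔ Fin m) λ f →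
    ∀ i j → Adj Γ i j ⇔ EdgeIn es (toℕ (Inverse.to f i)) (toℕ (Inverse.to f j))

{-# OPTIONS --safe #-}

-- Every leaf-free bicyclic graph is a spanning path h 0, …, h N with two extra edges (chords)
-- h 0 – h i and h N – h j: an ∞-graph if i ≤ j and a θ-graph if j < i.  Moreover the path can be
-- chosen so that any given cycle is h 0, …, h i: leave the cycle at a vertex of degree at least 3
-- and walk on until the walk meets itself; since the degrees sum to 2n + 2, nothing else is left.
--
-- At a vertex k off the chords a kernel vector v satisfies v (k - 1) = ± v (k + 1), so v is
-- determined by its values at 0, 1 and N, and the nullity is at most 3.  If it is 3, the kernel
-- vector with values 0, 1, 0 there is zero exactly at the even positions, and the equations at
-- 0 and N force i and j to be odd and N to be even.  The kernel vectors with values 1, 0, 0 and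
-- 0, 1, 0 vanish at i + 1, hence restrict to two independent kernel vectors of the cycle.
--
-- Conversely, on either side the parities of the lengths amount to n being odd once all cycles
-- are even.  If the cycles h 0, …, h i and h j, …, h N have nullity 2, then a kernel vector of
-- each that vanishes at the odd positions extends by zero to Γ, and a third kernel vector
-- lives on the odd positions.

module Submission where

open import Defs renaming (sym to edge-sym; inj to vs-injective)
open import Data.Bool using (Bool; true; false; T; not; if_then_else_; _∧_; _∨_)
open import Data.Bool.Properties using (T-∧; T-∨; ∧-identityʳ)
open import Data.Empty using (⊥; ⊥-elim)
open import Data.Fin using (Fin; toℕ; fromℕ<; punchIn; punchOut) renaming (zero to fz; suc to fs)
open import Data.Fin.Permutation using (↔⇒≡)
open import Data.Fin.Properties using (any?; toℕ-injective; toℕ<n; toℕ-fromℕ<; injective⇒≤; punchIn-punchOut; punchOut-injective) renaming (_≟_ to _≟F_; suc-injective to fs-injective)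
open import Data.List using (List; []; _∷_; _++_; length; map; applyUpTo)
open import Data.List.Properties using (length-map; map-applyUpTo)
import Data.List.Membership.DecPropositional as DecMembership
open import Data.List.Membership.Propositional using (_∈_; _∉_)
open import Data.List.Membership.Propositional.Properties using (∈-map⁻; ∈-++⁺ˡ; ∈-++⁺ʳ; ∈-++⁻)
open import Data.List.Relation.Unary.All using (All; []; _∷_)
import Data.List.Relation.Unary.All as All
import Data.List.Relation.Unary.All.Properties as AllP
open import Data.List.Relation.Unary.Any using (here; there)
open import Data.List.Relation.Unary.Unique.Propositional using (Unique; []; _∷_)
open import Data.Maybe using (just; nothing; is-just)
open import Data.Nat using (ℕ; zero; suc; _+_; _*_; _∸_; _≤_; _<_; z≤n; s≤s; _<?_; _≤?_; _%_; parity)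
open import Data.Nat.DivMod using (m%n<n; m≤n⇒m%n≡m; n%n≡0; m%n%n≡m%n; [m+n]%n≡m%n; %-distribˡ-+)
open import Data.Nat.Divisibility using (divides)
import Data.Nat.Properties as ℕP
open import Data.Nat.Tactic.RingSolver using (solve-∀)
open import Data.Parity.Base using (0ℙ; 1ℙ) renaming (_+_ to _+ℙ_)
import Data.Parity.Properties as ℙP
open import Data.Product using (Σ; _×_; _,_; ∃; proj₁; proj₂)
open import Data.Rational using (ℚ; 0ℚ; 1ℚ; ≢-nonZero; 1/_) renaming (_+_ to _+ℚ_; _*_ to _*ℚ_; -_ to -ℚ_)
import Data.Rational.Properties as ℚP
open import Data.Rational.Solver using (module +-*-Solver)
open import Data.Sign using () renaming (+ to plus; - to minus)
open import Data.Sum using (_⊎_; inj₁; inj₂; swap)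
open import Data.Unit using (tt)
open import Function using (_∘_; id)
open import Function.Bundles using (_↔_; mk↔ₛ′; Inverse; Injection; _⇔_; mk⇔; Equivalence)
open import Function.Properties.Inverse using (↔⇒↣)
open import Relation.Binary.Definitions using (tri<; tri≈; tri>)
open import Relation.Binary.PropositionalEquality using (_≡_; _≢_; refl; sym; trans; cong; cong₂; subst; subst₂; module ≡-Reasoning)
open import Relation.Nullary using (¬_; Dec; yes; no; does)
open import Relation.Nullary.Decidable using (⌊_⌋; ¬?; decidable-stable; dec-true; dec-false; toWitness; fromWitness; map′)
open import Algebra.Properties.CommutativeMonoid.Sum ℕP.+-0-commutativeMonoid using (sum; sum-cong-≗; ∑-distrib-+; ∑-comm)
open ≡-Reasoning
open +-*-Solver using (solve; _:+_; _:*_; :-_; _:=_; con)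

-- Linear algebra over ℚ

-- A spine shows two cycles directly, h 0 ... h i and h j ... h N. A θ-graph has a third one, which
-- is why the forward direction chooses a spine for each cycle. The obstacle to restricting a kernel
-- vector to h 0 ... h i is the edges that leave the cycle: one ends at i + 1, and one at N if j ≤
-- i. The vector must vanish at both. It is chosen to vanish at N, and the rows beyond i carry this
-- zero down in steps of two to i + 1, because N - (i + 1) is even.
--
-- In the converse the given isomorphism is never compared with the spine; it contributes the parity
-- of n = N + 1. Evenness of the cycle lengths i + 1 and N - j + 1 then makes i and j odd, so every
-- edge joins positions of opposite parity. The third vector solves a two-term recurrence along the
-- path; the equations at 0 and N are two further conditions on it, and nullity 2 of the two cycles
-- supplies them.
--
-- Dimensions are handled through evaluation at chosen vertices: injectivity on the kernel bounds a
-- nullity from above, a dual family from below.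

*-inverseʳ′ : ∀ a (a≢0 : a ≢ 0ℚ) → a *ℚ (1/ a) {{≢-nonZero a≢0}} ≡ 1ℚ
*-inverseʳ′ a a≢0 = ℚP.*-inverseʳ a {{≢-nonZero a≢0}}

*-cancelˡ-0 : ∀ {a b} → a ≢ 0ℚ → a *ℚ b ≡ 0ℚ → b ≡ 0ℚ
*-cancelˡ-0 {a} {b} a≢0 ab≡0 = begin
  b                   ≡⟨ ℚP.*-identityˡ b ⟨
  1ℚ *ℚ b             ≡⟨ cong (_*ℚ b) (*-inverseʳ′ a a≢0) ⟨
  (a *ℚ a⁻¹) *ℚ b     ≡⟨ solve 3 (λ a i b → (a :* i) :* b := i :* (a :* b)) refl a a⁻¹ b ⟩
  a⁻¹ *ℚ (a *ℚ b)     ≡⟨ cong (a⁻¹ *ℚ_) ab≡0 ⟩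
  a⁻¹ *ℚ 0ℚ           ≡⟨ ℚP.*-zeroʳ a⁻¹ ⟩
  0ℚ                  ∎
  where a⁻¹ = (1/ a) {{≢-nonZero a≢0}}

∑-cong : ∀ {n} {f g : Fin n → ℚ} → (∀ i → f i ≡ g i) → ∑ℚ f ≡ ∑ℚ g
∑-cong {zero}  eq = refl
∑-cong {suc n} eq = cong₂ _+ℚ_ (eq fz) (∑-cong (λ i → eq (fs i)))

∑-zero : ∀ {n} {f : Fin n → ℚ} → (∀ i → f i ≡ 0ℚ) → ∑ℚ f ≡ 0ℚ
∑-zero {zero}  eq = refl
∑-zero {suc n} eq = trans (cong₂ _+ℚ_ (eq fz) (∑-zero (λ i → eq (fs i)))) (ℚP.+-identityˡ 0ℚ)

∑-+ : ∀ {n} (f g : Fin n → ℚ) → ∑ℚ (λ i → f i +ℚ g i) ≡ ∑ℚ f +ℚ ∑ℚ g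
∑-+ {zero}  f g = sym (ℚP.+-identityˡ 0ℚ)
∑-+ {suc n} f g = begin
  (f fz +ℚ g fz) +ℚ ∑ℚ (λ i → f (fs i) +ℚ g (fs i))
    ≡⟨ cong ((f fz +ℚ g fz) +ℚ_) (∑-+ (λ i → f (fs i)) (λ i → g (fs i))) ⟩
  (f fz +ℚ g fz) +ℚ (∑ℚ (λ i → f (fs i)) +ℚ ∑ℚ (λ i → g (fs i)))
    ≡⟨ solve 4 (λ a b c d → (a :+ b) :+ (c :+ d) := (a :+ c) :+ (b :+ d)) refl (f fz) (g fz) _ _ ⟩
  (f fz +ℚ ∑ℚ (λ i → f (fs i))) +ℚ (g fz +ℚ ∑ℚ (λ i → g (fs i))) ∎

∑-*ˡ : ∀ {n} c (f : Fin n → ℚ) → ∑ℚ (λ i → c *ℚ f i) ≡ c *ℚ ∑ℚ f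
∑-*ˡ {zero}  c f = sym (ℚP.*-zeroʳ c)
∑-*ˡ {suc n} c f = trans (cong (c *ℚ f fz +ℚ_) (∑-*ˡ c (λ i → f (fs i))))
                         (sym (ℚP.*-distribˡ-+ c (f fz) _))

∑-*ʳ : ∀ {n} (f : Fin n → ℚ) c → ∑ℚ (λ i → f i *ℚ c) ≡ ∑ℚ f *ℚ c
∑-*ʳ f c = trans (∑-cong (λ i → ℚP.*-comm (f i) c)) (trans (∑-*ˡ c f) (ℚP.*-comm c _))

∑-swap : ∀ {m n} (f : Fin m → Fin n → ℚ) →
         ∑ℚ (λ i → ∑ℚ (λ j → f i j)) ≡ ∑ℚ (λ j → ∑ℚ (λ i → f i j))
∑-swap {zero} {n} f = sym (∑-zero {n} (λ _ → refl))
∑-swap {suc m} f = begin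
  ∑ℚ (f fz) +ℚ ∑ℚ (λ i → ∑ℚ (f (fs i)))
    ≡⟨ cong (∑ℚ (f fz) +ℚ_) (∑-swap (λ i → f (fs i))) ⟩
  ∑ℚ (f fz) +ℚ ∑ℚ (λ j → ∑ℚ (λ i → f (fs i) j))
    ≡⟨ ∑-+ (f fz) _ ⟨
  ∑ℚ (λ j → f fz j +ℚ ∑ℚ (λ i → f (fs i) j)) ∎

∑-one : ∀ {n} {f : Fin n → ℚ} a → (∀ i → i ≢ a → f i ≡ 0ℚ) → ∑ℚ f ≡ f a
∑-one {suc n} {f} fz off =
  trans (cong (f fz +ℚ_) (∑-zero (λ i → off (fs i) (λ ())))) (ℚP.+-identityʳ _)
∑-one {suc n} {f} (fs a) off =
  trans (cong₂ _+ℚ_ (off fz (λ ())) (∑-one a (λ i i≢a → off (fs i) (λ e → i≢a (fs-injective e)))))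
        (ℚP.+-identityˡ _)

∑-two : ∀ {n} {f : Fin n → ℚ} a b → a ≢ b → (∀ i → i ≢ a → i ≢ b → f i ≡ 0ℚ) → ∑ℚ f ≡ f a +ℚ f b
∑-two fz fz a≢b off = ⊥-elim (a≢b refl)
∑-two {f = f} fz (fs b) a≢b off =
  cong (f fz +ℚ_) (∑-one b (λ i i≢b → off (fs i) (λ ()) (λ e → i≢b (fs-injective e))))
∑-two {f = f} (fs a) fz a≢b off =
  trans (cong (f fz +ℚ_) (∑-one a (λ i i≢a → off (fs i) (λ e → i≢a (fs-injective e)) (λ ()))))
        (ℚP.+-comm (f fz) _)
∑-two {f = f} (fs a) (fs b) a≢b off =
  trans (cong₂ _+ℚ_ (off fz (λ ()) (λ ()))
           (∑-two a b (λ e → a≢b (cong fs e))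
             (λ i i≢a i≢b → off (fs i) (λ e → i≢a (fs-injective e)) (λ e → i≢b (fs-injective e)))))
        (ℚP.+-identityˡ _)

Dependence : ∀ {m k} → (Fin m → Fin k → ℚ) → Set
Dependence {m} w =
  Σ (Fin m → ℚ) λ c → (∃ λ i → c i ≢ 0ℚ) × (∀ j → ∑ℚ (λ i → c i *ℚ w i j) ≡ 0ℚ)

-- Gaussian elimination on a pivot column of the first vector.
dependent : ∀ k (w : Fin (suc k) → Fin k → ℚ) → Dependence w
dependent zero    w = (λ _ → 1ℚ) , (fz , λ ()) , λ ()
dependent (suc k) w with any? (λ j → ¬? (w fz j ℚP.≟ 0ℚ))
... | no ¬pivot = c , (fz , λ ()) , λ j → trans (cong₂ _+ℚ_ (vanish j) (∑-zero (λ i → ℚP.*-zeroˡ (w (fs i) j)))) (ℚP.+-identityˡ 0ℚ)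
  where
  c : Fin (suc (suc k)) → ℚ
  c fz     = 1ℚ
  c (fs _) = 0ℚ
  vanish : ∀ j → 1ℚ *ℚ w fz j ≡ 0ℚ
  vanish j = trans (ℚP.*-identityˡ _)
    (decidable-stable (w fz j ℚP.≟ 0ℚ) (λ w≢0 → ¬pivot (j , w≢0)))
... | yes (p , w₀p≢0) = c , (fs (proj₁ nonzero) , proj₂ nonzero) , combo
  where
  q : Fin (suc k) → ℚ
  q s = w (fs s) p *ℚ (1/ w fz p) {{≢-nonZero w₀p≢0}}

  eliminated : Fin (suc k) → Fin k → ℚ
  eliminated s j = w (fs s) (punchIn p j) +ℚ (-ℚ q s) *ℚ w fz (punchIn p j)

  rec : Dependence eliminated
  rec = dependent k eliminated

  c′ : Fin (suc k) → ℚ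
  c′ = proj₁ rec
  nonzero : ∃ λ i → c′ i ≢ 0ℚ
  nonzero = proj₁ (proj₂ rec)

  c : Fin (suc (suc k)) → ℚ
  -- The multiples of the first vector that elimination subtracted, gathered into one coefficient.
  c fz     = ∑ℚ (λ s → c′ s *ℚ (-ℚ q s))
  c (fs s) = c′ s

  reduced : ∀ j → ∑ℚ (λ i → c i *ℚ w i j) ≡ ∑ℚ (λ s → c′ s *ℚ (w (fs s) j +ℚ (-ℚ q s) *ℚ w fz j))
  reduced j = begin
    ∑ℚ (λ s → c′ s *ℚ (-ℚ q s)) *ℚ w fz j +ℚ ∑ℚ (λ s → c′ s *ℚ w (fs s) j)
      ≡⟨ cong (_+ℚ ∑ℚ (λ s → c′ s *ℚ w (fs s) j)) (∑-*ʳ (λ s → c′ s *ℚ (-ℚ q s)) (w fz j)) ⟨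
    ∑ℚ (λ s → (c′ s *ℚ (-ℚ q s)) *ℚ w fz j) +ℚ ∑ℚ (λ s → c′ s *ℚ w (fs s) j)
      ≡⟨ ∑-+ (λ s → (c′ s *ℚ (-ℚ q s)) *ℚ w fz j) (λ s → c′ s *ℚ w (fs s) j) ⟨
    ∑ℚ (λ s → (c′ s *ℚ (-ℚ q s)) *ℚ w fz j +ℚ c′ s *ℚ w (fs s) j)
      ≡⟨ ∑-cong (λ s → solve 4 (λ c q a b → (c :* q) :* a :+ c :* b := c :* (b :+ q :* a)) refl
                         (c′ s) (-ℚ q s) (w fz j) (w (fs s) j)) ⟩
    ∑ℚ (λ s → c′ s *ℚ (w (fs s) j +ℚ (-ℚ q s) *ℚ w fz j)) ∎

  pivot-column : ∀ s → c′ s *ℚ (w (fs s) p +ℚ (-ℚ q s) *ℚ w fz p) ≡ 0ℚ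
  pivot-column s = begin
    c′ s *ℚ (a +ℚ (-ℚ (a *ℚ i)) *ℚ b)
      ≡⟨ solve 4 (λ c a i b → c :* (a :+ (:- (a :* i)) :* b) := c :* (a :+ (:- (a :* (b :* i))))) refl (c′ s) a i b ⟩
    c′ s *ℚ (a +ℚ (-ℚ (a *ℚ (b *ℚ i))))
      ≡⟨ cong (λ z → c′ s *ℚ (a +ℚ (-ℚ (a *ℚ z)))) (*-inverseʳ′ b w₀p≢0) ⟩
    c′ s *ℚ (a +ℚ (-ℚ (a *ℚ 1ℚ)))
      ≡⟨ solve 2 (λ c a → c :* (a :+ (:- (a :* con 1ℚ))) := con 0ℚ) refl (c′ s) a ⟩
    0ℚ ∎
    where
    a = w (fs s) p
    b = w fz p
    i = (1/ w fz p) {{≢-nonZero w₀p≢0}}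

  combo : ∀ j → ∑ℚ (λ i → c i *ℚ w i j) ≡ 0ℚ
  combo j with p ≟F j
  ... | yes refl = trans (reduced p) (∑-zero pivot-column)
  ... | no p≢j = trans (reduced j)
          (subst (λ l → ∑ℚ (λ s → c′ s *ℚ (w (fs s) l +ℚ (-ℚ q s) *ℚ w fz l)) ≡ 0ℚ)
                 (punchIn-punchOut p≢j) (proj₂ (proj₂ rec) (punchOut p≢j)))

combination : ∀ {n k} → (Fin k → ℚ) → (Fin k → Fin n → ℚ) → Fin n → ℚ
combination c w j = ∑ℚ (λ i → c i *ℚ w i j)

combination-InKernel : ∀ {n k} (A : Fin n → Fin n → ℚ) (c : Fin k → ℚ) (w : Fin k → Fin n → ℚ) →
  (∀ i → InKernel A (w i)) → InKernel A (combination c w)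
combination-InKernel A c w ker r = begin
  ∑ℚ (λ j → A r j *ℚ ∑ℚ (λ i → c i *ℚ w i j))
    ≡⟨ ∑-cong (λ j → trans (sym (∑-*ˡ (A r j) (λ i → c i *ℚ w i j)))
         (∑-cong (λ i → solve 3 (λ a c w → a :* (c :* w) := c :* (a :* w)) refl (A r j) (c i) (w i j)))) ⟩
  ∑ℚ (λ j → ∑ℚ (λ i → c i *ℚ (A r j *ℚ w i j)))
    ≡⟨ ∑-swap (λ j i → c i *ℚ (A r j *ℚ w i j)) ⟩
  ∑ℚ (λ i → ∑ℚ (λ j → c i *ℚ (A r j *ℚ w i j)))
    ≡⟨ ∑-zero (λ i → trans (∑-*ˡ (c i) (λ j → A r j *ℚ w i j)) (trans (cong (c i *ℚ_) (ker i r)) (ℚP.*-zeroʳ (c i)))) ⟩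
  0ℚ ∎

-- Evaluation at the points `π j` is injective on the kernel. Every upper bound on a nullity is
-- obtained in this form.
Determines : ∀ {n k} → (Fin n → Fin n → ℚ) → (Fin k → Fin n) → Set
Determines A π = ∀ v → InKernel A v → (∀ j → v (π j) ≡ 0ℚ) → ∀ u → v u ≡ 0ℚ

-- Of `suc k` vectors restricted to `k` points some nontrivial combination vanishes at all the
-- points; as a kernel vector it is then zero everywhere, against independence.
Determines⇒¬KerDim : ∀ {n k} (A : Fin n → Fin n → ℚ) (π : Fin k → Fin n) →
  Determines A π → ¬ KerDimAtLeast A (suc k)
Determines⇒¬KerDim {k = k} A π det (w , indep , ker) with dependent k (λ i j → w i (π j))
... | c , (i , cᵢ≢0) , eq =
  cᵢ≢0 (indep c (det (combination c w) (combination-InKernel A c w ker) eq) i)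

-- The basis vectors and the target are k + 1 vectors in ℚᵏ, and the target occurs in any dependence between them.
interpolate : ∀ {n k} (A : Fin n → Fin n → ℚ) (π : Fin k → Fin n) → Determines A π →
  KerDimAtLeast A k → ∀ (c : Fin k → ℚ) → ∃ λ v → InKernel A v × (∀ j → v (π j) ≡ c j)
interpolate {k = k} A π det (w , indep , ker) c with dependent k rows
  where
  rows : Fin (suc k) → Fin k → ℚ
  rows fz     j = c j
  rows (fs i) j = w i (π j)
... | a , (i₀ , a≢0) , eq with a fz ℚP.≟ 0ℚ
...   | yes a₀≡0 = ⊥-elim (a≢0 (all-zero i₀))
  where
  a₊ : Fin k → ℚ
  a₊ i = a (fs i)
  a₊≡0 : ∀ i → a₊ i ≡ 0ℚ
  a₊≡0 = indep a₊ (det (combination a₊ w) (combination-InKernel A a₊ w ker) λ j → begin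
    ∑ℚ (λ i → a (fs i) *ℚ w i (π j))                     ≡⟨ ℚP.+-identityˡ _ ⟨
    0ℚ +ℚ ∑ℚ (λ i → a (fs i) *ℚ w i (π j))               ≡⟨ cong (_+ℚ ∑ℚ (λ i → a (fs i) *ℚ w i (π j))) (trans (cong (_*ℚ c j) a₀≡0) (ℚP.*-zeroˡ (c j))) ⟨
    a fz *ℚ c j +ℚ ∑ℚ (λ i → a (fs i) *ℚ w i (π j))      ≡⟨ eq j ⟩
    0ℚ ∎)
  all-zero : ∀ i → a i ≡ 0ℚ
  all-zero fz     = a₀≡0
  all-zero (fs i) = a₊≡0 i
...   | no a₀≢0 = combination b w , combination-InKernel A b w ker , value
  where
  t = (1/ a fz) {{≢-nonZero a₀≢0}}
  b : Fin k → ℚ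
  b i = (-ℚ t) *ℚ a (fs i)
  value : ∀ j → combination b w (π j) ≡ c j
  value j = begin
    ∑ℚ (λ i → ((-ℚ t) *ℚ a (fs i)) *ℚ w i (π j))
      ≡⟨ trans (∑-cong (λ i → ℚP.*-assoc (-ℚ t) (a (fs i)) (w i (π j)))) (∑-*ˡ (-ℚ t) (λ i → a (fs i) *ℚ w i (π j))) ⟩
    (-ℚ t) *ℚ S
      ≡⟨ solve 4 (λ t s a c → (:- t) :* s := (a :* t) :* c :+ (:- t) :* (a :* c :+ s)) refl t S (a fz) (c j) ⟩
    (a fz *ℚ t) *ℚ c j +ℚ (-ℚ t) *ℚ (a fz *ℚ c j +ℚ S)
      ≡⟨ cong₂ (λ x y → x *ℚ c j +ℚ (-ℚ t) *ℚ y) (*-inverseʳ′ (a fz) a₀≢0) (eq j) ⟩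
    1ℚ *ℚ c j +ℚ (-ℚ t) *ℚ 0ℚ
      ≡⟨ solve 2 (λ t c → con 1ℚ :* c :+ (:- t) :* con 0ℚ := c) refl t (c j) ⟩
    c j ∎
    where
    S = ∑ℚ (λ i → a (fs i) *ℚ w i (π j))

-- The values of the vectors at the points form an identity matrix, so evaluating a relation at
-- `π i` isolates `c i`.
KerDim-dual : ∀ {n k} (A : Fin n → Fin n → ℚ) (π : Fin k → Fin n) (w : Fin k → Fin n → ℚ) →
  (∀ i → InKernel A (w i)) → (∀ i → w i (π i) ≡ 1ℚ) → (∀ i j → i ≢ j → w i (π j) ≡ 0ℚ) →
  KerDimAtLeast A k
KerDim-dual A π w ker diag off = w , indep , ker
  where
  indep : LinIndep w
  indep c eq i = begin
    c i                              ≡⟨ ℚP.*-identityʳ (c i) ⟨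
    c i *ℚ 1ℚ                        ≡⟨ cong (c i *ℚ_) (diag i) ⟨
    c i *ℚ w i (π i)                 ≡⟨ ∑-one i (λ l l≢i → trans (cong (c l *ℚ_) (off l i l≢i)) (ℚP.*-zeroʳ (c l))) ⟨
    ∑ℚ (λ l → c l *ℚ w l (π i))      ≡⟨ eq (π i) ⟩
    0ℚ ∎

-- Degrees and edges

bit : Bool → ℕ
bit b = if b then 1 else 0

count≡sum : ∀ {n} (f : Fin n → Bool) → count f ≡ sum (bit ∘ f)
count≡sum {zero}  f = refl
count≡sum {suc n} f = cong (bit (f fz) +_) (count≡sum (f ∘ fs))

upDegree : ∀ {n} → SignedGraph n → Fin n → ℕ
upDegree Γ i = count (λ j → ⌊ toℕ i <? toℕ j ⌋ ∧ adj? Γ i j)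

-- The summation inside numEdges is a local definition; unification recovers it
-- once every argument in the goal has been generalised to a variable.
mutual
  localSum : ∀ {N} (Γ : SignedGraph N) {k} → (Fin k → ℕ) → ℕ
  localSum = _

  numEdges-localSum : ∀ {k} (Γ : SignedGraph (suc k)) →
    numEdges Γ ≡ upDegree Γ fz + localSum Γ (upDegree Γ ∘ fs)
  numEdges-localSum {k} Γ with upDegree Γ fz | upDegree Γ ∘ fs
  ... | _ | _ with suc k | Γ
  ... | _ | _ = refl

localSum≡sum : ∀ {N} (Γ : SignedGraph N) {k} (f : Fin k → ℕ) → localSum Γ f ≡ sum f
localSum≡sum Γ {zero}  f = refl
localSum≡sum Γ {suc k} f = cong (f fz +_) (localSum≡sum Γ (f ∘ fs))

numEdges≡sum : ∀ {n} (Γ : SignedGraph n) → numEdges Γ ≡ sum (upDegree Γ)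
numEdges≡sum {zero}  Γ = refl
numEdges≡sum {suc n} Γ =
  trans (numEdges-localSum Γ) (cong (upDegree Γ fz +_) (localSum≡sum Γ (upDegree Γ ∘ fs)))

Adj-sym : ∀ {n} (Γ : SignedGraph n) {i j} → Adj Γ i j → Adj Γ j i
Adj-sym Γ {i} {j} = subst (T ∘ is-just) (edge-sym Γ i j)

Adj-irrefl : ∀ {n} (Γ : SignedGraph n) {i j} → Adj Γ i j → i ≢ j
Adj-irrefl Γ {i} a refl = subst (T ∘ is-just) (loopless Γ i) a

-- `numEdges` counts an adjacent pair only from its smaller end. Each row of the adjacency table is
-- split at the diagonal, and exchanging the two sums identifies the lower part with the upper one.
handshake : ∀ {n} (Γ : SignedGraph n) → sum (degree Γ) ≡ numEdges Γ + numEdges Γ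
handshake {n} Γ = begin
  sum (degree Γ)
    ≡⟨ sum-cong-≗ (λ i → trans (count≡sum (adj? Γ i)) (trans (sum-cong-≗ (split i))
         (∑-distrib-+ (up i) (λ j → up j i)))) ⟩
  sum (λ i → sum (up i) + sum (λ j → up j i))
    ≡⟨ ∑-distrib-+ (λ i → sum (up i)) (λ i → sum (λ j → up j i)) ⟩
  sum (λ i → sum (up i)) + sum (λ i → sum (λ j → up j i))
    ≡⟨ cong (sum (λ i → sum (up i)) +_) (∑-comm (λ i j → up j i)) ⟩
  sum (λ i → sum (up i)) + sum (λ i → sum (up i))
    ≡⟨ cong₂ _+_ E≡ E≡ ⟨
  numEdges Γ + numEdges Γ ∎
  where
  up : Fin n → Fin n → ℕ
  up i j = bit (⌊ toℕ i <? toℕ j ⌋ ∧ adj? Γ i j)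

  E≡ : numEdges Γ ≡ sum (λ i → sum (up i))
  E≡ = trans (numEdges≡sum Γ) (sum-cong-≗ (λ i → count≡sum (λ j → ⌊ toℕ i <? toℕ j ⌋ ∧ adj? Γ i j)))

  split : ∀ i j → bit (adj? Γ i j) ≡ up i j + up j i
  split i j with toℕ i <? toℕ j | toℕ j <? toℕ i
  ... | yes i<j | yes j<i = ⊥-elim (ℕP.<-asym i<j j<i)
  ... | yes i<j | no _    = sym (ℕP.+-identityʳ _)
  ... | no _    | yes j<i = cong (bit ∘ is-just) (edge-sym Γ i j)
  ... | no i≮j  | no j≮i  =
    trans (cong (λ l → bit (adj? Γ i l)) (sym i≡j)) (cong (bit ∘ is-just) (loopless Γ i))
    where
    i≡j : i ≡ j
    i≡j = toℕ-injective (ℕP.≤-antisym (ℕP.≮⇒≥ j≮i) (ℕP.≮⇒≥ i≮j))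

_∖_ : ∀ {n} → (Fin n → Bool) → Fin n → Fin n → Bool
(f ∖ a) i = f i ∧ not (does (a ≟F i))

∖-intro : ∀ {n} (f : Fin n → Bool) {a i} → T (f i) → a ≢ i → T ((f ∖ a) i)
∖-intro f {a} {i} fi a≢i =
  Equivalence.from T-∧ (fi , subst (T ∘ not) (sym (dec-false (a ≟F i) a≢i)) tt)

∖-elim : ∀ {n} (f : Fin n → Bool) {a i} → T ((f ∖ a) i) → T (f i) × a ≢ i
∖-elim f {a} {i} t with Equivalence.to T-∧ t
... | fi , na = fi , λ a≡i → subst (T ∘ not) (dec-true (a ≟F i) a≡i) na

count-cong : ∀ {n} {f g : Fin n → Bool} → (∀ i → f i ≡ g i) → count f ≡ count g
count-cong {zero}  eq = refl
count-cong {suc n} eq = cong₂ _+_ (cong bit (eq fz)) (count-cong (λ i → eq (fs i)))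

count-∖ : ∀ {n} (f : Fin n → Bool) a → count f ≡ bit (f a) + count (f ∖ a)
count-∖ {suc n} f fz with f fz
... | true  = cong suc (count-cong (λ i → sym (∧-identityʳ (f (fs i)))))
... | false = count-cong (λ i → sym (∧-identityʳ (f (fs i))))
count-∖ {suc n} f (fs a) = begin
  bit (f fz) + count (f ∘ fs)
    ≡⟨ cong (bit (f fz) +_) (count-∖ (f ∘ fs) a) ⟩
  bit (f fz) + (bit (f (fs a)) + count ((f ∘ fs) ∖ a))
    ≡⟨ shuffle (bit (f fz)) (bit (f (fs a))) _ ⟩
  bit (f (fs a)) + (bit (f fz) + count ((f ∘ fs) ∖ a))
    ≡⟨ cong (λ b → bit (f (fs a)) + (bit b + count ((f ∘ fs) ∖ a))) (∧-identityʳ (f fz)) ⟨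
  bit (f (fs a)) + (bit (f fz ∧ true) + count ((f ∘ fs) ∖ a)) ∎
  where
  shuffle : ∀ x y z → x + (y + z) ≡ y + (x + z)
  shuffle = solve-∀

bit-T : ∀ {b} → T b → bit b ≡ 1
bit-T {true} _ = refl

bit≤1 : ∀ b → bit b ≤ 1
bit≤1 true  = ℕP.≤-refl
bit≤1 false = z≤n

length≤count : ∀ {n} (f : Fin n → Bool) {xs} → Unique xs → All (T ∘ f) xs → length xs ≤ count f
length≤count f []        []         = z≤n
length≤count f {x ∷ xs} (x∉ ∷ u) (fx ∷ fxs) =
  subst (suc (length xs) ≤_) (sym (trans (count-∖ f x) (cong (_+ count (f ∖ x)) (bit-T fx))))
    (s≤s (length≤count (f ∖ x) u (All.map (λ (fi , x≢i) → ∖-intro f fi x≢i) (All.zip (fxs , x∉)))))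

count-witness : ∀ {n} (f : Fin n → Bool) → 0 < count f → ∃ λ i → T (f i)
count-witness {suc n} f 0<c with f fz in eq
... | true  = fz , subst T (sym eq) tt
... | false with count-witness (f ∘ fs) 0<c
...   | i , fi = fs i , fi

-- Crossing out a point lowers the count by at most one. This supplies the next vertex of a walk
-- that has to avoid the vertices in `xs`.
count-fresh : ∀ {n} (f : Fin n → Bool) xs → length xs < count f → ∃ λ i → T (f i) × i ∉ xs
count-fresh f [] 0<c with count-witness f 0<c
... | i , fi = i , fi , λ ()
count-fresh f (x ∷ xs) l<c with count-fresh (f ∖ x) xs
  (ℕP.≤-pred (ℕP.≤-trans l<c (subst (_≤ suc (count (f ∖ x))) (sym (count-∖ f x))
     (ℕP.+-monoˡ-≤ (count (f ∖ x)) (bit≤1 (f x))))))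
... | i , t , i∉ with ∖-elim f t
...   | fi , x≢i = i , fi , λ { (here i≡x) → x≢i (sym i≡x) ; (there i∈) → i∉ i∈ }

-- A point outside the list could be prepended to it, making the list longer than the count. This
-- turns an upper bound on a degree into a complete neighbourhood.
count-exhaust : ∀ {n} (f : Fin n → Bool) {xs} → Unique xs → All (T ∘ f) xs → count f ≤ length xs →
  ∀ {y} → T (f y) → y ∈ xs
count-exhaust {n} f {xs} u all c≤l {y} fy with y ∈? xs
  where open DecMembership (_≟F_ {n}) using (_∈?_)
... | yes y∈ = y∈
... | no y∉ = ⊥-elim (ℕP.<⇒≱ (length≤count f (AllP.¬Any⇒All¬ xs y∉ ∷ u) (fy ∷ all)) c≤l)

sum-mono-≤ : ∀ {n} {f g : Fin n → ℕ} → (∀ i → g i ≤ f i) → sum g ≤ sum f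
sum-mono-≤ {zero}  le = z≤n
sum-mono-≤ {suc n} le = ℕP.+-mono-≤ (le fz) (sum-mono-≤ (λ i → le (fs i)))

-- Cancelling the inequalities of all other terms leaves the one for term `i`. With `f` the degrees,
-- a total without slack turns every lower bound into an equality.
sum-tight : ∀ {n} {f g : Fin n → ℕ} → (∀ i → g i ≤ f i) → sum f ≤ sum g → ∀ i → f i ≤ g i
sum-tight {suc n} {f} {g} le sf≤sg fz =
  ℕP.+-cancelʳ-≤ (sum (g ∘ fs)) (f fz) (g fz)
    (ℕP.≤-trans (ℕP.+-monoʳ-≤ (f fz) (sum-mono-≤ (λ i → le (fs i)))) sf≤sg)
sum-tight {suc n} {f} {g} le sf≤sg (fs i) =
  sum-tight (λ i → le (fs i))
    (ℕP.+-cancelˡ-≤ (g fz) _ _ (ℕP.≤-trans (ℕP.+-monoˡ-≤ (sum (f ∘ fs)) (le fz)) sf≤sg)) i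

sum-const : ∀ n c → sum {n} (λ _ → c) ≡ n * c
sum-const zero    c = refl
sum-const (suc n) c = cong (c +_) (sum-const n c)

δ : ∀ {n} → Fin n → Fin n → ℕ
δ a i = bit (does (a ≟F i))

sum-δ : ∀ {n} (a : Fin n) → sum (δ a) ≡ 1
sum-δ {suc n} fz     = cong suc (trans (sum-const n 0) (ℕP.*-zeroʳ n))
sum-δ {suc n} (fs a) = sum-δ a

-- The degrees of a spine: 2 at each vertex, plus one for each chord arriving there from an end of
-- the path. The total is twice the edge number n + 1.
sum-2+δ+δ : ∀ {n} (a b : Fin n) → sum (λ i → 2 + (δ a i + δ b i)) ≡ suc n + suc n
sum-2+δ+δ {n} a b = begin
  sum (λ i → 2 + (δ a i + δ b i))            ≡⟨ ∑-distrib-+ (λ _ → 2) (λ i → δ a i + δ b i) ⟩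
  sum {n} (λ _ → 2) + sum (λ i → δ a i + δ b i) ≡⟨ cong₂ _+_ (sum-const n 2) (∑-distrib-+ (δ a) (δ b)) ⟩
  n * 2 + (sum (δ a) + sum (δ b))            ≡⟨ cong₂ (λ x y → n * 2 + (x + y)) (sum-δ a) (sum-δ b) ⟩
  n * 2 + 2                                  ≡⟨ lem n ⟩
  suc n + suc n                              ∎
  where
  lem : ∀ n → n * 2 + 2 ≡ suc n + suc n
  lem = solve-∀

Reach-closed : ∀ {n} (Γ : SignedGraph n) (P : Fin n → Set) →
  (∀ {u w} → P u → Adj Γ u w → P w) → ∀ {u w} → Reach Γ u w → P u → P w
Reach-closed Γ P cl Reach.here       p = p
Reach-closed Γ P cl (Reach.step a r) p = Reach-closed Γ P cl r (cl p a)

inhabited : ∀ {n} {P : Fin n → Set} → ¬ (∀ u → P u) → Fin n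
inhabited {zero}  ¬∀ = ⊥-elim (¬∀ λ ())
inhabited {suc n} _  = fz

module LeafFreeBicyclic {n} (Γ : SignedGraph n) (leafFree : LeafFree Γ) (bicyclic : Bicyclic Γ) where

  ∑degree : sum (degree Γ) ≡ suc n + suc n
  ∑degree = trans (handshake Γ) (cong₂ _+_ (proj₂ bicyclic) (proj₂ bicyclic))

  reach-all : (P : Fin n → Set) → (∀ {u w} → P u → Adj Γ u w → P w) → ∀ {u} → P u → ∀ w → P w
  reach-all P cl {u} p w = Reach-closed Γ P cl (proj₁ bicyclic u w) p

  -- Degrees of at most 2 would sum to at most 2n, while the sum is 2n + 2. The same fact shows that
  -- there is a vertex at all and that every cycle has a branching vertex.
  ¬degree≤2 : ¬ (∀ u → degree Γ u ≤ 2)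
  ¬degree≤2 le = ℕP.<⇒≱ lt (subst (_≤ n * 2) ∑degree (subst (sum (degree Γ) ≤_) (sum-const n 2) (sum-mono-≤ le)))
    where
    lem : ∀ n → n * 2 + 2 ≡ suc n + suc n
    lem = solve-∀
    lt : n * 2 < suc n + suc n
    lt = subst (n * 2 <_) (lem n) (ℕP.m<m+n (n * 2) (s≤s z≤n))

  2≤degree : ∀ u → 2 ≤ degree Γ u
  2≤degree u with degree Γ u in eq
  -- By connectedness an isolated vertex would be the only one, so no degree would exceed 2.
  ... | 0 = ⊥-elim (¬degree≤2 (λ w → subst (λ x → degree Γ x ≤ 2) (isolated w) (subst (_≤ 2) (sym eq) z≤n)))
    where
    no-neighbour : ∀ {w} → ¬ Adj Γ u w
    no-neighbour a = ℕP.<⇒≱ (length≤count (adj? Γ u) ([] ∷ []) (a ∷ [])) (ℕP.≤-reflexive eq)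
    isolated : ∀ w → u ≡ w
    isolated = reach-all (u ≡_) (λ { refl a → ⊥-elim (no-neighbour a) }) refl
  ... | 1 = ⊥-elim (leafFree u eq)
  ... | suc (suc _) = s≤s (s≤s z≤n)

  degree-tight : ∀ a b → (∀ u → 2 + (δ a u + δ b u) ≤ degree Γ u) → ∀ u → degree Γ u ≤ 2 + (δ a u + δ b u)
  degree-tight a b le = sum-tight le (ℕP.≤-reflexive (trans ∑degree (sym (sum-2+δ+δ a b))))

  vertex : Fin n
  vertex = inhabited ¬degree≤2

-- Cycles, paths and spines

suc-% : ∀ t m → suc (t % suc m) % suc m ≡ suc t % suc m
suc-% t m = begin
  (1 + t % suc m) % suc m                      ≡⟨ %-distribˡ-+ 1 (t % suc m) (suc m) ⟩
  (1 % suc m + t % suc m % suc m) % suc m      ≡⟨ cong (λ z → (1 % suc m + z) % suc m) (m%n%n≡m%n t (suc m)) ⟩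
  (1 % suc m + t % suc m) % suc m              ≡⟨ %-distribˡ-+ 1 t (suc m) ⟨
  (1 + t) % suc m                              ∎

%-cancel-suc : ∀ m a b → suc a % suc m ≡ suc b % suc m → a % suc m ≡ b % suc m
%-cancel-suc m a b eq = begin
  a % suc m                              ≡⟨ shift a ⟨
  (m + suc a) % suc m                    ≡⟨ %-distribˡ-+ m (suc a) (suc m) ⟩
  (m % suc m + suc a % suc m) % suc m    ≡⟨ cong (λ z → (m % suc m + z) % suc m) eq ⟩
  (m % suc m + suc b % suc m) % suc m    ≡⟨ %-distribˡ-+ m (suc b) (suc m) ⟨
  (m + suc b) % suc m                    ≡⟨ shift b ⟩
  b % suc m                              ∎
  where
  shift : ∀ x → (m + suc x) % suc m ≡ x % suc m
  shift x = trans (cong (_% suc m) (trans (ℕP.+-suc m x) (ℕP.+-comm (suc m) x))) ([m+n]%n≡m%n x (suc m))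

%-cancelˡ : ∀ m r a b → (r + a) % suc m ≡ (r + b) % suc m → a % suc m ≡ b % suc m
%-cancelˡ m zero    a b eq = eq
%-cancelˡ m (suc r) a b eq = %-cancelˡ m r a b (%-cancel-suc m (r + a) (r + b) eq)

-- The cycle becomes a walk `W` over all natural numbers with period `suc m`, so that the neighbours
-- of `W (suc t)` are `W t` and `W (2 + t)` even across the seam. `m` is the length minus one
-- because `IsCycleSucc` reduces modulo `suc (k ∸ 1)`.
module CycleWalk {n} {Γ : SignedGraph n} (C : Cycle Γ) where

  m : ℕ
  m = len C ∸ 1

  len≡ : len C ≡ suc m
  len≡ = sym (ℕP.m+[n∸m]≡n (ℕP.≤-trans (s≤s z≤n) (len≥3 C)))

  2≤m : 2 ≤ m
  2≤m = ℕP.≤-pred (subst (3 ≤_) len≡ (len≥3 C))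

  idx : ℕ → Fin (len C)
  idx t = fromℕ< (subst (t % suc m <_) (sym len≡) (m%n<n t (suc m)))

  toℕ-idx : ∀ t → toℕ (idx t) ≡ t % suc m
  toℕ-idx t = toℕ-fromℕ< _

  toℕ≤m : ∀ (b : Fin (len C)) → toℕ b ≤ m
  toℕ≤m b = ℕP.≤-pred (subst (toℕ b <_) len≡ (toℕ<n b))

  idx-toℕ : ∀ b → idx (toℕ b) ≡ b
  idx-toℕ b = toℕ-injective (trans (toℕ-idx (toℕ b)) (m≤n⇒m%n≡m (toℕ≤m b)))

  idx-cong : ∀ t s → t % suc m ≡ s % suc m → idx t ≡ idx s
  idx-cong t s eq = toℕ-injective (trans (toℕ-idx t) (trans eq (sym (toℕ-idx s))))

  idx-injective : ∀ t s → idx t ≡ idx s → t % suc m ≡ s % suc m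
  idx-injective t s eq = trans (sym (toℕ-idx t)) (trans (cong toℕ eq) (toℕ-idx s))

  idx-period : ∀ t → idx (t + suc m) ≡ idx t
  idx-period t = idx-cong (t + suc m) t ([m+n]%n≡m%n t (suc m))

  idx-succ : ∀ t → T (IsCycleSucc (idx t) (idx (suc t)))
  idx-succ t = fromWitness (begin
    suc (toℕ (idx t)) % suc m  ≡⟨ cong (λ z → suc z % suc m) (toℕ-idx t) ⟩
    suc (t % suc m) % suc m    ≡⟨ suc-% t m ⟩
    suc t % suc m              ≡⟨ toℕ-idx (suc t) ⟨
    toℕ (idx (suc t))          ∎)

  succ-unique : ∀ t b → T (IsCycleSucc (idx t) b) → b ≡ idx (suc t)
  succ-unique t b s = toℕ-injective (trans (sym (toWitness s)) (toWitness (idx-succ t)))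

  pred-unique : ∀ t b → T (IsCycleSucc b (idx (suc t))) → b ≡ idx t
  pred-unique t b s = trans (sym (idx-toℕ b)) (idx-cong (toℕ b) t
    (%-cancel-suc m (toℕ b) t (trans (toWitness s) (toℕ-idx (suc t)))))

  W : ℕ → Fin n
  W t = vs C (idx t)

  W-adj : ∀ t → Adj Γ (W t) (W (suc t))
  W-adj t = closed C _ _ (idx-succ t)

  W-injective : ∀ t s → W t ≡ W s → t % suc m ≡ s % suc m
  W-injective t s eq = idx-injective t s (vs-injective C _ _ eq)

  W-shift-injective : ∀ r {a b} → a ≤ m → b ≤ m → W (r + a) ≡ W (r + b) → a ≡ b
  W-shift-injective r {a} {b} a≤m b≤m eq = trans (sym (m≤n⇒m%n≡m a≤m))
    (trans (%-cancelˡ m r a b (W-injective (r + a) (r + b) eq)) (m≤n⇒m%n≡m b≤m))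

  idx-distinct : ∀ t → idx t ≢ idx (2 + t)
  idx-distinct t eq = ℕP.<⇒≢ (s≤s z≤n) (W-shift-injective t z≤n 2≤m
    (cong (vs C) (trans (cong idx (ℕP.+-identityʳ t)) (trans eq (cong idx (ℕP.+-comm 2 t))))))

  W-period : ∀ t → W (t + suc m) ≡ W t
  W-period t = cong (vs C) (idx-period t)

  shift-surjective : ∀ r → r ≤ suc m → ∀ b → ∃ λ s → s ≤ m × idx (r + s) ≡ b
  shift-surjective r r≤p b with r ≤? toℕ b
  ... | yes r≤b = toℕ b ∸ r , ℕP.≤-trans (ℕP.m∸n≤m (toℕ b) r) (toℕ≤m b) ,
                  trans (cong idx (ℕP.m+[n∸m]≡n r≤b)) (idx-toℕ b)
  ... | no r≰b = toℕ b + (suc m ∸ r) , ℕP.≤-pred s<p , (begin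
      idx (r + (toℕ b + (suc m ∸ r)))   ≡⟨ cong idx (shuffle r (toℕ b) (suc m ∸ r)) ⟩
      idx (toℕ b + (r + (suc m ∸ r)))   ≡⟨ cong (λ z → idx (toℕ b + z)) (ℕP.m+[n∸m]≡n r≤p) ⟩
      idx (toℕ b + suc m)               ≡⟨ idx-period (toℕ b) ⟩
      idx (toℕ b)                       ≡⟨ idx-toℕ b ⟩
      b                                 ∎)
    where
    shuffle : ∀ x y z → x + (y + z) ≡ y + (x + z)
    shuffle = solve-∀
    s<p : toℕ b + (suc m ∸ r) < suc m
    s<p = subst (toℕ b + (suc m ∸ r) <_) (ℕP.m+[n∸m]≡n r≤p) (ℕP.+-monoˡ-< (suc m ∸ r) (ℕP.≰⇒> r≰b))

record IsPath {n} (Γ : SignedGraph n) (h : ℕ → Fin n) (N : ℕ) : Set where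
  field
    injective : ∀ {a b} → a ≤ N → b ≤ N → h a ≡ h b → a ≡ b
    linked    : ∀ {k} → k < N → Adj Γ (h k) (h (suc k))

module _ {n} {Γ : SignedGraph n} where

  onPath? : ∀ (h : ℕ → Fin n) N u → Dec (∃ λ k → k ≤ N × h k ≡ u)
  onPath? h N u = map′ (λ (t , eq) → toℕ t , ℕP.≤-pred (toℕ<n t) , eq)
    (λ (k , k≤N , eq) → fromℕ< (s≤s k≤N) , trans (cong h (toℕ-fromℕ< (s≤s k≤N))) eq)
    (any? (λ (t : Fin (suc N)) → h (toℕ t) ≟F u))

  path-length : ∀ {h N} → IsPath Γ h N → suc N ≤ n
  path-length {h} {N} path = injective⇒≤ {f = λ (t : Fin (suc N)) → h (toℕ t)}
    (λ eq → toℕ-injective (IsPath.injective path (ℕP.≤-pred (toℕ<n _)) (ℕP.≤-pred (toℕ<n _)) eq))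

  cycleFromPath : ∀ (h : ℕ → Fin n) m → 2 ≤ m → IsPath Γ h m → Adj Γ (h m) (h 0) → Cycle Γ
  cycleFromPath h m 2≤m path back = record
    { len = suc m
    ; len≥3 = s≤s 2≤m
    ; vs = λ t → h (toℕ t)
    ; inj = λ a b eq → toℕ-injective (IsPath.injective path (ℕP.≤-pred (toℕ<n a)) (ℕP.≤-pred (toℕ<n b)) eq)
    ; closed = closing
    }
    where
    closing : ∀ a b → T (IsCycleSucc {suc m} a b) → Adj Γ (h (toℕ a)) (h (toℕ b))
    closing a b s with ℕP.m≤n⇒m<n∨m≡n (ℕP.≤-pred (toℕ<n a))
    ... | inj₁ a<m = subst (λ z → Adj Γ (h (toℕ a)) (h z))
                       (trans (sym (m≤n⇒m%n≡m a<m)) (toWitness s)) (IsPath.linked path a<m)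
    ... | inj₂ a≡m = subst₂ (λ y z → Adj Γ (h y) (h z)) (sym a≡m)
                       (trans (sym (n%n≡0 (suc m))) (trans (cong (λ z → suc z % suc m) (sym a≡m)) (toWitness s))) back

  snoc : (ℕ → Fin n) → ℕ → Fin n → ℕ → Fin n
  snoc h N d k = if does (k ≤? N) then h k else d

  snoc-≤ : ∀ h N d {k} → k ≤ N → snoc h N d k ≡ h k
  snoc-≤ h N d {k} k≤N = cong (λ b → if b then h k else d) (dec-true (k ≤? N) k≤N)

  snoc-last : ∀ h N d → snoc h N d (suc N) ≡ d
  snoc-last h N d = cong (λ b → if b then h (suc N) else d) (dec-false (suc N ≤? N) ℕP.1+n≰n)

  snoc-path : ∀ {h N d} → IsPath Γ h N → Adj Γ (h N) d → (∀ {k} → k ≤ N → h k ≢ d) →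
    IsPath Γ (snoc h N d) (suc N)
  snoc-path {h} {N} {d} path a fresh = record { injective = injective ; linked = linked }
    where
    injective : ∀ {a b} → a ≤ suc N → b ≤ suc N → snoc h N d a ≡ snoc h N d b → a ≡ b
    injective {a} {b} a≤ b≤ eq with ℕP.m≤n⇒m<n∨m≡n a≤ | ℕP.m≤n⇒m<n∨m≡n b≤
    ... | inj₁ (s≤s a≤N) | inj₁ (s≤s b≤N) = IsPath.injective path a≤N b≤N
            (trans (sym (snoc-≤ h N d a≤N)) (trans eq (snoc-≤ h N d b≤N)))
    ... | inj₁ (s≤s a≤N) | inj₂ refl = ⊥-elim (fresh a≤N
            (trans (sym (snoc-≤ h N d a≤N)) (trans eq (snoc-last h N d))))
    ... | inj₂ refl | inj₁ (s≤s b≤N) = ⊥-elim (fresh b≤N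
            (trans (sym (snoc-≤ h N d b≤N)) (trans (sym eq) (snoc-last h N d))))
    ... | inj₂ a≡ | inj₂ b≡ = trans a≡ (sym b≡)

    linked : ∀ {k} → k < suc N → Adj Γ (snoc h N d k) (snoc h N d (suc k))
    linked {k} (s≤s k≤N) with ℕP.m≤n⇒m<n∨m≡n k≤N
    ... | inj₁ k<N = subst₂ (Adj Γ) (sym (snoc-≤ h N d k≤N)) (sym (snoc-≤ h N d k<N)) (IsPath.linked path k<N)
    ... | inj₂ refl = subst₂ (Adj Γ) (sym (snoc-≤ h N d k≤N)) (sym (snoc-last h N d)) a

-- Adjacency of positions k and l on a path 0 … N with chords 0 – i and N – j (bounds are kept separately).
data Link (N i j k l : ℕ) : Set where
  next   : l ≡ suc k → Link N i j k l
  prev   : k ≡ suc l → Link N i j k l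
  chord₀ : k ≡ 0 → l ≡ i → Link N i j k l
  chordᵢ : k ≡ i → l ≡ 0 → Link N i j k l
  chordₙ : k ≡ N → l ≡ j → Link N i j k l
  chordⱼ : k ≡ j → l ≡ N → Link N i j k l

link-adj : ∀ {n} {Γ : SignedGraph n} {h N i j} → IsPath Γ h N → Adj Γ (h 0) (h i) → Adj Γ (h N) (h j) →
  ∀ {k l} → k ≤ N → l ≤ N → Link N i j k l → Adj Γ (h k) (h l)
link-adj {Γ = Γ} path adj₀ adjₙ k≤ l≤ = λ where
  (next refl)        → IsPath.linked path l≤
  (prev refl)        → Adj-sym Γ (IsPath.linked path k≤)
  (chord₀ refl refl) → adj₀
  (chordᵢ refl refl) → Adj-sym Γ adj₀
  (chordₙ refl refl) → adjₙ
  (chordⱼ refl refl) → Adj-sym Γ adjₙ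

-- A spanning path whose two ends are joined back to the path by the chords 0 – i and N – j,
-- with no further edges: an ∞-graph when i ≤ j and a θ-graph when j < i.
record Spine {n} (Γ : SignedGraph n) : Set where
  field
    h        : ℕ → Fin n
    N i j    : ℕ
    2≤i      : 2 ≤ i
    i≤N      : i ≤ N
    2+j≤N    : 2 + j ≤ N
    -- With i = N and j = 0 both chords would be the same edge.
    distinct : ¬ (i ≡ N × j ≡ 0)
    path     : IsPath Γ h N
    adj₀     : Adj Γ (h 0) (h i)
    adjₙ     : Adj Γ (h N) (h j)
    spanning : ∀ u → ∃ λ k → k ≤ N × h k ≡ u
    links    : ∀ {k l} → k ≤ N → l ≤ N → Adj Γ (h k) (h l) → Link N i j k l

  open IsPath path public

  j≤N : j ≤ N
  j≤N = ℕP.≤-trans (ℕP.m≤n+m j 2) 2+j≤N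

  2≤N : 2 ≤ N
  2≤N = ℕP.≤-trans 2≤i i≤N

  n≡sucN : n ≡ suc N
  n≡sucN = ℕP.≤-antisym (injective⇒≤ {f = λ u → fromℕ< (s≤s (proj₁ (proj₂ (spanning u))))} inj′) (path-length path)
    where
    inj′ : ∀ {u w} → fromℕ< (s≤s (proj₁ (proj₂ (spanning u)))) ≡ fromℕ< (s≤s (proj₁ (proj₂ (spanning w)))) → u ≡ w
    inj′ {u} {w} eq = trans (sym (proj₂ (proj₂ (spanning u)))) (trans (cong h
      (trans (sym (toℕ-fromℕ< (s≤s (proj₁ (proj₂ (spanning u)))))) (trans (cong toℕ eq) (toℕ-fromℕ< (s≤s (proj₁ (proj₂ (spanning w))))))))
      (proj₂ (proj₂ (spanning w))))

-- Existence of a spine along a given cycle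

module Structure {n} (Γ : SignedGraph n) (leafFree : LeafFree Γ) (bicyclic : Bicyclic Γ) where
  open LeafFreeBicyclic Γ leafFree bicyclic

  -- Neither spanning nor the absence of further edges is assumed: a path with two chords uses up
  -- the whole degree sum, and connectedness then puts every vertex on the path.
  module Complete (h : ℕ → Fin n) (N i j : ℕ) (2≤i : 2 ≤ i) (i≤N : i ≤ N) (2+j≤N : 2 + j ≤ N)
    (distinct : ¬ (i ≡ N × j ≡ 0)) (path : IsPath Γ h N)
    (adj₀ : Adj Γ (h 0) (h i)) (adjₙ : Adj Γ (h N) (h j)) where

    open IsPath path

    -- An interior position has two path neighbours, an end of the path has one path neighbour and
    -- its own chord. The far ends i and j receive a chord on top of these two.
    Δ : ℕ → ℕ
    Δ k = 2 + (δ (h i) (h k) + δ (h j) (h k))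

    -- Distinct linked positions, as many as `Δ k`: at first a lower bound for the degree, and the
    -- complete neighbourhood once the degree sum has been used.
    record Neighbours (k : ℕ) : Set where
      field
        ps     : List ℕ
        good   : All (λ l → l ≤ N × Link N i j k l) ps
        unique : Unique ps
        size   : length ps ≡ Δ k

    δ-yes : ∀ {a k} → k ≡ a → δ (h a) (h k) ≡ 1
    δ-yes {a} {k} eq = cong bit (dec-true (h a ≟F h k) (cong h (sym eq)))

    δ-no : ∀ {a k} → a ≤ N → k ≤ N → k ≢ a → δ (h a) (h k) ≡ 0
    δ-no {a} {k} a≤ k≤ k≢a = cong bit (dec-false (h a ≟F h k) (λ eq → k≢a (sym (injective a≤ k≤ eq))))

    j≤N : j ≤ N
    j≤N = ℕP.≤-trans (ℕP.m≤n+m j 2) 2+j≤N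
    2≤N : 2 ≤ N
    2≤N = ℕP.≤-trans 2≤i i≤N
    0<i : 0 < i
    0<i = ℕP.≤-trans (s≤s z≤n) 2≤i
    1≤N : 1 ≤ N
    1≤N = ℕP.≤-trans (s≤s z≤n) 2≤N
    j<N : j < N
    j<N = ℕP.≤-trans (ℕP.n≤1+n (suc j)) 2+j≤N

    size-lemma : ∀ {k x y} → δ (h i) (h k) ≡ x → δ (h j) (h k) ≡ y → 2 + (x + y) ≡ Δ k
    size-lemma p q = cong₂ (λ x y → 2 + (x + y)) (sym p) (sym q)

    neighbours : ∀ k → k ≤ N → Neighbours k
    neighbours zero _ with 0 ℕP.≟ j
    ... | yes 0≡j = record
      { ps = 1 ∷ i ∷ N ∷ []
      ; good = (1≤N , next refl) ∷ (i≤N , chord₀ refl refl) ∷ (ℕP.≤-refl , chordⱼ 0≡j refl) ∷ []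
      ; unique = (ℕP.<⇒≢ 2≤i ∷ ℕP.<⇒≢ 2≤N ∷ []) ∷ ((λ i≡N → distinct (i≡N , sym 0≡j)) ∷ []) ∷ [] ∷ []
      ; size = size-lemma (δ-no i≤N z≤n (ℕP.<⇒≢ 0<i)) (δ-yes 0≡j) }
    ... | no 0≢j = record
      { ps = 1 ∷ i ∷ []
      ; good = (1≤N , next refl) ∷ (i≤N , chord₀ refl refl) ∷ []
      ; unique = (ℕP.<⇒≢ 2≤i ∷ []) ∷ [] ∷ []
      ; size = size-lemma (δ-no i≤N z≤n (ℕP.<⇒≢ 0<i)) (δ-no j≤N z≤n 0≢j) }
    neighbours (suc k) k<N with ℕP.m≤n⇒m<n∨m≡n k<N
    ... | inj₂ 1+k≡N with suc k ℕP.≟ i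
    ...   | yes k≡i = record
      { ps = k ∷ j ∷ 0 ∷ []
      ; good = (ℕP.<⇒≤ k<N , prev refl) ∷ (j≤N , chordₙ 1+k≡N refl) ∷ (z≤n , chordᵢ k≡i refl) ∷ []
      ; unique = ((λ k≡j → ℕP.<⇒≢ (ℕP.≤-trans (s≤s (s≤s (ℕP.≤-reflexive k≡j))) 2+j≤N) 1+k≡N)
                 ∷ ℕP.>⇒≢ (ℕP.≤-pred (subst (2 ≤_) (sym 1+k≡N) 2≤N)) ∷ [])
                 ∷ ((λ j≡0 → distinct (trans (sym k≡i) 1+k≡N , j≡0)) ∷ []) ∷ [] ∷ []
      ; size = size-lemma (δ-yes k≡i) (δ-no j≤N k<N (λ k≡j → ℕP.<⇒≢ j<N (trans (sym k≡j) 1+k≡N))) }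
    ...   | no k≢i = record
      { ps = k ∷ j ∷ []
      ; good = (ℕP.<⇒≤ k<N , prev refl) ∷ (j≤N , chordₙ 1+k≡N refl) ∷ []
      ; unique = ((λ k≡j → ℕP.<⇒≢ (ℕP.≤-trans (s≤s (s≤s (ℕP.≤-reflexive k≡j))) 2+j≤N) 1+k≡N) ∷ []) ∷ [] ∷ []
      ; size = size-lemma (δ-no i≤N k<N k≢i) (δ-no j≤N k<N (λ k≡j → ℕP.<⇒≢ j<N (trans (sym k≡j) 1+k≡N))) }
    neighbours (suc k) k<N | inj₁ 1+k<N with suc k ℕP.≟ i | suc k ℕP.≟ j
    ... | no k≢i | no k≢j = record
      { ps = k ∷ suc (suc k) ∷ []
      ; good = (ℕP.<⇒≤ k<N , prev refl) ∷ (1+k<N , next refl) ∷ []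
      ; unique = (ℕP.<⇒≢ (ℕP.m≤n+m (suc k) 1) ∷ []) ∷ [] ∷ []
      ; size = size-lemma (δ-no i≤N k<N k≢i) (δ-no j≤N k<N k≢j) }
    ... | yes k≡i | no k≢j = record
      { ps = k ∷ suc (suc k) ∷ 0 ∷ []
      ; good = (ℕP.<⇒≤ k<N , prev refl) ∷ (1+k<N , next refl) ∷ (z≤n , chordᵢ k≡i refl) ∷ []
      ; unique = (ℕP.<⇒≢ (ℕP.m≤n+m (suc k) 1) ∷ ℕP.>⇒≢ (ℕP.≤-pred (subst (2 ≤_) (sym k≡i) 2≤i)) ∷ [])
                 ∷ ((λ ()) ∷ []) ∷ [] ∷ []
      ; size = size-lemma (δ-yes k≡i) (δ-no j≤N k<N k≢j) }
    ... | no k≢i | yes k≡j = record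
      { ps = k ∷ suc (suc k) ∷ N ∷ []
      ; good = (ℕP.<⇒≤ k<N , prev refl) ∷ (1+k<N , next refl) ∷ (ℕP.≤-refl , chordⱼ k≡j refl) ∷ []
      ; unique = (ℕP.<⇒≢ (ℕP.m≤n+m (suc k) 1) ∷ ℕP.<⇒≢ k<N ∷ [])
                 ∷ (ℕP.<⇒≢ (subst (λ z → 2 + z ≤ N) (sym k≡j) 2+j≤N) ∷ []) ∷ [] ∷ []
      ; size = size-lemma (δ-no i≤N k<N k≢i) (δ-yes k≡j) }
    ... | yes k≡i | yes k≡j = record
      { ps = k ∷ suc (suc k) ∷ 0 ∷ N ∷ []
      ; good = (ℕP.<⇒≤ k<N , prev refl) ∷ (1+k<N , next refl) ∷ (z≤n , chordᵢ k≡i refl) ∷ (ℕP.≤-refl , chordⱼ k≡j refl) ∷ []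
      ; unique = (ℕP.<⇒≢ (ℕP.m≤n+m (suc k) 1) ∷ ℕP.>⇒≢ (ℕP.≤-pred (subst (2 ≤_) (sym k≡i) 2≤i)) ∷ ℕP.<⇒≢ k<N ∷ [])
                 ∷ ((λ ()) ∷ ℕP.<⇒≢ (subst (λ z → 2 + z ≤ N) (sym k≡j) 2+j≤N) ∷ []) ∷ (ℕP.<⇒≢ 1≤N ∷ []) ∷ [] ∷ []
      ; size = size-lemma (δ-yes k≡i) (δ-yes k≡j) }

    unique-map : ∀ {k} ps → All (λ l → l ≤ N × Link N i j k l) ps → Unique ps → Unique (map h ps)
    unique-map []       []             []       = []
    unique-map (p ∷ ps) ((p≤ , _) ∷ g) (p∉ ∷ u) =
      AllP.map⁺ (All.map (λ ((q≤ , _) , p≢q) eq → p≢q (injective p≤ q≤ eq)) (All.zip (g , p∉))) ∷ unique-map ps g u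

    adjacent : ∀ {k} → k ≤ N → (nb : Neighbours k) → All (Adj Γ (h k)) (map h (Neighbours.ps nb))
    adjacent k≤ nb = AllP.map⁺ (All.map (λ (l≤ , lk) → link-adj path adj₀ adjₙ k≤ l≤ lk) (Neighbours.good nb))

    Δ≤degree : ∀ u → 2 + (δ (h i) u + δ (h j) u) ≤ degree Γ u
    Δ≤degree u with onPath? {Γ = Γ} h N u
    ... | yes (k , k≤N , refl) = subst (_≤ degree Γ (h k)) (trans (length-map h (Neighbours.ps nb)) (Neighbours.size nb))
            (length≤count (adj? Γ (h k)) (unique-map _ (Neighbours.good nb) (Neighbours.unique nb)) (adjacent k≤N nb))
      where nb = neighbours k k≤N
    -- Off the path both δ vanish, and minimum degree 2 suffices.
    ... | no off = subst (_≤ degree Γ u) (cong₂ (λ x y → 2 + (bit x + bit y))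
                     (sym (dec-false (h i ≟F u) (λ eq → off (i , i≤N , eq))))
                     (sym (dec-false (h j ≟F u) (λ eq → off (j , j≤N , eq))))) (2≤degree u)

    -- The degrees forced by the path and the chords already sum to 2n + 2, so they are the degrees.
    exact : ∀ {k u} → k ≤ N → Adj Γ (h k) u → ∃ λ l → l ≤ N × u ≡ h l × Link N i j k l
    exact {k} {u} k≤N a with ∈-map⁻ h (count-exhaust (adj? Γ (h k))
        (unique-map _ (Neighbours.good nb) (Neighbours.unique nb)) (adjacent k≤N nb)
        (subst (degree Γ (h k) ≤_) (sym (trans (length-map h (Neighbours.ps nb)) (Neighbours.size nb)))
          (degree-tight (h i) (h j) Δ≤degree (h k))) a)
      where nb = neighbours k k≤N
    ... | l , l∈ , u≡ with All.lookup (Neighbours.good (neighbours k k≤N)) l∈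
    ...   | l≤ , lk = l , l≤ , u≡ , lk

    spine : Spine Γ
    spine = record
      { h = h ; N = N ; i = i ; j = j ; 2≤i = 2≤i ; i≤N = i≤N ; 2+j≤N = 2+j≤N ; distinct = distinct
      ; path = path ; adj₀ = adj₀ ; adjₙ = adjₙ
      ; spanning = reach-all (λ u → ∃ λ k → k ≤ N × h k ≡ u)
          (λ { (k , k≤ , refl) a → let (l , l≤ , u≡ , _) = exact k≤ a in l , l≤ , sym u≡ }) (0 , z≤n , refl)
      ; links = λ {k} {l} k≤ l≤ a → let (l′ , l′≤ , u≡ , lk) = exact k≤ a in
          subst (Link N i j k) (sym (injective l≤ l′≤ u≡)) lk
      }

  -- The initial segment is kept so that a cycle traversed first stays at the start of the longer
  -- path; `2+j≤N′` says that the returning edge is not the last path edge.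
  record Extension (h : ℕ → Fin n) (N : ℕ) : Set where
    field
      h′     : ℕ → Fin n
      N′ j   : ℕ
      N≤N′   : N ≤ N′
      agree  : ∀ {k} → k ≤ N → h′ k ≡ h k
      path′  : IsPath Γ h′ N′
      2+j≤N′ : 2 + j ≤ N′
      back   : Adj Γ (h′ N′) (h′ j)

  -- Minimum degree 2 offers an edge other than the one just traversed. It either returns to the
  -- path, which ends the walk, or lengthens the path. The invariant `n ≤ N + fuel` fails once the
  -- fuel is gone, because a path has at most `n` vertices.
  extend : ∀ fuel h N → IsPath Γ h N → 1 ≤ N → n ≤ N + fuel → Extension h N
  extend zero h N path _ n≤ =
    ⊥-elim (ℕP.<⇒≱ (path-length path) (subst (n ≤_) (ℕP.+-identityʳ N) n≤))
  extend (suc fuel) h (suc M) path _ n≤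
    with count-fresh (adj? Γ (h (suc M))) (h M ∷ []) (2≤degree _)
  ... | d , a , d∉ with onPath? {Γ = Γ} h (suc M) d
  ...   | yes (k , k≤ , refl) = record
      { h′ = h ; N′ = suc M ; j = k ; N≤N′ = ℕP.≤-refl ; agree = λ _ → refl ; path′ = path
      ; 2+j≤N′ = s≤s (ℕP.≤∧≢⇒< (ℕP.≤-pred (ℕP.≤∧≢⇒< k≤ (λ { refl → Adj-irrefl Γ a refl })))
                        (λ { refl → d∉ (here refl) }))
      ; back = a }
  ...   | no off = record
      { h′ = Extension.h′ rec ; N′ = Extension.N′ rec ; j = Extension.j rec
      ; N≤N′ = ℕP.≤-trans (ℕP.n≤1+n _) (Extension.N≤N′ rec)
      ; agree = λ {k} k≤ → trans (Extension.agree rec (ℕP.m≤n⇒m≤1+n k≤)) (snoc-≤ {Γ = Γ} h (suc M) d k≤)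
      ; path′ = Extension.path′ rec ; 2+j≤N′ = Extension.2+j≤N′ rec ; back = Extension.back rec }
    where
    rec : Extension (snoc {Γ = Γ} h (suc M) d) (suc (suc M))
    rec = extend fuel _ _ (snoc-path path a (λ k≤ eq → off (_ , k≤ , eq))) (s≤s z≤n)
            (subst (n ≤_) (ℕP.+-suc (suc M) fuel) n≤)

  -- Spines are built along a given cycle; this one serves where none is given. A walk starting with
  -- any edge runs until it meets itself, and its tail from the meeting point is a cycle.
  cycle : Cycle Γ
  cycle with count-fresh (adj? Γ vertex) [] (ℕP.≤-trans (s≤s z≤n) (2≤degree vertex))
  ... | d , a , _ = cycleFromPath (λ t → h′ (j + t)) (N′ ∸ j) (ℕP.m+n≤o⇒m≤o∸n 2 2+j≤N′) sub
        (subst (λ z → Adj Γ z (h′ (j + 0))) (cong h′ (sym j+[N∸j])) (subst (λ z → Adj Γ (h′ N′) (h′ z)) (sym (ℕP.+-identityʳ j)) back))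
    where
    h₀ : ℕ → Fin n
    h₀ = snoc {Γ = Γ} (λ _ → vertex) 0 d
    path₀ : IsPath Γ h₀ 1
    path₀ = snoc-path (record { injective = λ { z≤n z≤n _ → refl } ; linked = λ () }) a (λ _ → Adj-irrefl Γ a)
    open Extension (extend n h₀ 1 path₀ (s≤s z≤n) (ℕP.n≤1+n n))
    j+[N∸j] : j + (N′ ∸ j) ≡ N′
    j+[N∸j] = ℕP.m+[n∸m]≡n (ℕP.≤-trans (ℕP.m≤n+m j 2) 2+j≤N′)
    bound : ∀ {k} → k ≤ N′ ∸ j → j + k ≤ N′
    bound {k} k≤ = subst (j + k ≤_) j+[N∸j] (ℕP.+-monoʳ-≤ j k≤)
    sub : IsPath Γ (λ t → h′ (j + t)) (N′ ∸ j)
    sub = record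
      { injective = λ a≤ b≤ eq → ℕP.+-cancelˡ-≡ j _ _ (IsPath.injective path′ (bound a≤) (bound b≤) eq)
      ; linked = λ {k} k< → subst (λ z → Adj Γ (h′ (j + k)) (h′ z)) (sym (ℕP.+-suc j k))
                   (IsPath.linked path′ (subst (_≤ N′) (ℕP.+-suc j k) (bound k<))) }

  -- The spine starts just after the cycle vertex with index `r`, goes once around the cycle and is
  -- back there at `h m`, since `W (suc r + m)` is `W r` by periodicity.
  record SpineAlong (C : Cycle Γ) : Set where
    open CycleWalk C
    field
      S     : Spine Γ
      r     : ℕ
      r≤m   : r ≤ m
      i≡m   : Spine.i S ≡ m
      along : ∀ {s} → s ≤ m → Spine.h S s ≡ W (suc r + s)

  spineAlong : ∀ C → SpineAlong C
  spineAlong C with any? (λ t → 3 ≤? degree Γ (vs C t))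
    where open CycleWalk C
  -- Without a vertex of degree 3 the cycle is closed under adjacency, hence is all of Γ, and the
  -- degree sum is too small.
  ... | no ¬branch = ⊥-elim (¬degree≤2 (λ u → let (t , eq) = everywhere u in
                      subst (λ z → degree Γ z ≤ 2) eq (low t)))
    where
    open CycleWalk C
    low : ∀ t → degree Γ (vs C t) ≤ 2
    low t = ℕP.≤-pred (ℕP.≰⇒> (λ 3≤ → ¬branch (t , 3≤)))
    next-vertex : ∀ {u w} → (∃ λ t → vs C t ≡ u) → Adj Γ u w → ∃ λ t → vs C t ≡ w
    next-vertex (t , refl) a with shift-surjective 1 (s≤s z≤n) t
    ... | s , _ , refl with count-exhaust (adj? Γ (W (suc s)))
            (((λ eq → idx-distinct s (vs-injective C _ _ eq)) ∷ []) ∷ [] ∷ [])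
            (Adj-sym Γ (W-adj s) ∷ W-adj (suc s) ∷ []) (low (idx (suc s))) a
    ...   | here w≡         = idx s , sym w≡
    ...   | there (here w≡) = idx (2 + s) , sym w≡
    everywhere : ∀ u → ∃ λ t → vs C t ≡ u
    everywhere = reach-all (λ u → ∃ λ t → vs C t ≡ u) next-vertex (idx 0 , refl)
  -- The cycle is turned so that the branching vertex comes last; a third edge there avoids both
  -- cycle neighbours `h (m ∸ 1)` and `h 0`.
  ... | yes (t₀ , 3≤) = leave (count-fresh (adj? Γ (h m)) (h (m ∸ 1) ∷ h 0 ∷ []) (subst (λ u → 3 ≤ degree Γ u) (sym hm≡) 3≤))
    where
    open CycleWalk C
    r : ℕ
    r = suc (toℕ t₀)
    h : ℕ → Fin n
    h s = W (r + s)
    hm≡ : h m ≡ vs C t₀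
    hm≡ = trans (cong W (sym (ℕP.+-suc (toℕ t₀) m))) (trans (W-period (toℕ t₀)) (cong (vs C) (idx-toℕ t₀)))
    path : IsPath Γ h m
    path = record
      { injective = W-shift-injective r
      ; linked = λ {k} _ → subst (λ z → Adj Γ (h k) (W z)) (sym (ℕP.+-suc r k)) (W-adj (r + k)) }
    adj₀ : Adj Γ (h 0) (h m)
    adj₀ = Adj-sym Γ (subst (Adj Γ (h m))
      (trans (cong W (trans (sym (ℕP.+-suc r m)) (cong (_+ suc m) (sym (ℕP.+-identityʳ r))))) (W-period (r + 0))) (W-adj (r + m)))
    leave : (∃ λ d → Adj Γ (h m) d × d ∉ (h (m ∸ 1) ∷ h 0 ∷ [])) → SpineAlong C
    leave (d , a , d∉) with onPath? {Γ = Γ} h m d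
    -- The third edge is a chord of the cycle: the path ends with the cycle, so i = N = m, and k is
    -- not 0 because `h 0` was avoided.
    ... | yes (k , k≤ , refl) = record
        { S = Complete.spine h m m k 2≤m ℕP.≤-refl
                (subst (λ z → suc (suc k) ≤ z) suc[m∸1]≡m (s≤s (ℕP.≤∧≢⇒< (ℕP.≤-pred (subst (suc k ≤_) (sym suc[m∸1]≡m) k<m)) (λ { refl → d∉ (here refl) }))))
                (λ { (_ , refl) → d∉ (there (here refl)) }) path adj₀ a
        ; r = toℕ t₀ ; r≤m = toℕ≤m t₀ ; i≡m = refl ; along = λ _ → refl }
      where
      suc[m∸1]≡m : suc (m ∸ 1) ≡ m
      suc[m∸1]≡m = ℕP.m+[n∸m]≡n (ℕP.≤-trans (s≤s z≤n) 2≤m)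
      k<m : k < m
      k<m = ℕP.≤∧≢⇒< k≤ (λ k≡m → Adj-irrefl Γ a (cong h (sym k≡m)))
    -- The third edge leaves the cycle, so the final path is longer than `m` and the chords differ.
    ... | no off = record
        { S = Complete.spine h′ N′ m j 2≤m (ℕP.<⇒≤ N≤N′) 2+j≤N′ (λ (m≡ , _) → ℕP.<⇒≢ N≤N′ m≡) path′
                (subst₂ (Adj Γ) (sym (start z≤n)) (sym (start ℕP.≤-refl)) adj₀) back
        ; r = toℕ t₀ ; r≤m = toℕ≤m t₀ ; i≡m = refl ; along = start }
      where
      open Extension (extend n (snoc {Γ = Γ} h m d) (suc m) (snoc-path path a (λ k≤ eq → off (_ , k≤ , eq)))
                        (s≤s z≤n) (ℕP.m≤n+m n (suc m)))
      start : ∀ {s} → s ≤ m → h′ s ≡ h s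
      start s≤ = trans (agree (ℕP.m≤n⇒m≤1+n s≤)) (snoc-≤ {Γ = Γ} h m d s≤)

-- Kernels of cycles and of spines

∸-suc : ∀ {N d} → suc d ≤ N → N ∸ d ≡ suc (N ∸ suc d)
∸-suc = ℕP.+-∸-assoc 1

parity≢ : ∀ {k} → parity k ≡ 0ℙ → parity k ≡ 1ℙ → ⊥
parity≢ p q with trans (sym p) q
... | ()

Even⇒parity : ∀ {k} → Even k → parity k ≡ 0ℙ
Even⇒parity (divides q refl) = go q
  where
  go : ∀ q → parity (q * 2) ≡ 0ℙ
  go zero    = refl
  go (suc q) = go q

parity⇒Even : ∀ k → parity k ≡ 0ℙ → Even k
parity⇒Even zero          _ = divides 0 refl
parity⇒Even (suc zero)    ()
parity⇒Even (suc (suc k)) p with parity⇒Even k p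
... | divides q eq = divides (suc q) (cong (2 +_) eq)

Odd⇒parity : ∀ k → Odd k → parity k ≡ 1ℙ
Odd⇒parity k odd with parity k in eq
... | 0ℙ = ⊥-elim (odd (parity⇒Even k eq))
... | 1ℙ = refl

parity⇒Odd : ∀ {k} → parity k ≡ 1ℙ → Odd k
parity⇒Odd {k} p even = parity≢ {k} (Even⇒parity even) p

parity-∸ : ∀ {N k} → k ≤ N → parity (N ∸ k) ≡ parity N +ℙ parity k
parity-∸ {N} {k} k≤N =
  solve₂ (parity (N ∸ k)) (parity k) (trans (cong parity (sym (ℕP.m∸n+n≡m k≤N))) (ℙP.+-homo-+ (N ∸ k) k))
  where
  solve₂ : ∀ x y {z} → z ≡ x +ℙ y → x ≡ z +ℙ y
  solve₂ 0ℙ 0ℙ refl = refl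
  solve₂ 0ℙ 1ℙ refl = refl
  solve₂ 1ℙ 0ℙ refl = refl
  solve₂ 1ℙ 1ℙ refl = refl

parity-suc : ∀ k → parity (suc k) ≡ 1ℙ +ℙ parity k
parity-suc = ℙP.+-homo-+ 1

odd-suc : ∀ k → parity k ≡ 1ℙ → parity (suc k) ≡ 0ℙ
odd-suc k p = trans (parity-suc k) (cong (1ℙ +ℙ_) p)

even-pred : ∀ k → parity (suc k) ≡ 0ℙ → parity k ≡ 1ℙ
even-pred k p with parity k | parity-suc k
... | 1ℙ | _ = refl
... | 0ℙ | q with trans (sym p) q
...   | ()

odd-pred : ∀ k → parity (suc k) ≡ 1ℙ → parity k ≡ 0ℙ
odd-pred k p with parity k | parity-suc k
... | 0ℙ | _ = refl
... | 1ℙ | q with trans (sym p) q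
...   | ()

-- Kernel equations relate positions two apart, hence induction in steps of two; the bound `B` keeps
-- the hops on the path.
evens : ∀ (P : ℕ → Set) B → (∀ k → 2 + k ≤ B → P k → P (2 + k)) → P 0 →
  ∀ k → k ≤ B → parity k ≡ 0ℙ → P k
evens P B hop p₀ zero          _   _  = p₀
evens P B hop p₀ (suc zero)    _   ()
evens P B hop p₀ (suc (suc k)) k≤B pk = hop k k≤B (evens P B hop p₀ k (ℕP.≤-trans (ℕP.m≤n+m k 2) k≤B) pk)

odds : ∀ (P : ℕ → Set) B → (∀ k → 2 + k ≤ B → P k → P (2 + k)) → P 1 →
  ∀ k → k ≤ B → parity k ≡ 1ℙ → P k
odds P B hop p₁ zero          _   ()
odds P B hop p₁ (suc zero)    _   _  = p₁
odds P B hop p₁ (suc (suc k)) k≤B pk = hop k k≤B (odds P B hop p₁ k (ℕP.≤-trans (ℕP.m≤n+m k 2) k≤B) pk)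

second-zero : ∀ a b x y → b ≢ 0ℚ → a *ℚ x +ℚ b *ℚ y ≡ 0ℚ → x ≡ 0ℚ → y ≡ 0ℚ
second-zero a b x y b≢0 eq refl = *-cancelˡ-0 b≢0
  (trans (solve 3 (λ a b y → b :* y := a :* con 0ℚ :+ b :* y) refl a b y) eq)

first-zero : ∀ a b x y → a ≢ 0ℚ → a *ℚ x +ℚ b *ℚ y ≡ 0ℚ → y ≡ 0ℚ → x ≡ 0ℚ
first-zero a b x y a≢0 eq = second-zero b a y x a≢0 (trans (ℚP.+-comm (b *ℚ y) (a *ℚ x)) eq)

module _ {n} (Γ : SignedGraph n) where

  adjMatrix-adj : ∀ {u w} → Adj Γ u w → adjMatrix Γ u w ≢ 0ℚ
  adjMatrix-adj {u} {w} a with edge Γ u w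
  ... | just plus  = λ ()
  ... | just minus = λ ()

  adjMatrix-square : ∀ {u w} → Adj Γ u w → adjMatrix Γ u w *ℚ adjMatrix Γ u w ≡ 1ℚ
  adjMatrix-square {u} {w} a with edge Γ u w
  ... | just plus  = refl
  ... | just minus = refl

  term-zero : ∀ (v : Fin n → ℚ) u w → (Adj Γ u w → v w ≡ 0ℚ) → adjMatrix Γ u w *ℚ v w ≡ 0ℚ
  term-zero v u w z with edge Γ u w
  ... | nothing = ℚP.*-zeroˡ (v w)
  ... | just s  = trans (cong (signℚ (just s) *ℚ_) (z tt)) (ℚP.*-zeroʳ (signℚ (just s)))

  row-two : ∀ (v : Fin n → ℚ) u a b → a ≢ b → (∀ w → Adj Γ u w → w ≢ a → w ≢ b → v w ≡ 0ℚ) →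
    ∑ℚ (λ w → adjMatrix Γ u w *ℚ v w) ≡ adjMatrix Γ u a *ℚ v a +ℚ adjMatrix Γ u b *ℚ v b
  row-two v u a b a≢b off = ∑-two a b a≢b (λ w w≢a w≢b → term-zero v u w (λ uw → off w uw w≢a w≢b))

  kernel-zero : ∀ {v} → InKernel (adjMatrix Γ) v → ∀ {u w} → Adj Γ u w →
    (∀ x → Adj Γ u x → x ≢ w → v x ≡ 0ℚ) → v w ≡ 0ℚ
  kernel-zero {v} ker {u} {w} a off = *-cancelˡ-0 (adjMatrix-adj a)
    (trans (sym (∑-one w (λ x x≢w → term-zero v u x (λ ux → off x ux x≢w)))) (ker u))

pair : ∀ {A : Set} → A → A → Fin 2 → A
pair x y fz      = x
pair x y (fs fz) = y

triple : ∀ {A : Set} → A → A → A → Fin 3 → A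
triple x y z fz           = x
triple x y z (fs fz)      = y
triple x y z (fs (fs fz)) = z

module CycleKernel {n} {Γ : SignedGraph n} (C : Cycle Γ) where
  open CycleWalk C public

  a⁻ a⁺ : ℕ → ℚ
  a⁻ t = adjMatrix Γ (W (suc t)) (W t)
  a⁺ t = adjMatrix Γ (W (suc t)) (W (2 + t))

  a⁻≢0 : ∀ t → a⁻ t ≢ 0ℚ
  a⁻≢0 t = adjMatrix-adj Γ (Adj-sym Γ (W-adj t))
  a⁺≢0 : ∀ t → a⁺ t ≢ 0ℚ
  a⁺≢0 t = adjMatrix-adj Γ (W-adj (suc t))

  -- Index `suc t` has exactly two cyclic neighbours, distinct because the length is at least 3.
  cycle-row : ∀ (x : Fin (len C) → ℚ) t → ∑ℚ (λ b → cycleMatrix Γ C (idx (suc t)) b *ℚ x b) ≡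
    a⁻ t *ℚ x (idx t) +ℚ a⁺ t *ℚ x (idx (2 + t))
  cycle-row x t = trans (∑-two (idx t) (idx (2 + t)) (idx-distinct t) off)
    (cong₂ (λ p q → p *ℚ x (idx t) +ℚ q *ℚ x (idx (2 + t)))
       (on (Equivalence.from T-∨ (inj₂ (idx-succ t))))
       (on (Equivalence.from T-∨ (inj₁ (idx-succ (suc t))))))
    where
    on : ∀ {b} → T (IsCycleSucc (idx (suc t)) b ∨ IsCycleSucc b (idx (suc t))) →
      cycleMatrix Γ C (idx (suc t)) b ≡ adjMatrix Γ (W (suc t)) (vs C b)
    on {b} s with IsCycleSucc (idx (suc t)) b ∨ IsCycleSucc b (idx (suc t))
    ... | true = refl
    off : ∀ b → b ≢ idx t → b ≢ idx (2 + t) → cycleMatrix Γ C (idx (suc t)) b *ℚ x b ≡ 0ℚ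
    off b b≢ b≢′ with IsCycleSucc (idx (suc t)) b in e₁ | IsCycleSucc b (idx (suc t)) in e₂
    ... | true  | _     = ⊥-elim (b≢′ (succ-unique (suc t) b (subst T (sym e₁) tt)))
    ... | false | true  = ⊥-elim (b≢ (pred-unique t b (subst T (sym e₂) tt)))
    ... | false | false = ℚP.*-zeroˡ (x b)

  module _ x (ker : InKernel (cycleMatrix Γ C) x) where

    private
      x̂ : ℕ → ℚ
      x̂ t = x (idx t)

    kernel-row : ∀ t → a⁻ t *ℚ x (idx t) +ℚ a⁺ t *ℚ x (idx (2 + t)) ≡ 0ℚ
    kernel-row t = trans (sym (cycle-row x t)) (ker (idx (suc t)))

    zero-forward : ∀ t → x̂ t ≡ 0ℚ → x̂ (2 + t) ≡ 0ℚ
    zero-forward t = second-zero (a⁻ t) (a⁺ t) (x̂ t) (x̂ (2 + t)) (a⁺≢0 t) (kernel-row t)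

    zero-backward : ∀ t → x̂ (2 + t) ≡ 0ℚ → x̂ t ≡ 0ℚ
    zero-backward t = first-zero (a⁻ t) (a⁺ t) (x̂ t) (x̂ (2 + t)) (a⁻≢0 t) (kernel-row t)

    evens-zero : x̂ 0 ≡ 0ℚ → ∀ t → parity t ≡ 0ℙ → x̂ t ≡ 0ℚ
    evens-zero z t = evens (λ t → x̂ t ≡ 0ℚ) t (λ k _ → zero-forward k) z t ℕP.≤-refl

    odds-zero : x̂ 1 ≡ 0ℚ → ∀ t → parity t ≡ 1ℙ → x̂ t ≡ 0ℚ
    odds-zero z t = odds (λ t → x̂ t ≡ 0ℚ) t (λ k _ → zero-forward k) z t ℕP.≤-refl

  -- Each row ties an index only to the one two further on, so the values at 0 and 1 fix the even
  -- and the odd indices separately.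
  determined : Determines (cycleMatrix Γ C) (pair (idx 0) (idx 1))
  determined x ker z b = subst (λ c → x c ≡ 0ℚ) (idx-toℕ b) (all (toℕ b))
    where
    all : ∀ t → x (idx t) ≡ 0ℚ
    all t with parity t in eq
    ... | 0ℙ = evens-zero x ker (z fz) t eq
    ... | 1ℙ = odds-zero x ker (z (fs fz)) t eq

  nullity≤2 : ¬ KerDimAtLeast (cycleMatrix Γ C) 3
  nullity≤2 = Determines⇒¬KerDim (cycleMatrix Γ C) (pair (idx 0) (idx 1)) determined

  with-values : KerDimAtLeast (cycleMatrix Γ C) 2 → ∀ y z →
    ∃ λ x → InKernel (cycleMatrix Γ C) x × x (idx 0) ≡ y × x (idx 1) ≡ z
  with-values dim y z with interpolate (cycleMatrix Γ C) (pair (idx 0) (idx 1)) determined dim (pair y z)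
  ... | x , ker , val = x , ker , val fz , val (fs fz)

  -- A kernel vector with values 0 and 1 at the indices 0 and 1 is nonzero at every odd index. If
  -- the length were odd, going once around would reach index 0 among these.
  even-length : KerDimAtLeast (cycleMatrix Γ C) 2 → parity (len C) ≡ 0ℙ
  even-length dim with with-values dim 0ℚ 1ℚ
  ... | x , ker , x₀ , x₁ with parity (suc m) in eq
  ...   | 0ℙ = trans (cong parity len≡) eq
  ...   | 1ℙ = ⊥-elim (odd≢0 (suc m) ℕP.≤-refl eq (trans (cong x (idx-period 0)) x₀))
    where
    odd≢0 : ∀ t → t ≤ suc m → parity t ≡ 1ℙ → x (idx t) ≢ 0ℚ
    odd≢0 = odds (λ t → x (idx t) ≢ 0ℚ) (suc m) (λ t _ x≢0 z → x≢0 (zero-backward x ker t z))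
              (λ z → ℚP.1≢0 (trans (sym x₁) z))

module SpineKernel {n} {Γ : SignedGraph n} (S : Spine Γ) where
  open Spine S public

  0<N : 0 < N
  0<N = ℕP.≤-trans (s≤s z≤n) 2≤N
  0≢i : 0 ≢ i
  0≢i = ℕP.<⇒≢ (ℕP.≤-trans (s≤s z≤n) 2≤i)
  0≢N : 0 ≢ N
  0≢N = ℕP.<⇒≢ 0<N

  module _ {v} (ker : InKernel (adjMatrix Γ) v) where

    row-zero : ∀ {k l} → k ≤ N → Adj Γ (h k) (h l) →
      (∀ l′ → l′ ≤ N → Link N i j k l′ → l′ ≢ l → v (h l′) ≡ 0ℚ) → v (h l) ≡ 0ℚ
    row-zero {k} {l} k≤ a off = kernel-zero Γ ker a go
      where
      go : ∀ x → Adj Γ (h k) x → x ≢ h l → v x ≡ 0ℚ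
      go x kx x≢ with spanning x
      ... | l′ , l′≤ , refl = off l′ l′≤ (links k≤ l′≤ kx) (λ e → x≢ (cong h e))

    module _ (v₀ : v (h 0) ≡ 0ℚ) (vₙ : v (h N) ≡ 0ℚ) where

      -- Once `v` vanishes at 0 and N, a chord contributes nothing to an interior row, so the
      -- interior behaves like a bare path.
      interior : ∀ {k l} → 0 < k → k < N → Link N i j k l → l ≢ suc k → k ≢ suc l → v (h l) ≡ 0ℚ
      interior 0<k k<N (next e)       ≢+ ≢- = ⊥-elim (≢+ e)
      interior 0<k k<N (prev e)       ≢+ ≢- = ⊥-elim (≢- e)
      interior 0<k k<N (chord₀ e _)   ≢+ ≢- = ⊥-elim (ℕP.>⇒≢ 0<k e)
      interior 0<k k<N (chordᵢ _ refl) ≢+ ≢- = v₀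
      interior 0<k k<N (chordₙ e _)   ≢+ ≢- = ⊥-elim (ℕP.<⇒≢ k<N e)
      interior 0<k k<N (chordⱼ _ refl) ≢+ ≢- = vₙ

      forward : ∀ k → 2 + k ≤ N → v (h k) ≡ 0ℚ → v (h (2 + k)) ≡ 0ℚ
      forward k lt z = row-zero (ℕP.<⇒≤ lt) (linked lt) off
        where
        off : ∀ l → l ≤ N → Link N i j (suc k) l → l ≢ 2 + k → v (h l) ≡ 0ℚ
        off l _ lk l≢ with l ℕP.≟ k
        ... | yes refl = z
        ... | no l≢k = interior (s≤s z≤n) lt lk l≢ (λ e → l≢k (ℕP.suc-injective (sym e)))

      backward : ∀ k → 2 + k ≤ N → v (h (2 + k)) ≡ 0ℚ → v (h k) ≡ 0ℚ
      backward k lt z = row-zero (ℕP.<⇒≤ lt) (Adj-sym Γ (linked (ℕP.<⇒≤ lt))) off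
        where
        off : ∀ l → l ≤ N → Link N i j (suc k) l → l ≢ k → v (h l) ≡ 0ℚ
        off l _ lk l≢k with l ℕP.≟ 2 + k
        ... | yes refl = z
        ... | no l≢ = interior (s≤s z≤n) lt lk l≢ (λ e → l≢k (ℕP.suc-injective (sym e)))

      even-zero : ∀ k → k ≤ N → parity k ≡ 0ℙ → v (h k) ≡ 0ℚ
      even-zero = evens (λ k → v (h k) ≡ 0ℚ) N forward v₀

      odd-zero : v (h 1) ≡ 0ℚ → ∀ k → k ≤ N → parity k ≡ 1ℙ → v (h k) ≡ 0ℚ
      odd-zero = odds (λ k → v (h k) ≡ 0ℚ) N forward

      module _ (v₁ : v (h 1) ≢ 0ℚ) where

        odd-nonzero : ∀ k → k ≤ N → parity k ≡ 1ℙ → v (h k) ≢ 0ℚ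
        odd-nonzero = odds (λ k → v (h k) ≢ 0ℚ) N (λ k lt nz z → nz (backward k lt z)) v₁

        -- The row at 0 involves 1, i and, if j = 0, also N. Were `v` zero at i, only the term at 1
        -- would survive.
        vᵢ≢0 : v (h i) ≢ 0ℚ
        vᵢ≢0 z = v₁ (row-zero z≤n (linked 0<N) off)
          where
          off : ∀ l → l ≤ N → Link N i j 0 l → l ≢ 1 → v (h l) ≡ 0ℚ
          off l _ (next e)        l≢1 = ⊥-elim (l≢1 e)
          off l _ (prev ())       l≢1
          off l _ (chord₀ _ refl) l≢1 = z
          off l _ (chordᵢ _ refl) l≢1 = v₀
          off l _ (chordₙ e _)    l≢1 = ⊥-elim (0≢N e)
          off l _ (chordⱼ _ refl) l≢1 = vₙ

        N-is-even : parity N ≡ 0ℙ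
        N-is-even with parity N in eq
        ... | 0ℙ = refl
        ... | 1ℙ = ⊥-elim (odd-nonzero N ℕP.≤-refl eq vₙ)

        -- Position N - 1 is odd, so `v` is nonzero there, and in the row at N only j can balance
        -- it.
        vⱼ≢0 : v (h j) ≢ 0ℚ
        vⱼ≢0 z = odd-nonzero (N ∸ 1) (ℕP.m∸n≤m N 1) (trans (parity-∸ 0<N) (cong (_+ℙ 1ℙ) N-is-even))
                   (row-zero ℕP.≤-refl (Adj-sym Γ (subst (λ q → Adj Γ (h (N ∸ 1)) (h q)) N≡ (linked (ℕP.≤-reflexive N≡)))) off)
          where
          N≡ : suc (N ∸ 1) ≡ N
          N≡ = ℕP.m+[n∸m]≡n 0<N
          off : ∀ l → l ≤ N → Link N i j N l → l ≢ N ∸ 1 → v (h l) ≡ 0ℚ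
          off l l≤ (next e)        l≢ = ⊥-elim (ℕP.1+n≰n (subst (_≤ N) e l≤))
          off l l≤ (prev e)        l≢ = ⊥-elim (l≢ (ℕP.suc-injective (trans (sym e) (sym N≡))))
          off l l≤ (chord₀ e _)    l≢ = ⊥-elim (0≢N (sym e))
          off l l≤ (chordᵢ _ refl) l≢ = v₀
          off l l≤ (chordₙ _ refl) l≢ = z
          off l l≤ (chordⱼ _ refl) l≢ = vₙ

        i-is-odd : parity i ≡ 1ℙ
        i-is-odd with parity i in eq
        ... | 0ℙ = ⊥-elim (vᵢ≢0 (even-zero i i≤N eq))
        ... | 1ℙ = refl

        j-is-odd : parity j ≡ 1ℙ
        j-is-odd with parity j in eq
        ... | 0ℙ = ⊥-elim (vⱼ≢0 (even-zero j j≤N eq))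
        ... | 1ℙ = refl

  -- Zeros at 0 and N silence the chords; the values at 0 and 1 then determine the even and the odd
  -- positions.
  coordinates : Fin 3 → Fin n
  coordinates = triple (h 0) (h 1) (h N)

  determined : Determines (adjMatrix Γ) coordinates
  determined v ker z u with spanning u
  ... | k , k≤N , refl with parity k in eq
  ...   | 0ℙ = even-zero ker (z fz) (z (fs (fs fz))) k k≤N eq
  ...   | 1ℙ = odd-zero ker (z fz) (z (fs (fs fz))) (z (fs fz)) k k≤N eq

  nullity≤3 : ¬ KerDimAtLeast (adjMatrix Γ) 4
  nullity≤3 = Determines⇒¬KerDim (adjMatrix Γ) coordinates determined

  with-values : KerDimAtLeast (adjMatrix Γ) 3 → ∀ x y z →
    ∃ λ v → InKernel (adjMatrix Γ) v × v (h 0) ≡ x × v (h 1) ≡ y × v (h N) ≡ z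
  with-values dim x y z with interpolate (adjMatrix Γ) coordinates determined dim (triple x y z)
  ... | v , ker , val = v , ker , val fz , val (fs fz) , val (fs (fs fz))

  record OddChords : Set where
    field
      i-odd  : parity i ≡ 1ℙ
      j-odd  : parity j ≡ 1ℙ
      N-even : parity N ≡ 0ℙ

    i<N : i < N
    i<N = ℕP.≤∧≢⇒< i≤N (λ { refl → parity≢ {N} N-even i-odd })

  -- The kernel vector with values 0, 1, 0 at positions 0, 1, N vanishes exactly at the even
  -- positions, whereas it is nonzero at i and at j and zero at N.
  oddChords : KerDimAtLeast (adjMatrix Γ) 3 → OddChords
  oddChords dim with with-values dim 0ℚ 1ℚ 0ℚ
  ... | v , ker , v₀ , v₁ , vₙ = record
      { i-odd = i-is-odd ker v₀ vₙ v₁≢0 ; j-odd = j-is-odd ker v₀ vₙ v₁≢0 ; N-even = N-is-even ker v₀ vₙ v₁≢0 }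
    where
    v₁≢0 : v (h 1) ≢ 0ℚ
    v₁≢0 z = ℚP.1≢0 (trans (sym v₁) z)

  module _ (odd : OddChords) where
    open OddChords odd

    -- `v (h 0)` may be nonzero here, so zeros are carried down from N rather than up from 0. Rows
    -- strictly between i and N meet no chord except possibly the one to N, and `N ∸ suc i` is even.
    beyond-i : ∀ {v} → InKernel (adjMatrix Γ) v → v (h N) ≡ 0ℚ → v (h (suc i)) ≡ 0ℚ
    beyond-i {v} ker vₙ = subst (λ k → v (h k) ≡ 0ℚ) (ℕP.m∸[m∸n]≡n i<N)
      (evens (λ d → v (h (N ∸ d)) ≡ 0ℚ) (N ∸ suc i) descend vₙ (N ∸ suc i) ℕP.≤-refl even)
      where
      even : parity (N ∸ suc i) ≡ 0ℙ
      even = trans (parity-∸ i<N) (cong₂ _+ℙ_ N-even (odd-suc i i-odd))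
      descend : ∀ d → 2 + d ≤ N ∸ suc i → v (h (N ∸ d)) ≡ 0ℚ → v (h (N ∸ (2 + d))) ≡ 0ℚ
      descend d d≤ z = row-zero ker (ℕP.<⇒≤ k<N)
          (Adj-sym Γ (subst (λ q → Adj Γ (h (N ∸ (2 + d))) (h q)) below (linked (ℕP.<⇒≤ (subst (_< N) (sym below) k<N))))) off
        where
        k = N ∸ suc d
        2+d≤N : 2 + d ≤ N
        2+d≤N = ℕP.≤-trans d≤ (ℕP.m∸n≤m N (suc i))
        below : suc (N ∸ (2 + d)) ≡ k
        below = sym (∸-suc 2+d≤N)
        above : N ∸ d ≡ suc k
        above = ∸-suc (ℕP.<⇒≤ 2+d≤N)
        k<N : k < N
        k<N = ℕP.∸-monoʳ-< {N} {suc d} {0} (s≤s z≤n) (ℕP.<⇒≤ 2+d≤N)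
        i<k : i < k
        i<k = ℕP.m+n≤o⇒m≤o∸n (suc i) (subst (_≤ N) (ℕP.+-comm (suc d) (suc i))
                (ℕP.m≤o∸n⇒m+n≤o (suc d) i<N (ℕP.<⇒≤ d≤)))
        off : ∀ l → l ≤ N → Link N i j k l → l ≢ N ∸ (2 + d) → v (h l) ≡ 0ℚ
        off l _ (next e)        l≢ = subst (λ q → v (h q) ≡ 0ℚ) (trans above (sym e)) z
        off l _ (prev e)        l≢ = ⊥-elim (l≢ (ℕP.suc-injective (trans (sym e) (sym below))))
        off l _ (chord₀ e _)    l≢ = ⊥-elim (ℕP.<⇒≢ (ℕP.≤-trans (s≤s z≤n) i<k) (sym e))
        off l _ (chordᵢ e _)    l≢ = ⊥-elim (ℕP.<⇒≢ i<k (sym e))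
        off l _ (chordₙ e _)    l≢ = ⊥-elim (ℕP.<⇒≢ k<N e)
        off l _ (chordⱼ _ refl) l≢ = vₙ

-- Nullity 3 forces nullity 2 on every cycle

module _ {n} (Γ : SignedGraph n) (leafFree : LeafFree Γ) (bicyclic : Bicyclic Γ) where
  open Structure Γ leafFree bicyclic

  cycleNullity : KerDimAtLeast (adjMatrix Γ) 3 → ∀ C → CycleNullity Γ C 2
  cycleNullity dim C = KerDim-dual (cycleMatrix Γ C) coords vectors vectors-ker diag off , nullity≤2
    where
    open SpineAlong (spineAlong C)
    open CycleKernel C hiding (determined; with-values)
    open SpineKernel S
    odd : OddChords
    odd = oddChords dim
    open OddChords odd

    -- The two-term rows of `C`, listed from the vertex at which the spine starts.
    Restricted : (Fin n → ℚ) → Set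
    Restricted v = ∀ s → s ≤ m →
      adjMatrix Γ (W (suc (r + s))) (W (r + s)) *ℚ v (W (r + s)) +ℚ
      adjMatrix Γ (W (suc (r + s))) (W (2 + (r + s))) *ℚ v (W (2 + (r + s))) ≡ 0ℚ

    module _ {v} (ker : InKernel (adjMatrix Γ) v) (vₙ : v (h N) ≡ 0ℚ) where

      -- With `h a` and `h b` the cycle neighbours of `h s`, this turns a row of Γ into a row of the
      -- cycle. The equations for `u`, `p` and `q` carry it from spine positions to the indices of
      -- the closed walk.
      two-terms : ∀ {s a b} → s ≤ N → a ≤ N → b ≤ N → a ≢ b →
        (∀ l → l ≤ N → Link N i j s l → l ≢ a → l ≢ b → v (h l) ≡ 0ℚ) →
        ∀ {u p q} → u ≡ h s → p ≡ h a → q ≡ h b →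
        adjMatrix Γ u p *ℚ v p +ℚ adjMatrix Γ u q *ℚ v q ≡ 0ℚ
      two-terms {s} {a} {b} s≤ a≤ b≤ a≢b zeros refl refl refl =
        trans (sym (row-two Γ v (h s) (h a) (h b) (λ e → a≢b (injective a≤ b≤ e)) outside)) (ker (h s))
        where
        outside : ∀ w → Adj Γ (h s) w → w ≢ h a → w ≢ h b → v w ≡ 0ℚ
        outside w sw w≢a w≢b with spanning w
        ... | l , l≤ , refl = zeros l l≤ (links s≤ l≤ sw) (λ e → w≢a (cong h e)) (λ e → w≢b (cong h e))

      m≡i : m ≡ i
      m≡i = sym i≡m
      m<N : m < N
      m<N = subst (_< N) i≡m i<N

      h≡ : ∀ s → s ≤ m → W (suc (r + s)) ≡ h s
      h≡ s s≤ = sym (along s≤)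

      wrap-back : W (r + 0) ≡ h m
      wrap-back = trans (trans (cong W (ℕP.+-identityʳ r)) (trans (sym (W-period r)) (cong W (ℕP.+-suc r m)))) (h≡ m ℕP.≤-refl)

      wrap-forward : W (2 + (r + m)) ≡ h 0
      wrap-forward = trans (trans (cong W (cong suc (trans (sym (ℕP.+-suc r m)) (cong (_+ suc m) (sym (ℕP.+-identityʳ r))))))
        (W-period (suc (r + 0)))) (h≡ 0 z≤n)

      restricted : Restricted v
      restricted zero _ = two-terms z≤n (ℕP.<⇒≤ m<N) 0<N (ℕP.>⇒≢ 2≤m) zeros (h≡ 0 z≤n) wrap-back
          (trans (cong W (cong suc (sym (ℕP.+-suc r 0)))) (h≡ 1 (ℕP.<⇒≤ 2≤m)))
        where
        zeros : ∀ l → l ≤ N → Link N i j 0 l → l ≢ m → l ≢ 1 → v (h l) ≡ 0ℚ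
        zeros l _ (next e)        l≢ l≢′ = ⊥-elim (l≢′ e)
        zeros l _ (prev ())       l≢ l≢′
        zeros l _ (chord₀ _ e)    l≢ l≢′ = ⊥-elim (l≢ (trans e i≡m))
        zeros l _ (chordᵢ e _)    l≢ l≢′ = ⊥-elim (0≢i e)
        zeros l _ (chordₙ e _)    l≢ l≢′ = ⊥-elim (0≢N e)
        zeros l _ (chordⱼ _ refl) l≢ l≢′ = vₙ
      restricted (suc s) s<m with ℕP.m≤n⇒m<n∨m≡n s<m
      ... | inj₁ 1+s<m = two-terms (ℕP.<⇒≤ 1+s<N) (ℕP.<⇒≤ (ℕP.<⇒≤ 1+s<N)) 1+s<N (ℕP.<⇒≢ (ℕP.m≤n+m (suc s) 1)) zeros
          (h≡ (suc s) s<m) (trans (cong W (ℕP.+-suc r s)) (h≡ s (ℕP.<⇒≤ s<m)))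
          (trans (cong W (cong suc (sym (ℕP.+-suc r (suc s))))) (h≡ (2 + s) 1+s<m))
        where
        1+s<N : suc s < N
        1+s<N = ℕP.<-trans 1+s<m m<N
        zeros : ∀ l → l ≤ N → Link N i j (suc s) l → l ≢ s → l ≢ 2 + s → v (h l) ≡ 0ℚ
        zeros l _ (next e)        l≢ l≢′ = ⊥-elim (l≢′ e)
        zeros l _ (prev e)        l≢ l≢′ = ⊥-elim (l≢ (ℕP.suc-injective (sym e)))
        zeros l _ (chord₀ () _)   l≢ l≢′
        zeros l _ (chordᵢ e _)    l≢ l≢′ = ⊥-elim (ℕP.<⇒≢ 1+s<m (trans e i≡m))
        zeros l _ (chordₙ e _)    l≢ l≢′ = ⊥-elim (ℕP.<⇒≢ 1+s<N e)
        zeros l _ (chordⱼ _ refl) l≢ l≢′ = vₙ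
      ... | inj₂ 1+s≡m = two-terms (subst (_≤ N) (sym 1+s≡m) (ℕP.<⇒≤ m<N)) (ℕP.≤-trans (ℕP.<⇒≤ s<m) (ℕP.<⇒≤ m<N)) z≤n
          (ℕP.>⇒≢ (ℕP.≤-pred (subst (2 ≤_) (sym 1+s≡m) 2≤m))) zeros
          (h≡ (suc s) s<m) (trans (cong W (ℕP.+-suc r s)) (h≡ s (ℕP.<⇒≤ s<m)))
          (trans (cong (λ z → W (2 + (r + z))) 1+s≡m) wrap-forward)
        where
        1+s≡i : suc s ≡ i
        1+s≡i = trans 1+s≡m m≡i
        zeros : ∀ l → l ≤ N → Link N i j (suc s) l → l ≢ s → l ≢ 0 → v (h l) ≡ 0ℚ
        -- Here the path leaves the cycle, towards position i + 1.
        zeros l _ (next e)        l≢ l≢′ =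
          subst (λ q → v (h q) ≡ 0ℚ) (trans (cong suc (sym 1+s≡i)) (sym e)) (beyond-i odd ker vₙ)
        zeros l _ (prev e)        l≢ l≢′ = ⊥-elim (l≢ (ℕP.suc-injective (sym e)))
        zeros l _ (chord₀ () _)   l≢ l≢′
        zeros l _ (chordᵢ _ e)    l≢ l≢′ = ⊥-elim (l≢′ e)
        zeros l _ (chordₙ e _)    l≢ l≢′ = ⊥-elim (ℕP.<⇒≢ i<N (trans (sym 1+s≡i) e))
        zeros l _ (chordⱼ _ refl) l≢ l≢′ = vₙ

      restrict-ker : InKernel (cycleMatrix Γ C) (v ∘ vs C)
      restrict-ker b with shift-surjective (suc r) (s≤s r≤m) b
      ... | s , s≤ , refl = trans (cycle-row (v ∘ vs C) (r + s)) (restricted s s≤)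

    -- Both vectors vanish at N, and on the positions 0 and 1 they are dual.
    e₀ = with-values dim 1ℚ 0ℚ 0ℚ
    e₁ = with-values dim 0ℚ 1ℚ 0ℚ

    coords : Fin 2 → Fin (len C)
    coords = pair (idx (suc r + 0)) (idx (suc r + 1))

    vectors : Fin 2 → Fin (len C) → ℚ
    vectors = pair (proj₁ e₀ ∘ vs C) (proj₁ e₁ ∘ vs C)

    vectors-ker : ∀ a → InKernel (cycleMatrix Γ C) (vectors a)
    vectors-ker fz      = restrict-ker (proj₁ (proj₂ e₀)) (proj₂ (proj₂ (proj₂ (proj₂ e₀))))
    vectors-ker (fs fz) = restrict-ker (proj₁ (proj₂ e₁)) (proj₂ (proj₂ (proj₂ (proj₂ e₁))))

    at₀ : ∀ v → v (h 0) ≡ v (W (suc r + 0))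
    at₀ v = cong v (along z≤n)
    at₁ : ∀ v → v (h 1) ≡ v (W (suc r + 1))
    at₁ v = cong v (along (ℕP.<⇒≤ 2≤m))

    diag : ∀ a → vectors a (coords a) ≡ 1ℚ
    diag fz      = trans (sym (at₀ (proj₁ e₀))) (proj₁ (proj₂ (proj₂ e₀)))
    diag (fs fz) = trans (sym (at₁ (proj₁ e₁))) (proj₁ (proj₂ (proj₂ (proj₂ e₁))))

    off : ∀ a b → a ≢ b → vectors a (coords b) ≡ 0ℚ
    off fz      fz      a≢b = ⊥-elim (a≢b refl)
    off fz      (fs fz) a≢b = trans (sym (at₁ (proj₁ e₀))) (proj₁ (proj₂ (proj₂ (proj₂ e₀))))
    off (fs fz) fz      a≢b = trans (sym (at₀ (proj₁ e₁))) (proj₁ (proj₂ (proj₂ e₁)))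
    off (fs fz) (fs fz) a≢b = ⊥-elim (a≢b refl)

-- Nullity 2 on two cycles gives nullity 3

proportional : ∀ a b c {x y} x′ y′ → b ≢ 0ℚ → a *ℚ x +ℚ b *ℚ y ≡ 0ℚ → a *ℚ x′ +ℚ b *ℚ y′ ≡ 0ℚ →
  x ≡ c *ℚ x′ → y ≡ c *ℚ y′
proportional a b c {_} {y} x′ y′ b≢0 e e′ refl = begin
  y                                  ≡⟨ solve 3 (λ y c z → y := (y :+ (:- (c :* z))) :+ c :* z) refl y c y′ ⟩
  (y +ℚ (-ℚ (c *ℚ y′))) +ℚ c *ℚ y′   ≡⟨ cong (_+ℚ c *ℚ y′) (*-cancelˡ-0 b≢0 difference) ⟩
  0ℚ +ℚ c *ℚ y′                      ≡⟨ ℚP.+-identityˡ _ ⟩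
  c *ℚ y′                            ∎
  where
  difference : b *ℚ (y +ℚ (-ℚ (c *ℚ y′))) ≡ 0ℚ
  difference = begin
    b *ℚ (y +ℚ (-ℚ (c *ℚ y′)))
      ≡⟨ solve 6 (λ a b c x y z → b :* (y :+ (:- (c :* z))) :=
           (a :* (c :* x) :+ b :* y) :+ (:- (c :* (a :* x :+ b :* z)))) refl a b c x′ y y′ ⟩
    (a *ℚ (c *ℚ x′) +ℚ b *ℚ y) +ℚ (-ℚ (c *ℚ (a *ℚ x′ +ℚ b *ℚ y′)))
      ≡⟨ cong₂ (λ p q → p +ℚ (-ℚ (c *ℚ q))) e e′ ⟩
    0ℚ +ℚ (-ℚ (c *ℚ 0ℚ))
      ≡⟨ solve 1 (λ c → con 0ℚ :+ (:- (c :* con 0ℚ)) := con 0ℚ) refl c ⟩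
    0ℚ ∎

module Base {n} {Γ : SignedGraph n} (S : Spine Γ) where
  open SpineKernel S hiding (determined; with-values)

  A : ℕ → ℕ → ℚ
  A k l = adjMatrix Γ (h k) (h l)

  0<i : 0 < i
  0<i = ℕP.<⇒≤ 2≤i

  base : Cycle Γ
  base = cycleFromPath h i 2≤i
    (record { injective = λ a≤ b≤ → injective (ℕP.≤-trans a≤ i≤N) (ℕP.≤-trans b≤ i≤N)
            ; linked = λ k< → linked (ℕP.≤-trans k< i≤N) })
    (Adj-sym Γ adj₀)

  open CycleKernel base

  W≡h : ∀ {t} → t ≤ i → W t ≡ h t
  W≡h {t} t≤i = cong h (trans (toℕ-idx t) (m≤n⇒m%n≡m t≤i))

  module _ x (ker : InKernel (cycleMatrix Γ base) x) where

    row-mid : ∀ k → 2 + k ≤ i → A (suc k) k *ℚ x (idx k) +ℚ A (suc k) (2 + k) *ℚ x (idx (2 + k)) ≡ 0ℚ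
    row-mid k le = trans (cong₂ (λ p q → p *ℚ x (idx k) +ℚ q *ℚ x (idx (2 + k)))
        (sym (cong₂ (adjMatrix Γ) (W≡h (ℕP.<⇒≤ le)) (W≡h (ℕP.<⇒≤ (ℕP.<⇒≤ le)))))
        (sym (cong₂ (adjMatrix Γ) (W≡h (ℕP.<⇒≤ le)) (W≡h le)))) (kernel-row x ker k)

    row-i : ∀ k → suc k ≡ i → A i k *ℚ x (idx k) +ℚ A i 0 *ℚ x (idx 0) ≡ 0ℚ
    row-i k 1+k≡i = trans (cong₂ _+ℚ_
        (cong (_*ℚ x (idx k)) (sym (cong₂ (adjMatrix Γ) Wi (W≡h (ℕP.<⇒≤ (ℕP.≤-reflexive 1+k≡i))))))
        (cong₂ _*ℚ_ (sym (cong₂ (adjMatrix Γ) Wi (trans (cong (vs base) around) (W≡h z≤n)))) (cong x (sym around))))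
      (kernel-row x ker k)
      where
      Wi : W (suc k) ≡ h i
      Wi = trans (cong W 1+k≡i) (W≡h ℕP.≤-refl)
      around : idx (2 + k) ≡ idx 0
      around = trans (cong (idx ∘ suc) 1+k≡i) (idx-period 0)

    row-0 : A 0 i *ℚ x (idx i) +ℚ A 0 1 *ℚ x (idx 1) ≡ 0ℚ
    row-0 = trans (cong₂ _+ℚ_
        (cong (_*ℚ x (idx i)) (sym (cong₂ (adjMatrix Γ) W0 (W≡h ℕP.≤-refl))))
        (cong₂ _*ℚ_ (sym (cong₂ (adjMatrix Γ) W0 (trans (cong (vs base) (idx-period 1)) (W≡h 0<i)))) (cong x (sym (idx-period 1)))))
      (kernel-row x ker i)
      where
      W0 : W (suc i) ≡ h 0
      W0 = trans (cong (vs base) (idx-period 0)) (W≡h z≤n)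

  pos : Fin n → ℕ
  pos u = proj₁ (spanning u)

  fromPos : (ℕ → ℚ) → Fin n → ℚ
  fromPos y u = y (pos u)

  fromPos-h : ∀ y {k} → k ≤ N → fromPos y (h k) ≡ y k
  fromPos-h y {k} k≤ with spanning (h k)
  ... | l , l≤ , eq = cong y (injective l≤ k≤ eq)

  -- Every row below is verified in one of two forms: all neighbours carry 0, or all but two do and
  -- these two cancel.
  data Row (y : ℕ → ℚ) (k : ℕ) : Set where
    zeros : (∀ l → l ≤ N → Link N i j k l → y l ≡ 0ℚ) → Row y k
    two   : ∀ a b → a ≤ N → b ≤ N → a ≢ b → A k a *ℚ y a +ℚ A k b *ℚ y b ≡ 0ℚ →
            (∀ l → l ≤ N → Link N i j k l → l ≢ a → l ≢ b → y l ≡ 0ℚ) → Row y k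

  fromPos-InKernel : ∀ y → (∀ k → k ≤ N → Row y k) → InKernel (adjMatrix Γ) (fromPos y)
  fromPos-InKernel y rows u with spanning u
  ... | k , k≤ , refl with rows k k≤
  ...   | zeros z = ∑-zero (λ w → term-zero Γ (fromPos y) (h k) w (λ a → all w a))
    where
    all : ∀ w → Adj Γ (h k) w → fromPos y w ≡ 0ℚ
    all w a with spanning w
    ... | l , l≤ , refl = z l l≤ (links k≤ l≤ a)
  ...   | two a b a≤ b≤ a≢b eq z =
    trans (row-two Γ (fromPos y) (h k) (h a) (h b) (λ e → a≢b (injective a≤ b≤ e)) outside)
      (trans (cong₂ (λ p q → A k a *ℚ p +ℚ A k b *ℚ q) (fromPos-h y a≤) (fromPos-h y b≤)) eq)
    where
    outside : ∀ w → Adj Γ (h k) w → w ≢ h a → w ≢ h b → fromPos y w ≡ 0ℚ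
    outside w kw w≢a w≢b with spanning w
    ... | l , l≤ , refl = z l l≤ (links k≤ l≤ kw) (λ e → w≢a (cong h e)) (λ e → w≢b (cong h e))

  module _ (dim : KerDimAtLeast (cycleMatrix Γ base) 2) where

    i-odd′ : parity i ≡ 1ℙ
    i-odd′ = even-pred i (even-length dim)

    -- On the odd positions y is a multiple of the cycle's kernel vector with values 0, 1 at 0, 1.
    closing : (y : ℕ → ℚ) → (∀ k → 2 + k ≤ N → A (suc k) k *ℚ y k +ℚ A (suc k) (2 + k) *ℚ y (2 + k) ≡ 0ℚ) →
      A 0 i *ℚ y i +ℚ A 0 1 *ℚ y 1 ≡ 0ℚ
    closing y rec with with-values dim 0ℚ 1ℚ
    ... | x , ker , _ , x₁ = begin
        A 0 i *ℚ y i +ℚ A 0 1 *ℚ y 1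
          ≡⟨ cong₂ (λ p q → A 0 i *ℚ p +ℚ A 0 1 *ℚ q) (multiple i ℕP.≤-refl i-odd′) (multiple 1 0<i refl) ⟩
        A 0 i *ℚ (y 1 *ℚ x (idx i)) +ℚ A 0 1 *ℚ (y 1 *ℚ x (idx 1))
          ≡⟨ solve 5 (λ a b c x z → a :* (c :* x) :+ b :* (c :* z) := c :* (a :* x :+ b :* z)) refl
               (A 0 i) (A 0 1) (y 1) (x (idx i)) (x (idx 1)) ⟩
        y 1 *ℚ (A 0 i *ℚ x (idx i) +ℚ A 0 1 *ℚ x (idx 1))
          ≡⟨ trans (cong (y 1 *ℚ_) (row-0 x ker)) (ℚP.*-zeroʳ (y 1)) ⟩
        0ℚ ∎
      where
      multiple : ∀ k → k ≤ i → parity k ≡ 1ℙ → y k ≡ y 1 *ℚ x (idx k)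
      multiple = odds (λ k → y k ≡ y 1 *ℚ x (idx k)) i
        (λ k le eq → proportional (A (suc k) k) (A (suc k) (2 + k)) (y 1) (x (idx k)) (x (idx (2 + k)))
           (adjMatrix-adj Γ (linked (ℕP.≤-trans le i≤N))) (rec k (ℕP.≤-trans le i≤N)) (row-mid x ker k le) eq)
        (sym (trans (cong (y 1 *ℚ_) x₁) (ℚP.*-identityʳ (y 1))))

    module _ (odd : OddChords) where
      open OddChords odd

      -- With x 1 = 0 the cycle vector vanishes at the odd positions. The cycle is attached to the
      -- rest of Γ through i and, if j ≤ i, through j; both are odd, so no outside row meets a
      -- nonzero value.
      cycleVector : ∃ λ v → InKernel (adjMatrix Γ) v × v (h 0) ≡ 1ℚ × v (h N) ≡ 0ℚ ×
        (∀ k → k ≤ N → parity k ≡ 1ℙ → v (h k) ≡ 0ℚ)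
      cycleVector with with-values dim 1ℚ 0ℚ
      ... | x , ker , x₀ , x₁ = fromPos y , fromPos-InKernel y rows ,
          trans (fromPos-h y z≤n) (trans (y-≤ z≤n) x₀) , trans (fromPos-h y ℕP.≤-refl) (y-> i<N) ,
          (λ k k≤ pk → trans (fromPos-h y k≤) (y-odd k pk))
        where
        y : ℕ → ℚ
        y k = if does (k ≤? i) then x (idx k) else 0ℚ
        y-≤ : ∀ {k} → k ≤ i → y k ≡ x (idx k)
        y-≤ {k} k≤ = cong (λ b → if b then x (idx k) else 0ℚ) (dec-true (k ≤? i) k≤)
        y-> : ∀ {k} → i < k → y k ≡ 0ℚ
        y-> {k} i<k = cong (λ b → if b then x (idx k) else 0ℚ) (dec-false (k ≤? i) (ℕP.<⇒≱ i<k))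
        y-odd : ∀ k → parity k ≡ 1ℙ → y k ≡ 0ℚ
        y-odd k pk with ℕP.<-≤-connex i k
        ... | inj₁ i<k = y-> i<k
        ... | inj₂ k≤i = trans (y-≤ k≤i) (odds-zero x ker x₁ k pk)
        yₙ : y N ≡ 0ℚ
        yₙ = y-> i<N

        rows : ∀ k → k ≤ N → Row y k
        rows zero _ = two i 1 i≤N 0<N (ℕP.>⇒≢ 2≤i)
            (trans (cong₂ (λ p q → A 0 i *ℚ p +ℚ A 0 1 *ℚ q) (y-≤ ℕP.≤-refl) (y-≤ 0<i)) (row-0 x ker)) rest
          where
          rest : ∀ l → l ≤ N → Link N i j 0 l → l ≢ i → l ≢ 1 → y l ≡ 0ℚ
          rest l _ (next e)        l≢ l≢′ = ⊥-elim (l≢′ e)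
          rest l _ (prev ())       l≢ l≢′
          rest l _ (chord₀ _ e)    l≢ l≢′ = ⊥-elim (l≢ e)
          rest l _ (chordᵢ e _)    l≢ l≢′ = ⊥-elim (0≢i e)
          rest l _ (chordₙ e _)    l≢ l≢′ = ⊥-elim (0≢N e)
          rest l _ (chordⱼ _ refl) l≢ l≢′ = yₙ
        rows (suc k) k<N with ℕP.<-cmp (suc k) i
        ... | tri< 1+k<i _ _ = two k (2 + k) (ℕP.<⇒≤ k<N) (ℕP.≤-trans 1+k<i i≤N) (ℕP.<⇒≢ (ℕP.m≤n+m (suc k) 1))
            (trans (cong₂ (λ p q → A (suc k) k *ℚ p +ℚ A (suc k) (2 + k) *ℚ q) (y-≤ (ℕP.<⇒≤ (ℕP.<⇒≤ 1+k<i))) (y-≤ 1+k<i))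
              (row-mid x ker k 1+k<i)) rest
          where
          rest : ∀ l → l ≤ N → Link N i j (suc k) l → l ≢ k → l ≢ 2 + k → y l ≡ 0ℚ
          rest l _ (next e)        l≢ l≢′ = ⊥-elim (l≢′ e)
          rest l _ (prev e)        l≢ l≢′ = ⊥-elim (l≢ (ℕP.suc-injective (sym e)))
          rest l _ (chord₀ () _)   l≢ l≢′
          rest l _ (chordᵢ e _)    l≢ l≢′ = ⊥-elim (ℕP.<⇒≢ 1+k<i e)
          rest l _ (chordₙ e _)    l≢ l≢′ = ⊥-elim (ℕP.<⇒≢ (ℕP.≤-trans 1+k<i i≤N) e)
          rest l _ (chordⱼ _ refl) l≢ l≢′ = yₙ
        ... | tri≈ _ 1+k≡i _ = two k 0 (ℕP.<⇒≤ k<N) z≤n (ℕP.>⇒≢ (ℕP.≤-pred (subst (2 ≤_) (sym 1+k≡i) 2≤i)))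
            (trans (cong₂ (λ p q → A (suc k) k *ℚ p +ℚ A (suc k) 0 *ℚ q) (y-≤ (ℕP.<⇒≤ (ℕP.≤-reflexive 1+k≡i))) (y-≤ z≤n))
              (subst (λ z → A z k *ℚ x (idx k) +ℚ A z 0 *ℚ x (idx 0) ≡ 0ℚ) (sym 1+k≡i) (row-i x ker k 1+k≡i))) rest
          where
          rest : ∀ l → l ≤ N → Link N i j (suc k) l → l ≢ k → l ≢ 0 → y l ≡ 0ℚ
          rest l _ (next e)        l≢ l≢′ = y-> (ℕP.≤-reflexive (trans (cong suc (sym 1+k≡i)) (sym e)))
          rest l _ (prev e)        l≢ l≢′ = ⊥-elim (l≢ (ℕP.suc-injective (sym e)))
          rest l _ (chord₀ () _)   l≢ l≢′
          rest l _ (chordᵢ _ e)    l≢ l≢′ = ⊥-elim (l≢′ e)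
          rest l _ (chordₙ e _)    l≢ l≢′ = ⊥-elim (ℕP.<⇒≢ i<N (trans (sym 1+k≡i) e))
          rest l _ (chordⱼ _ refl) l≢ l≢′ = yₙ
        ... | tri> _ _ i<1+k = zeros rest
          where
          rest : ∀ l → l ≤ N → Link N i j (suc k) l → y l ≡ 0ℚ
          rest l _ (next refl)     = y-> (ℕP.m≤n⇒m≤1+n i<1+k)
          -- Only position i + 1 looks back into the cycle along the path, at i.
          rest l _ (prev refl) with ℕP.m≤n⇒m<n∨m≡n (ℕP.≤-pred i<1+k)
          ... | inj₁ i<k  = y-> i<k
          ... | inj₂ refl = y-odd i i-odd
          rest l _ (chord₀ () _)
          rest l _ (chordᵢ e _)    = ⊥-elim (ℕP.>⇒≢ i<1+k e)
          rest l _ (chordₙ _ refl) = y-odd j j-odd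
          rest l _ (chordⱼ _ refl) = yₙ

-- Reading the path backwards exchanges the chords, so what is proved about the cycle at the start
-- of a spine holds for the one at its end.
reverse : ∀ {n} {Γ : SignedGraph n} → Spine Γ → Spine Γ
reverse {Γ = Γ} S = record
  { h = λ k → h (N ∸ k) ; N = N ; i = N ∸ j ; j = N ∸ i
  ; 2≤i = ℕP.m+n≤o⇒m≤o∸n 2 2+j≤N
  ; i≤N = ℕP.m∸n≤m N j
  ; 2+j≤N = subst (2 + (N ∸ i) ≤_) (ℕP.m+[n∸m]≡n i≤N) (ℕP.+-monoˡ-≤ (N ∸ i) 2≤i)
  ; distinct = λ (e , e′) → distinct (ℕP.≤-antisym i≤N (ℕP.m∸n≡0⇒m≤n e′) ,
      trans (sym (ℕP.m∸[m∸n]≡n j≤N)) (trans (cong (N ∸_) e) (ℕP.n∸n≡0 N)))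
  ; path = record
      { injective = λ {a} {b} a≤ b≤ eq →
          flipped a≤ b≤ (injective (ℕP.m∸n≤m N a) (ℕP.m∸n≤m N b) eq)
      ; linked = λ {k} k<N → Adj-sym Γ (subst (λ z → Adj Γ (h (N ∸ suc k)) (h z)) (sym (∸-suc k<N))
          (linked (subst (_≤ N) (∸-suc k<N) (ℕP.m∸n≤m N k)))) }
  ; adj₀ = subst (λ z → Adj Γ (h N) (h z)) (sym (ℕP.m∸[m∸n]≡n j≤N)) adjₙ
  ; adjₙ = subst₂ (λ y z → Adj Γ (h y) (h z)) (sym (ℕP.n∸n≡0 N)) (sym (ℕP.m∸[m∸n]≡n i≤N)) adj₀
  ; spanning = λ u → let (k , k≤ , eq) = spanning u in
      N ∸ k , ℕP.m∸n≤m N k , trans (cong h (ℕP.m∸[m∸n]≡n k≤)) eq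
  ; links = λ {k} {l} k≤ l≤ a → relink k≤ l≤ (links (ℕP.m∸n≤m N k) (ℕP.m∸n≤m N l) a)
  }
  where
  open Spine S
  flipped : ∀ {a b} → a ≤ N → b ≤ N → N ∸ a ≡ N ∸ b → a ≡ b
  flipped a≤ b≤ eq = ℕP.∸-cancelˡ-≡ a≤ b≤ eq
  moved : ∀ {a b} → a ≤ N → N ∸ a ≡ b → a ≡ N ∸ b
  moved a≤ eq = trans (sym (ℕP.m∸[m∸n]≡n a≤)) (cong (N ∸_) eq)
  stepped : ∀ {a b} → a ≤ N → b ≤ N → N ∸ a ≡ suc (N ∸ b) → b ≡ suc a
  stepped {a} {b} a≤ b≤ eq = flipped b≤ a<N (ℕP.suc-injective (trans (sym eq) (∸-suc {N} {a} a<N)))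
    where
    a<N : a < N
    a<N = ℕP.m∸n≢0⇒n<m (λ z → ℕP.0≢1+n (trans (sym z) eq))
  relink : ∀ {k l} → k ≤ N → l ≤ N → Link N i j (N ∸ k) (N ∸ l) → Link N (N ∸ j) (N ∸ i) k l
  relink k≤ l≤ (next e)     = prev (stepped l≤ k≤ e)
  relink k≤ l≤ (prev e)     = next (stepped k≤ l≤ e)
  relink k≤ l≤ (chord₀ e f) = chordₙ (moved k≤ e) (moved l≤ f)
  relink k≤ l≤ (chordᵢ e f) = chordⱼ (moved k≤ e) (moved l≤ f)
  relink k≤ l≤ (chordₙ e f) = chord₀ (trans (moved k≤ e) (ℕP.n∸n≡0 N)) (moved l≤ f)
  relink k≤ l≤ (chordⱼ e f) = chordᵢ (moved k≤ e) (trans (moved l≤ f) (ℕP.n∸n≡0 N))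

module _ {n} {Γ : SignedGraph n} (S : Spine Γ) where
  open SpineKernel S
  open Base S using (A; base; i-odd′; closing; cycleVector; Row; zeros; two; fromPos; fromPos-h; fromPos-InKernel)
  private
    module R = Base (reverse S)

  module _ (cycles : ∀ C → CycleNullity Γ C 2) (n-odd : parity n ≡ 1ℙ) where

    -- The two base cycles have the even lengths i + 1 and N - j + 1, and N = n - 1.
    cycles⇒oddChords : OddChords
    cycles⇒oddChords = record { i-odd = i-odd′ (proj₁ (cycles base)) ; j-odd = j-odd ; N-even = N-even }
      where
      N-even : parity N ≡ 0ℙ
      N-even = odd-pred N (trans (cong parity (sym n≡sucN)) n-odd)
      j-odd : parity j ≡ 1ℙ
      j-odd = trans (cong (_+ℙ parity j) (sym N-even)) (trans (sym (parity-∸ j≤N)) (R.i-odd′ (proj₁ (cycles R.base))))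

    private
      odd : OddChords
      odd = cycles⇒oddChords
      open OddChords odd

      odd′ : SpineKernel.OddChords (reverse S)
      odd′ = record
        { i-odd = trans (parity-∸ j≤N) (cong₂ _+ℙ_ N-even j-odd)
        ; j-odd = trans (parity-∸ i≤N) (cong₂ _+ℙ_ N-even i-odd)
        ; N-even = N-even }

    -- Supported on the odd positions. Entries at edges are their own inverses, so - a b serves as
    -- the quotient - a / b when a row is solved for its next value.
    alternating : ℕ → ℚ
    alternating zero          = 0ℚ
    alternating (suc zero)    = 1ℚ
    alternating (suc (suc k)) = (-ℚ (A (suc k) k *ℚ A (suc k) (2 + k))) *ℚ alternating k

    alternating-row : ∀ k → 2 + k ≤ N →
      A (suc k) k *ℚ alternating k +ℚ A (suc k) (2 + k) *ℚ alternating (2 + k) ≡ 0ℚ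
    alternating-row k le = begin
      a *ℚ y +ℚ b *ℚ ((-ℚ (a *ℚ b)) *ℚ y)
        ≡⟨ solve 3 (λ a b y → a :* y :+ b :* ((:- (a :* b)) :* y) := a :* y :+ (:- ((b :* b) :* (a :* y)))) refl a b y ⟩
      a *ℚ y +ℚ (-ℚ ((b *ℚ b) *ℚ (a *ℚ y)))
        ≡⟨ cong (λ z → a *ℚ y +ℚ (-ℚ (z *ℚ (a *ℚ y)))) (adjMatrix-square Γ (linked le)) ⟩
      a *ℚ y +ℚ (-ℚ (1ℚ *ℚ (a *ℚ y)))
        ≡⟨ solve 1 (λ z → z :+ (:- (con 1ℚ :* z)) := con 0ℚ) refl (a *ℚ y) ⟩
      0ℚ ∎
      where
      a = A (suc k) k
      b = A (suc k) (2 + k)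
      y = alternating k

    alternating-even : ∀ k → parity k ≡ 0ℙ → alternating k ≡ 0ℚ
    alternating-even k = evens (λ k → alternating k ≡ 0ℚ) k
      (λ k _ z → trans (cong ((-ℚ (A (suc k) k *ℚ A (suc k) (2 + k))) *ℚ_) z) (ℚP.*-zeroʳ (-ℚ (A (suc k) k *ℚ A (suc k) (2 + k)))))
      refl k ℕP.≤-refl

    -- The row at 0 is not part of the recursion. On the odd positions up to i the recursion is that
    -- of the first cycle, whose nullity 2 makes it close up.
    alternating-start : A 0 i *ℚ alternating i +ℚ A 0 1 *ℚ alternating 1 ≡ 0ℚ
    alternating-start = closing (proj₁ (cycles base)) alternating alternating-row

    -- Read backwards, `alternating` satisfies the recursion of the reversed spine, so it closes up
    -- around the second cycle.
    alternating-end : A N j *ℚ alternating j +ℚ A N (N ∸ 1) *ℚ alternating (N ∸ 1) ≡ 0ℚ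
    alternating-end = subst (λ z → A N z *ℚ alternating z +ℚ A N (N ∸ 1) *ℚ alternating (N ∸ 1) ≡ 0ℚ)
        (ℕP.m∸[m∸n]≡n j≤N) (R.closing (proj₁ (cycles R.base)) (λ k → alternating (N ∸ k)) rows)
      where
      rows : ∀ k → 2 + k ≤ N → R.A (suc k) k *ℚ alternating (N ∸ k) +ℚ
                                R.A (suc k) (2 + k) *ℚ alternating (N ∸ (2 + k)) ≡ 0ℚ
      rows k le = trans (ℚP.+-comm (A (N ∸ suc k) (N ∸ k) *ℚ alternating (N ∸ k)) (A (N ∸ suc k) (N ∸ (2 + k)) *ℚ alternating (N ∸ (2 + k))))
        (subst₂ (λ p q → A p (N ∸ (2 + k)) *ℚ alternating (N ∸ (2 + k)) +ℚ A p q *ℚ alternating q ≡ 0ℚ)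
          (sym (∸-suc {N} {suc k} le)) (sym (trans (∸-suc {N} {k} (ℕP.<⇒≤ le)) (cong suc (∸-suc {N} {suc k} le))))
          (alternating-row (N ∸ (2 + k)) (subst (_≤ N)
            (trans (∸-suc {N} {k} (ℕP.<⇒≤ le)) (cong suc (∸-suc {N} {suc k} le))) (ℕP.m∸n≤m N k))))

    -- Every edge joins an odd to an even position, since i and j are odd and N is even. Rows at odd
    -- positions meet only zeros; the others are the recursion and its two closing conditions.
    alternating-rows : ∀ k → k ≤ N → Row alternating k
    alternating-rows k k≤N with parity k in pk
    ... | 1ℙ = zeros rest
      where
      rest : ∀ l → l ≤ N → Link N i j k l → alternating l ≡ 0ℚ
      rest l _ (next refl)     = alternating-even l (odd-suc k pk)
      rest l _ (prev refl)     = alternating-even l (odd-pred l pk)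
      rest l _ (chord₀ refl _) = ⊥-elim (parity≢ {0} refl pk)
      rest l _ (chordᵢ _ refl) = refl
      rest l _ (chordₙ refl _) = ⊥-elim (parity≢ {N} N-even pk)
      rest l _ (chordⱼ _ refl) = alternating-even N N-even
    alternating-rows zero _ | 0ℙ = two i 1 i≤N 0<N (ℕP.>⇒≢ 2≤i) alternating-start rest
      where
      rest : ∀ l → l ≤ N → Link N i j 0 l → l ≢ i → l ≢ 1 → alternating l ≡ 0ℚ
      rest l _ (next e)        l≢ l≢′ = ⊥-elim (l≢′ e)
      rest l _ (prev ())       l≢ l≢′
      rest l _ (chord₀ _ e)    l≢ l≢′ = ⊥-elim (l≢ e)
      rest l _ (chordᵢ e _)    l≢ l≢′ = ⊥-elim (0≢i e)
      rest l _ (chordₙ e _)    l≢ l≢′ = ⊥-elim (0≢N e)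
      rest l _ (chordⱼ _ refl) l≢ l≢′ = alternating-even N N-even
    alternating-rows (suc k) k<N | 0ℙ with ℕP.m≤n⇒m<n∨m≡n k<N
    ... | inj₁ 1+k<N = two k (2 + k) (ℕP.<⇒≤ k<N) 1+k<N (ℕP.<⇒≢ (ℕP.m≤n+m (suc k) 1)) (alternating-row k 1+k<N) rest
      where
      rest : ∀ l → l ≤ N → Link N i j (suc k) l → l ≢ k → l ≢ 2 + k → alternating l ≡ 0ℚ
      rest l _ (next e)        l≢ l≢′ = ⊥-elim (l≢′ e)
      rest l _ (prev e)        l≢ l≢′ = ⊥-elim (l≢ (ℕP.suc-injective (sym e)))
      rest l _ (chord₀ () _)   l≢ l≢′
      rest l _ (chordᵢ _ refl) l≢ l≢′ = refl
      rest l _ (chordₙ e _)    l≢ l≢′ = ⊥-elim (ℕP.<⇒≢ 1+k<N e)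
      rest l _ (chordⱼ _ refl) l≢ l≢′ = alternating-even N N-even
    ... | inj₂ 1+k≡N = two j k j≤N (ℕP.<⇒≤ k<N)
          (ℕP.<⇒≢ (ℕP.≤-pred (subst (2 + j ≤_) (sym 1+k≡N) 2+j≤N)))
          (subst₂ (λ p q → A p j *ℚ alternating j +ℚ A p q *ℚ alternating q ≡ 0ℚ)
             (sym 1+k≡N) (cong (_∸ 1) (sym 1+k≡N)) alternating-end) rest
      where
      rest : ∀ l → l ≤ N → Link N i j (suc k) l → l ≢ j → l ≢ k → alternating l ≡ 0ℚ
      rest l l≤ (next e)       l≢ l≢′ = ⊥-elim (ℕP.1+n≰n (subst (_≤ N) (trans e (cong suc 1+k≡N)) l≤))
      rest l _ (prev e)        l≢ l≢′ = ⊥-elim (l≢′ (ℕP.suc-injective (sym e)))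
      rest l _ (chord₀ () _)   l≢ l≢′
      rest l _ (chordᵢ _ refl) l≢ l≢′ = refl
      rest l _ (chordₙ _ e)    l≢ l≢′ = ⊥-elim (l≢ e)
      rest l _ (chordⱼ _ refl) l≢ l≢′ = alternating-even N N-even

    -- One vector for each of the positions 0, 1 and N, in the order of `coordinates`; `Z` comes
    -- from the second cycle, read backwards.
    nullity≡3 : Nullity Γ 3
    nullity≡3 = KerDim-dual (adjMatrix Γ) coordinates vectors vectors-ker diag off , nullity≤3
      where
      Y = cycleVector (proj₁ (cycles base)) odd
      Z = R.cycleVector (proj₁ (cycles R.base)) odd′
      Y-vanishes : ∀ k → k ≤ N → parity k ≡ 1ℙ → proj₁ Y (h k) ≡ 0ℚ
      Y-vanishes = proj₂ (proj₂ (proj₂ (proj₂ Y)))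
      Z-vanishes : ∀ k → k ≤ N → parity k ≡ 1ℙ → proj₁ Z (h (N ∸ k)) ≡ 0ℚ
      Z-vanishes = proj₂ (proj₂ (proj₂ (proj₂ Z)))
      vectors : Fin 3 → Fin n → ℚ
      vectors = triple (proj₁ Y) (fromPos alternating) (proj₁ Z)
      vectors-ker : ∀ a → InKernel (adjMatrix Γ) (vectors a)
      vectors-ker fz           = proj₁ (proj₂ Y)
      vectors-ker (fs fz)      = fromPos-InKernel alternating alternating-rows
      vectors-ker (fs (fs fz)) = proj₁ (proj₂ Z)
      diag : ∀ a → vectors a (coordinates a) ≡ 1ℚ
      diag fz           = proj₁ (proj₂ (proj₂ Y))
      diag (fs fz)      = fromPos-h alternating 0<N
      diag (fs (fs fz)) = proj₁ (proj₂ (proj₂ Z))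
      off : ∀ a b → a ≢ b → vectors a (coordinates b) ≡ 0ℚ
      off fz           fz           a≢b = ⊥-elim (a≢b refl)
      off fz           (fs fz)      a≢b = Y-vanishes 1 0<N refl
      off fz           (fs (fs fz)) a≢b = proj₁ (proj₂ (proj₂ (proj₂ Y)))
      off (fs fz)      fz           a≢b = fromPos-h alternating z≤n
      off (fs fz)      (fs fz)      a≢b = ⊥-elim (a≢b refl)
      off (fs fz)      (fs (fs fz)) a≢b = trans (fromPos-h alternating ℕP.≤-refl) (alternating-even N N-even)
      off (fs (fs fz)) fz           a≢b = trans (cong (λ k → proj₁ Z (h k)) (sym (ℕP.n∸n≡0 N))) (proj₁ (proj₂ (proj₂ (proj₂ Z))))
      off (fs (fs fz)) (fs fz)      a≢b = trans (cong (λ k → proj₁ Z (h k)) (sym (ℕP.m∸[m∸n]≡n 0<N)))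
        (Z-vanishes (N ∸ 1) (ℕP.m∸n≤m N 1) (trans (parity-∸ 0<N) (cong (_+ℙ 1ℙ) N-even)))
      off (fs (fs fz)) (fs (fs fz)) a≢b = ⊥-elim (a≢b refl)

-- Isomorphisms with ∞- and θ-graphs

arcLabel : ℕ → (ℕ → ℕ) → ℕ → ℕ
arcLabel a g zero    = a
arcLabel a g (suc t) = g t

arcLabel-tail : ∀ a g t → arcLabel (g 0) (g ∘ suc) t ≡ arcLabel a g (suc t)
arcLabel-tail a g zero    = refl
arcLabel-tail a g (suc t) = refl

-- The shape common to all chains in `inftyEdges` and `thetaEdges`. With c = a it is a cycle.
arcEdges : ℕ → ℕ → ℕ → ℕ → List (ℕ × ℕ)
arcEdges a b K c = chain (a ∷ range b K ++ (c ∷ []))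

private
  -- A general labelling `g` in place of `b +_`, so that induction on `K` can shift it to `g ∘ suc`.
  edges′ : ℕ → (ℕ → ℕ) → ℕ → ℕ → List (ℕ × ℕ)
  edges′ a g K c = chain (a ∷ applyUpTo g K ++ (c ∷ []))

  inner′ : ∀ a g K c t → t < K → (arcLabel a g t , arcLabel a g (suc t)) ∈ edges′ a g K c
  inner′ a g (suc K) c zero    _         = here refl
  inner′ a g (suc K) c (suc t) (s≤s t<K) = there
    (subst (λ x → (x , g (suc t)) ∈ edges′ (g 0) (g ∘ suc) K c) (arcLabel-tail a g t) (inner′ (g 0) (g ∘ suc) K c t t<K))

  last′ : ∀ a g K c → (arcLabel a g K , c) ∈ edges′ a g K c
  last′ a g zero    c = here refl
  last′ a g (suc K) c = there
    (subst (λ x → (x , c) ∈ edges′ (g 0) (g ∘ suc) K c) (arcLabel-tail a g K) (last′ (g 0) (g ∘ suc) K c))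

  elim′ : ∀ a g K c {x y} → (x , y) ∈ edges′ a g K c →
    (∃ λ t → t < K × x ≡ arcLabel a g t × y ≡ arcLabel a g (suc t)) ⊎ (x ≡ arcLabel a g K × y ≡ c)
  elim′ a g zero    c (here refl) = inj₂ (refl , refl)
  elim′ a g (suc K) c (here refl) = inj₁ (0 , s≤s z≤n , refl , refl)
  elim′ a g (suc K) c (there m) with elim′ (g 0) (g ∘ suc) K c m
  ... | inj₁ (t , t<K , x≡ , y≡) = inj₁ (suc t , s≤s t<K , trans x≡ (arcLabel-tail a g t) , y≡)
  ... | inj₂ (x≡ , y≡)           = inj₂ (trans x≡ (arcLabel-tail a g K) , y≡)

  arcEdges≡ : ∀ a b K c → arcEdges a b K c ≡ edges′ a (b +_) K c
  arcEdges≡ a b K c = cong (λ xs → chain (a ∷ xs ++ (c ∷ []))) (map-applyUpTo id (b +_) K)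

arc-inner∈ : ∀ a b K c t → t < K → (arcLabel a (b +_) t , b + t) ∈ arcEdges a b K c
arc-inner∈ a b K c t t<K = subst (_ ∈_) (sym (arcEdges≡ a b K c)) (inner′ a (b +_) K c t t<K)

arc-last∈ : ∀ a b K c → (arcLabel a (b +_) K , c) ∈ arcEdges a b K c
arc-last∈ a b K c = subst ((arcLabel a (b +_) K , c) ∈_) (sym (arcEdges≡ a b K c)) (last′ a (b +_) K c)

arc-elim : ∀ a b K c {x y} → (x , y) ∈ arcEdges a b K c →
  (∃ λ t → t < K × x ≡ arcLabel a (b +_) t × y ≡ b + t) ⊎ (x ≡ arcLabel a (b +_) K × y ≡ c)
arc-elim a b K c m = elim′ a (b +_) K c (subst (_ ∈_) (arcEdges≡ a b K c) m)

-- Φ numbers the positions of a spine with chords 0 – i and N – j by the vertices of the graph with edges es.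
record Labelling (N i j : ℕ) (es : List (ℕ × ℕ)) : Set where
  field
    Φ     : ℕ → ℕ
    onto  : ∀ x → x ≤ N → ∃ λ k → k ≤ N × Φ k ≡ x
    along : ∀ k → k < N → EdgeIn es (Φ k) (Φ (suc k))
    start : EdgeIn es (Φ 0) (Φ i)
    end   : EdgeIn es (Φ N) (Φ j)
    sound : ∀ {x y} → (x , y) ∈ es →
            ∃ λ k → ∃ λ l → k ≤ N × l ≤ N × Link N i j k l × Φ k ≡ x × Φ l ≡ y

injective⇒surjective : ∀ {n} {f : Fin n → Fin n} → (∀ {x y} → f x ≡ f y → x ≡ y) → ∀ u → ∃ λ x → f x ≡ u
injective⇒surjective {suc n} {f} inj u with any? (λ x → f x ≟F u)
... | yes found = found
... | no ¬found = ⊥-elim (ℕP.1+n≰n (injective⇒≤ {f = λ x → punchOut (λ e → ¬found (x , sym e))}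
        (λ {x} {y} eq → inj (punchOut-injective (λ e → ¬found (x , sym e)) (λ e → ¬found (y , sym e)) eq))))

-- A section of `φ` is injective, hence bijective by finiteness, and its inverse agrees with `φ`.
labelBijection : ∀ {n m} → n ≡ m → (φ : Fin n → ℕ) → (∀ x → x < m → ∃ λ u → φ u ≡ x) →
  Σ (Fin n ↔ Fin m) λ f → ∀ u → toℕ (Inverse.to f u) ≡ φ u
labelBijection {n} refl φ onto = mk↔ₛ′ τ σ τσ στ , τ-φ
  where
  σ : Fin n → Fin n
  σ x = proj₁ (onto (toℕ x) (toℕ<n x))
  φσ : ∀ x → φ (σ x) ≡ toℕ x
  φσ x = proj₂ (onto (toℕ x) (toℕ<n x))
  σ-injective : ∀ {x y} → σ x ≡ σ y → x ≡ y
  σ-injective {x} {y} eq = toℕ-injective (trans (sym (φσ x)) (trans (cong φ eq) (φσ y)))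
  τ : Fin n → Fin n
  τ u = proj₁ (injective⇒surjective σ-injective u)
  στ : ∀ u → σ (τ u) ≡ u
  στ u = proj₂ (injective⇒surjective σ-injective u)
  τσ : ∀ x → τ (σ x) ≡ x
  τσ x = σ-injective (στ (σ x))
  τ-φ : ∀ u → toℕ (τ u) ≡ φ u
  τ-φ u = trans (sym (φσ (τ u))) (cong φ (στ u))

module _ {n} {Γ : SignedGraph n} (S : Spine Γ) where
  open Spine S

  labelling⇒iso : ∀ {m es} → suc N ≡ m → Labelling N i j es → IsoTo Γ m es
  labelling⇒iso {m} {es} N≡ L = f , λ u w → mk⇔ (to u w) (from u w)
    where
    open Labelling L
    φ : Fin n → ℕ
    φ u = Φ (proj₁ (spanning u))
    φ-h : ∀ {k} → k ≤ N → φ (h k) ≡ Φ k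
    φ-h {k} k≤ = cong Φ (injective (proj₁ (proj₂ (spanning (h k)))) k≤ (proj₂ (proj₂ (spanning (h k)))))
    bijection = labelBijection (trans n≡sucN N≡) φ
      (λ x x<m → let (k , k≤ , eq) = onto x (ℕP.≤-pred (subst (x <_) (sym N≡) x<m)) in h k , trans (φ-h k≤) eq)
    f = proj₁ bijection
    label : ∀ u → toℕ (Inverse.to f u) ≡ φ u
    label = proj₂ bijection
    φ-injective : ∀ {u w} → φ u ≡ φ w → u ≡ w
    φ-injective {u} {w} eq = Injection.injective (↔⇒↣ f) (toℕ-injective (trans (label u) (trans eq (sym (label w)))))

    link-edge : ∀ {k l} → k ≤ N → l ≤ N → Link N i j k l → EdgeIn es (Φ k) (Φ l)
    link-edge k≤ l≤ (next refl)        = along _ l≤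
    link-edge k≤ l≤ (prev refl)        = swap (along _ k≤)
    link-edge k≤ l≤ (chord₀ refl refl) = start
    link-edge k≤ l≤ (chordᵢ refl refl) = swap start
    link-edge k≤ l≤ (chordₙ refl refl) = end
    link-edge k≤ l≤ (chordⱼ refl refl) = swap end

    to : ∀ u w → Adj Γ u w → EdgeIn es (toℕ (Inverse.to f u)) (toℕ (Inverse.to f w))
    to u w a = subst₂ (EdgeIn es) (sym (label u)) (sym (label w))
      (link-edge (proj₁ (proj₂ (spanning u))) (proj₁ (proj₂ (spanning w)))
        (links (proj₁ (proj₂ (spanning u))) (proj₁ (proj₂ (spanning w)))
          (subst₂ (Adj Γ) (sym (proj₂ (proj₂ (spanning u)))) (sym (proj₂ (proj₂ (spanning w)))) a)))

    sound-adj : ∀ {u w} → (φ u , φ w) ∈ es → Adj Γ u w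
    sound-adj {u} {w} e with sound e
    ... | k , l , k≤ , l≤ , lk , Φk , Φl = subst₂ (Adj Γ)
      (φ-injective (trans (φ-h k≤) Φk)) (φ-injective (trans (φ-h l≤) Φl)) (link-adj path adj₀ adjₙ k≤ l≤ lk)

    from : ∀ u w → EdgeIn es (toℕ (Inverse.to f u)) (toℕ (Inverse.to f w)) → Adj Γ u w
    from u w e with subst₂ (EdgeIn es) (label u) (label w) e
    ... | inj₁ e∈ = sound-adj e∈
    ... | inj₂ e∈ = Adj-sym Γ (sound-adj e∈)

-- One arcEdges a b K c of the target graph, traced along the positions P 0, …, P K, γ of the spine.
record Arc (Φ : ℕ → ℕ) (N i j a b K c : ℕ) : Set where
  field
    P      : ℕ → ℕ
    γ      : ℕ
    P≤     : ∀ t → t ≤ K → P t ≤ N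
    γ≤     : γ ≤ N
    inner  : ∀ t → t < K → Link N i j (P t) (P (suc t))
    last   : Link N i j (P K) γ
    label₀ : Φ (P 0) ≡ a
    labelₛ : ∀ t → t < K → Φ (P (suc t)) ≡ b + t
    labelᵧ : Φ γ ≡ c

  label : ∀ t → t ≤ K → Φ (P t) ≡ arcLabel a (b +_) t
  label zero    _ = label₀
  label (suc t) t< = labelₛ t t<

  inner∈ : ∀ t → t < K → (Φ (P t) , Φ (P (suc t))) ∈ arcEdges a b K c
  inner∈ t t<K = subst₂ (λ x y → (x , y) ∈ arcEdges a b K c)
    (sym (label t (ℕP.<⇒≤ t<K))) (sym (labelₛ t t<K)) (arc-inner∈ a b K c t t<K)

  last∈ : (Φ (P K) , Φ γ) ∈ arcEdges a b K c
  last∈ = subst₂ (λ x y → (x , y) ∈ arcEdges a b K c) (sym (label K ℕP.≤-refl)) (sym labelᵧ) (arc-last∈ a b K c)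

  arc-sound : ∀ {x y} → (x , y) ∈ arcEdges a b K c →
    ∃ λ k → ∃ λ l → k ≤ N × l ≤ N × Link N i j k l × Φ k ≡ x × Φ l ≡ y
  arc-sound e with arc-elim a b K c e
  ... | inj₁ (t , t<K , refl , refl) =
    P t , P (suc t) , P≤ t (ℕP.<⇒≤ t<K) , P≤ (suc t) t<K , inner t t<K , label t (ℕP.<⇒≤ t<K) , labelₛ t t<K
  ... | inj₂ (refl , refl) = P K , γ , P≤ K ℕP.≤-refl , γ≤ , last , label K ℕP.≤-refl , labelᵧ

if-yes : ∀ {P : Set} (d : Dec P) {x y : ℕ} → P → (if does d then x else y) ≡ x
if-yes d {x} {y} p = cong (λ b → if b then x else y) (dec-true d p)

if-no : ∀ {P : Set} (d : Dec P) {x y : ℕ} → ¬ P → (if does d then x else y) ≡ y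
if-no d {x} {y} ¬p = cong (λ b → if b then x else y) (dec-false d ¬p)

descend-link : ∀ {N i j} q t → t < q → Link N i j (q ∸ t) (q ∸ suc t)
descend-link q t t<q = prev (∸-suc {q} {t} t<q)

ascend-link : ∀ {N i j} q t → Link N i j (q + t) (q + suc t)
ascend-link q t = next (ℕP.+-suc q t)

cover-down : ∀ {Φ N i j a b q c} (A : Arc Φ N i j a b q c) → (∀ t → Arc.P A t ≡ q ∸ t) →
  ∀ k → k < q → (Φ (suc k) , Φ k) ∈ arcEdges a b q c
cover-down {Φ} {a = a} {b} {q} {c} A P≡ k k<q = subst₂ (λ x y → (Φ x , Φ y) ∈ arcEdges a b q c)
  (trans (P≡ (q ∸ suc k)) (ℕP.m∸[m∸n]≡n k<q))
  (trans (P≡ (suc (q ∸ suc k))) (trans (cong (q ∸_) (sym (∸-suc {q} {k} k<q))) (ℕP.m∸[m∸n]≡n (ℕP.<⇒≤ k<q))))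
  (Arc.inner∈ A (q ∸ suc k) (ℕP.≤-trans (ℕP.≤-reflexive (sym (∸-suc {q} {k} k<q))) (ℕP.m∸n≤m q k)))

cover-up : ∀ {Φ N i j a b K c} q (A : Arc Φ N i j a b K c) → (∀ t → Arc.P A t ≡ q + t) →
  ∀ k → q ≤ k → k < q + K → (Φ k , Φ (suc k)) ∈ arcEdges a b K c
cover-up {Φ} {a = a} {b} {K} {c} q A P≡ k q≤k k< = subst₂ (λ x y → (Φ x , Φ y) ∈ arcEdges a b K c)
  (trans (P≡ (k ∸ q)) (ℕP.m+[n∸m]≡n q≤k))
  (trans (P≡ (suc (k ∸ q))) (trans (ℕP.+-suc q (k ∸ q)) (cong suc (ℕP.m+[n∸m]≡n q≤k))))
  (Arc.inner∈ A (k ∸ q) (ℕP.+-cancelˡ-< q _ _ (subst (_< q + K) (sym (ℕP.m+[n∸m]≡n q≤k)) k<)))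

-- The case i = j. The vertex shared by the cycles must be labelled 0, so the positions up to i are
-- numbered backwards. The second cycle has the 3 + e positions from i to N.
module InftyTouching (i e : ℕ) where
  N j : ℕ
  j = i
  N = i + (2 + e)
  es = inftyEdges (suc i) (3 + e) 1

  Φ : ℕ → ℕ
  Φ k = if does (k ≤? i) then i ∸ k else k

  Φ-low : ∀ {k} → k ≤ i → Φ k ≡ i ∸ k
  Φ-low {k} k≤i = if-yes (k ≤? i) k≤i
  Φ-high : ∀ {k} → i < k → Φ k ≡ k
  Φ-high {k} i<k = if-no (k ≤? i) (ℕP.<⇒≱ i<k)
  Φ-i : Φ i ≡ 0
  Φ-i = trans (Φ-low ℕP.≤-refl) (ℕP.n∸n≡0 i)

  first : Arc Φ N i j 0 1 i 0
  first = record
    { P = i ∸_ ; γ = i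
    ; P≤ = λ t _ → ℕP.≤-trans (ℕP.m∸n≤m i t) (ℕP.m≤m+n i _) ; γ≤ = ℕP.m≤m+n i _
    ; inner = descend-link i ; last = chord₀ (ℕP.n∸n≡0 i) refl
    ; label₀ = Φ-i
    ; labelₛ = λ t t<i → trans (Φ-low (ℕP.m∸n≤m i (suc t))) (ℕP.m∸[m∸n]≡n t<i)
    ; labelᵧ = Φ-i }

  second : Arc Φ N i j 0 (suc i) (2 + e) 0
  second = record
    { P = i +_ ; γ = i
    ; P≤ = λ t → ℕP.+-monoʳ-≤ i ; γ≤ = ℕP.m≤m+n i _
    ; inner = λ t _ → ascend-link i t ; last = chordₙ refl refl
    ; label₀ = trans (cong Φ (ℕP.+-identityʳ i)) Φ-i
    ; labelₛ = λ t _ → trans (cong Φ (ℕP.+-suc i t)) (Φ-high (s≤s (ℕP.m≤m+n i t)))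
    ; labelᵧ = Φ-i }

  labelling : Labelling N i j es
  labelling = record
    { Φ = Φ ; onto = onto ; along = along
    ; start = inj₁ (∈-++⁺ˡ (subst (λ z → (Φ z , Φ i) ∈ arcEdges 0 1 i 0) (ℕP.n∸n≡0 i) (Arc.last∈ first)))
    ; end = inj₁ (∈-++⁺ʳ _ (Arc.last∈ second))
    ; sound = sound }
    where
    onto : ∀ x → x ≤ N → ∃ λ k → k ≤ N × Φ k ≡ x
    onto x x≤N with ℕP.<-≤-connex i x
    ... | inj₁ i<x = x , x≤N , Φ-high i<x
    ... | inj₂ x≤i = i ∸ x , ℕP.≤-trans (ℕP.m∸n≤m i x) (ℕP.m≤m+n i _) ,
                     trans (Φ-low (ℕP.m∸n≤m i x)) (ℕP.m∸[m∸n]≡n x≤i)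
    along : ∀ k → k < N → EdgeIn es (Φ k) (Φ (suc k))
    along k k<N with ℕP.<-≤-connex k i
    ... | inj₁ k<i = inj₂ (∈-++⁺ˡ (cover-down first (λ _ → refl) k k<i))
    ... | inj₂ i≤k = inj₁ (∈-++⁺ʳ _ (cover-up i second (λ _ → refl) k i≤k k<N))
    sound : ∀ {x y} → (x , y) ∈ es → ∃ λ k → ∃ λ l → k ≤ N × l ≤ N × Link N i j k l × Φ k ≡ x × Φ l ≡ y
    sound e∈ with ∈-++⁻ (arcEdges 0 1 i 0) e∈
    ... | inj₁ m = Arc.arc-sound first m
    ... | inj₂ m = Arc.arc-sound second m

-- The case i < j, with d positions strictly between. The first cycle is numbered backwards from i,
-- the second upwards from p starting at j, and the d connecting positions receive the last labels,
-- as in `inftyEdges`.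
module InftyJoined (i d e : ℕ) where
  N j p q : ℕ
  j = i + suc d
  N = j + (2 + e)
  p = suc i
  q = 3 + e
  es = inftyEdges p q (2 + d)

  Φ : ℕ → ℕ
  Φ k = if does (k ≤? i) then i ∸ k else (if does (k <? j) then p + q + (k ∸ p) else p + (k ∸ j))

  i<j : i < j
  i<j = ℕP.m<m+n i (s≤s z≤n)
  i≤N : i ≤ N
  i≤N = ℕP.≤-trans (ℕP.<⇒≤ i<j) (ℕP.m≤m+n j _)

  Φ-low : ∀ {k} → k ≤ i → Φ k ≡ i ∸ k
  Φ-low {k} k≤i = if-yes (k ≤? i) k≤i
  Φ-mid : ∀ t → t < d → Φ (i + suc t) ≡ p + q + t
  Φ-mid t t<d = trans (if-no (i + suc t ≤? i) (ℕP.<⇒≱ (ℕP.m<m+n i (s≤s z≤n))))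
    (trans (if-yes (i + suc t <? j) (ℕP.+-monoʳ-< i (s≤s t<d)))
      (cong (p + q +_) (trans (cong (_∸ p) (ℕP.+-suc i t)) (ℕP.m+n∸m≡n p t))))
  Φ-high : ∀ t → Φ (j + t) ≡ p + t
  Φ-high t = trans (if-no (j + t ≤? i) (ℕP.<⇒≱ (ℕP.≤-trans i<j (ℕP.m≤m+n j t))))
    (trans (if-no (j + t <? j) (ℕP.≤⇒≯ (ℕP.m≤m+n j t))) (cong (p +_) (ℕP.m+n∸m≡n j t)))
  Φ-i : Φ i ≡ 0
  Φ-i = trans (Φ-low ℕP.≤-refl) (ℕP.n∸n≡0 i)
  Φ-j : Φ j ≡ p
  Φ-j = trans (cong Φ (sym (ℕP.+-identityʳ j))) (trans (Φ-high 0) (ℕP.+-identityʳ p))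

  first : Arc Φ N i j 0 1 i 0
  first = record
    { P = i ∸_ ; γ = i
    ; P≤ = λ t _ → ℕP.≤-trans (ℕP.m∸n≤m i t) i≤N ; γ≤ = i≤N
    ; inner = descend-link i ; last = chord₀ (ℕP.n∸n≡0 i) refl
    ; label₀ = Φ-i
    ; labelₛ = λ t t<i → trans (Φ-low (ℕP.m∸n≤m i (suc t))) (ℕP.m∸[m∸n]≡n t<i)
    ; labelᵧ = Φ-i }

  second : Arc Φ N i j p (suc p) (2 + e) p
  second = record
    { P = j +_ ; γ = j
    ; P≤ = λ t → ℕP.+-monoʳ-≤ j ; γ≤ = ℕP.m≤m+n j _
    ; inner = λ t _ → ascend-link j t ; last = chordₙ refl refl
    ; label₀ = trans (cong Φ (ℕP.+-identityʳ j)) Φ-j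
    ; labelₛ = λ t _ → trans (Φ-high (suc t)) (ℕP.+-suc p t)
    ; labelᵧ = Φ-j }

  third : Arc Φ N i j 0 (p + q) d p
  third = record
    { P = i +_ ; γ = j
    ; P≤ = λ t t≤d → ℕP.≤-trans (ℕP.+-monoʳ-≤ i (ℕP.m≤n⇒m≤1+n t≤d)) (ℕP.m≤m+n j _) ; γ≤ = ℕP.m≤m+n j _
    ; inner = λ t _ → ascend-link i t ; last = ascend-link i d
    ; label₀ = trans (cong Φ (ℕP.+-identityʳ i)) Φ-i
    ; labelₛ = Φ-mid
    ; labelᵧ = Φ-j }

  labelling : Labelling N i j es
  labelling = record
    { Φ = Φ ; onto = onto ; along = along
    ; start = inj₁ (∈-++⁺ˡ (subst (λ z → (Φ z , Φ i) ∈ arcEdges 0 1 i 0) (ℕP.n∸n≡0 i) (Arc.last∈ first)))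
    ; end = inj₁ (∈-++⁺ʳ (arcEdges 0 1 i 0) (∈-++⁺ˡ (Arc.last∈ second)))
    ; sound = sound }
    where
    onto : ∀ x → x ≤ N → ∃ λ k → k ≤ N × Φ k ≡ x
    onto x x≤N with ℕP.<-≤-connex x p
    ... | inj₁ (s≤s x≤i) = i ∸ x , ℕP.≤-trans (ℕP.m∸n≤m i x) i≤N ,
                     trans (Φ-low (ℕP.m∸n≤m i x)) (ℕP.m∸[m∸n]≡n x≤i)
    ... | inj₂ p≤x with ℕP.<-≤-connex x (p + q)
    ...   | inj₁ x<p+q = j + (x ∸ p) , ℕP.+-monoʳ-≤ j (ℕP.≤-pred (ℕP.+-cancelˡ-< p _ _ (subst (_< p + q) (sym (ℕP.m+[n∸m]≡n p≤x)) x<p+q))) ,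
                           trans (Φ-high (x ∸ p)) (ℕP.m+[n∸m]≡n p≤x)
    ...   | inj₂ p+q≤x = i + suc t , ℕP.≤-trans (ℕP.<⇒≤ (ℕP.+-monoʳ-< i (s≤s t<d))) (ℕP.m≤m+n j _) ,
                           trans (Φ-mid t t<d) (ℕP.m+[n∸m]≡n p+q≤x)
      where
      t = x ∸ (p + q)
      total : ∀ i d e → i + suc d + (2 + e) ≡ i + (3 + e) + d
      total = solve-∀
      t<d : t < d
      t<d = ℕP.+-cancelˡ-< (p + q) _ _ (subst (_< p + q + d) (sym (ℕP.m+[n∸m]≡n p+q≤x))
              (s≤s (ℕP.≤-trans x≤N (ℕP.≤-reflexive (total i d e)))))
    along : ∀ k → k < N → EdgeIn es (Φ k) (Φ (suc k))
    along k k<N with ℕP.<-≤-connex k i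
    ... | inj₁ k<i = inj₂ (∈-++⁺ˡ (cover-down first (λ _ → refl) k k<i))
    ... | inj₂ i≤k with ℕP.<-≤-connex k j
    ...   | inj₂ j≤k = inj₁ (∈-++⁺ʳ (arcEdges 0 1 i 0) (∈-++⁺ˡ (cover-up j second (λ _ → refl) k j≤k k<N)))
    ...   | inj₁ k<j with ℕP.<-≤-connex k (i + d)
    ...     | inj₁ k<i+d = inj₁ (∈-++⁺ʳ (arcEdges 0 1 i 0) (∈-++⁺ʳ (arcEdges p (suc p) (2 + e) p)
                             (cover-up i third (λ _ → refl) k i≤k k<i+d)))
    ...     | inj₂ i+d≤k = inj₁ (∈-++⁺ʳ (arcEdges 0 1 i 0) (∈-++⁺ʳ (arcEdges p (suc p) (2 + e) p)
                             (subst₂ (λ x y → (Φ x , Φ y) ∈ arcEdges 0 (p + q) d p) i+d≡k (trans (ℕP.+-suc i d) (cong suc i+d≡k)) (Arc.last∈ third))))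
      where
      i+d≡k : i + d ≡ k
      i+d≡k = ℕP.≤-antisym i+d≤k (ℕP.≤-pred (subst (k <_) (ℕP.+-suc i d) k<j))
    sound : ∀ {x y} → (x , y) ∈ es → ∃ λ k → ∃ λ l → k ≤ N × l ≤ N × Link N i j k l × Φ k ≡ x × Φ l ≡ y
    sound e∈ with ∈-++⁻ (arcEdges 0 1 i 0) e∈
    ... | inj₁ m = Arc.arc-sound first m
    ... | inj₂ m with ∈-++⁻ (arcEdges p (suc p) (2 + e) p) m
    ...   | inj₁ m′ = Arc.arc-sound second m′
    ...   | inj₂ m′ = Arc.arc-sound third m′

-- The case j < i. The branch vertices j and i are labelled 0 and 1. The three paths between them go
-- from j down to 0 and over the first chord, straight from j up to i, and over the second chord to
-- N and down to i; their lengths are j + 1, d + 1 and e + 1.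
module Theta (j d e : ℕ) where
  N i p q l : ℕ
  i = j + suc d
  N = i + e
  p = suc j
  q = suc d
  l = suc e
  es = thetaEdges p q l

  Φ : ℕ → ℕ
  Φ k = if does (k <? j) then 2 + (j ∸ suc k) else
        (if does (k ℕP.≟ j) then 0 else
        (if does (k <? i) then suc k else
        (if does (k ℕP.≟ i) then 1 else p + q + (N ∸ k))))

  j<i : j < i
  j<i = ℕP.m<m+n j (s≤s z≤n)
  j≤N : j ≤ N
  j≤N = ℕP.≤-trans (ℕP.<⇒≤ j<i) (ℕP.m≤m+n i _)

  Φ-low : ∀ t → t < j → Φ (j ∸ suc t) ≡ 2 + t
  Φ-low t t<j = trans (if-yes (j ∸ suc t <? j) below)
      (cong (2 +_) (trans (cong (j ∸_) (sym (∸-suc {j} {t} t<j))) (ℕP.m∸[m∸n]≡n (ℕP.<⇒≤ t<j))))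
    where
    below : j ∸ suc t < j
    below = ℕP.≤-trans (ℕP.≤-reflexive (sym (∸-suc {j} {t} t<j))) (ℕP.m∸n≤m j t)
  Φ-j : Φ j ≡ 0
  Φ-j = trans (if-no (j <? j) (ℕP.<-irrefl refl)) (if-yes (j ℕP.≟ j) refl)
  Φ-mid : ∀ t → t < d → Φ (j + suc t) ≡ suc p + t
  Φ-mid t t<d = trans (if-no (j + suc t <? j) (ℕP.<-asym j<))
    (trans (if-no (j + suc t ℕP.≟ j) (ℕP.>⇒≢ j<))
    (trans (if-yes (j + suc t <? i) (ℕP.+-monoʳ-< j (s≤s t<d))) (cong suc (ℕP.+-suc j t))))
    where
    j< : j < j + suc t
    j< = ℕP.m<m+n j (s≤s z≤n)
  Φ-i : Φ i ≡ 1
  Φ-i = trans (if-no (i <? j) (ℕP.<-asym j<i)) (trans (if-no (i ℕP.≟ j) (ℕP.>⇒≢ j<i))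
    (trans (if-no (i <? i) (ℕP.<-irrefl refl)) (if-yes (i ℕP.≟ i) refl)))
  Φ-high : ∀ t → t < e → Φ (N ∸ t) ≡ p + q + t
  Φ-high t t<e = trans (if-no (N ∸ t <? j) (ℕP.<-asym (ℕP.<-trans j<i i<)))
    (trans (if-no (N ∸ t ℕP.≟ j) (ℕP.>⇒≢ (ℕP.<-trans j<i i<)))
    (trans (if-no (N ∸ t <? i) (ℕP.<-asym i<)) (trans (if-no (N ∸ t ℕP.≟ i) (ℕP.>⇒≢ i<))
      (cong (p + q +_) (ℕP.m∸[m∸n]≡n (ℕP.≤-trans (ℕP.<⇒≤ t<e) (ℕP.m≤n+m e i)))))))
    where
    i< : i < N ∸ t
    i< = subst (i <_) (sym (ℕP.+-∸-assoc i (ℕP.<⇒≤ t<e))) (ℕP.m<m+n i (ℕP.m<n⇒0<n∸m t<e))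

  first : Arc Φ N i j 0 2 j 1
  first = record
    { P = j ∸_ ; γ = i
    ; P≤ = λ t _ → ℕP.≤-trans (ℕP.m∸n≤m j t) j≤N ; γ≤ = ℕP.m≤m+n i e
    ; inner = descend-link j ; last = chord₀ (ℕP.n∸n≡0 j) refl
    ; label₀ = Φ-j ; labelₛ = Φ-low ; labelᵧ = Φ-i }

  second : Arc Φ N i j 0 (suc p) d 1
  second = record
    { P = j +_ ; γ = i
    ; P≤ = λ t t≤d → ℕP.≤-trans (ℕP.+-monoʳ-≤ j (ℕP.m≤n⇒m≤1+n t≤d)) (ℕP.m≤m+n i e) ; γ≤ = ℕP.m≤m+n i e
    ; inner = λ t _ → ascend-link j t ; last = ascend-link j d
    ; label₀ = trans (cong Φ (ℕP.+-identityʳ j)) Φ-j ; labelₛ = Φ-mid ; labelᵧ = Φ-i }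

  third : Arc Φ N i j 0 (p + q) e 1
  third = record
    { P = P ; γ = i
    ; P≤ = P≤ ; γ≤ = ℕP.m≤m+n i e
    ; inner = inner ; last = last e refl
    ; label₀ = Φ-j ; labelₛ = Φ-high ; labelᵧ = Φ-i }
    where
    P : ℕ → ℕ
    P zero    = j
    P (suc t) = N ∸ t
    P≤ : ∀ t → t ≤ e → P t ≤ N
    P≤ zero    _ = j≤N
    P≤ (suc t) _ = ℕP.m∸n≤m N t
    inner : ∀ t → t < e → Link N i j (P t) (P (suc t))
    inner zero    _   = chordⱼ refl refl
    inner (suc t) t<e = descend-link N t (ℕP.≤-trans (ℕP.<⇒≤ t<e) (ℕP.m≤n+m e i))
    last : ∀ e′ → e′ ≡ e → Link N i j (P e′) i
    -- For e = 0 this path has no inner vertex: N = i, and the path is the chord itself.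
    last zero     refl = chordⱼ refl (sym (ℕP.+-identityʳ i))
    last (suc e′) refl = prev (trans (ℕP.+-∸-assoc i (ℕP.n≤1+n e′)) (trans (cong (i +_) (ℕP.m+n∸n≡m 1 e′)) (ℕP.+-comm i 1)))

  labelling : Labelling N i j es
  labelling = record
    { Φ = Φ ; onto = onto ; along = along
    ; start = inj₁ (∈-++⁺ˡ (subst (λ z → (Φ z , Φ i) ∈ arcEdges 0 2 j 1) (ℕP.n∸n≡0 j) (Arc.last∈ first)))
    ; end = end
    ; sound = sound }
    where
    third∈ : ∀ {xy} → xy ∈ arcEdges 0 (p + q) e 1 → xy ∈ es
    third∈ = ∈-++⁺ʳ (arcEdges 0 2 j 1) ∘ ∈-++⁺ʳ (arcEdges 0 (suc p) d 1)
    end : EdgeIn es (Φ N) (Φ j)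
    end with ℕP.<-≤-connex 0 e
    ... | inj₁ 0<e = inj₂ (third∈ (Arc.inner∈ third 0 0<e))
    ... | inj₂ e≤0 = inj₂ (third∈ (subst₂ (λ z x → (Φ (Arc.P third z) , Φ x) ∈ arcEdges 0 (p + q) e 1) (ℕP.n≤0⇒n≡0 e≤0)
                       (trans (sym (ℕP.+-identityʳ i)) (cong (i +_) (sym (ℕP.n≤0⇒n≡0 e≤0)))) (Arc.last∈ third)))
    onto : ∀ x → x ≤ N → ∃ λ k → k ≤ N × Φ k ≡ x
    onto zero          _   = j , j≤N , Φ-j
    onto (suc zero)    _   = i , ℕP.m≤m+n i e , Φ-i
    onto (suc (suc x)) x≤N with ℕP.<-≤-connex x j
    ... | inj₁ x<j = j ∸ suc x , ℕP.≤-trans (ℕP.m∸n≤m j (suc x)) j≤N , Φ-low x x<j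
    ... | inj₂ j≤x with ℕP.<-≤-connex x (j + d)
    ...   | inj₁ x<j+d = j + suc t , ℕP.≤-trans (ℕP.+-monoʳ-≤ j (ℕP.<⇒≤ (s≤s t<d))) (ℕP.m≤m+n i e) ,
                         trans (Φ-mid t t<d) (cong (2 +_) (ℕP.m+[n∸m]≡n j≤x))
      where
      t = x ∸ j
      t<d : t < d
      t<d = ℕP.+-cancelˡ-< j _ _ (subst (_< j + d) (sym (ℕP.m+[n∸m]≡n j≤x)) x<j+d)
    ...   | inj₂ j+d≤x = N ∸ t , ℕP.m∸n≤m N t , trans (Φ-high t t<e) (trans (cong (_+ t) (cong suc (ℕP.+-suc j d))) (cong (2 +_) (ℕP.m+[n∸m]≡n j+d≤x)))
      where
      t = x ∸ (j + d)
      t<e : t < e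
      t<e = ℕP.+-cancelˡ-< (j + d) _ _ (subst (_< j + d + e) (sym (ℕP.m+[n∸m]≡n j+d≤x))
              (ℕP.≤-pred (ℕP.≤-trans x≤N (ℕP.≤-reflexive (cong (_+ e) (ℕP.+-suc j d))))))
    along : ∀ k → k < N → EdgeIn es (Φ k) (Φ (suc k))
    along k k<N with ℕP.<-≤-connex k j
    ... | inj₁ k<j = inj₂ (∈-++⁺ˡ (cover-down first (λ _ → refl) k k<j))
    ... | inj₂ j≤k with ℕP.<-≤-connex k (j + d)
    ...   | inj₁ k<j+d = inj₁ (∈-++⁺ʳ (arcEdges 0 2 j 1) (∈-++⁺ˡ (cover-up j second (λ _ → refl) k j≤k k<j+d)))
    ...   | inj₂ j+d≤k with ℕP.<-≤-connex k i
    ...     | inj₁ k<i = inj₁ (∈-++⁺ʳ (arcEdges 0 2 j 1) (∈-++⁺ˡ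
                (subst₂ (λ x y → (Φ x , Φ y) ∈ arcEdges 0 (suc p) d 1) j+d≡k (trans (ℕP.+-suc j d) (cong suc j+d≡k)) (Arc.last∈ second))))
      where
      j+d≡k : j + d ≡ k
      j+d≡k = ℕP.≤-antisym j+d≤k (ℕP.≤-pred (subst (k <_) (ℕP.+-suc j d) k<i))
    ...     | inj₂ i≤k with ℕP.m≤n⇒m<n∨m≡n i≤k
    ...       | inj₁ i<k = inj₂ (third∈ (subst₂ (λ x y → (Φ x , Φ y) ∈ arcEdges 0 (p + q) e 1)
                  (ℕP.m∸[m∸n]≡n k<N) (trans (cong (N ∸_) (sym (∸-suc {N} {k} k<N))) (ℕP.m∸[m∸n]≡n (ℕP.<⇒≤ k<N)))
                  (Arc.inner∈ third (suc (N ∸ suc k)) (subst (_< e) (∸-suc {N} {k} k<N)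
                    (subst (N ∸ k <_) (ℕP.m+n∸m≡n i e) (ℕP.∸-monoʳ-< {N} {k} {i} i<k (ℕP.<⇒≤ k<N)))))))
    ...       | inj₂ refl = inj₂ (third∈ (subst (λ x → (Φ x , Φ i) ∈ arcEdges 0 (p + q) e 1)
                  (trans (cong (Arc.P third) (trans (sym (ℕP.m+n∸m≡n i e)) (∸-suc {N} {i} k<N))) (ℕP.m∸[m∸n]≡n k<N))
                  (Arc.last∈ third)))
    sound : ∀ {x y} → (x , y) ∈ es → ∃ λ k → ∃ λ l → k ≤ N × l ≤ N × Link N i j k l × Φ k ≡ x × Φ l ≡ y
    sound e∈ with ∈-++⁻ (arcEdges 0 2 j 1) e∈
    ... | inj₁ m = Arc.arc-sound first m
    ... | inj₂ m with ∈-++⁻ (arcEdges 0 (suc p) d 1) m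
    ...   | inj₁ m′ = Arc.arc-sound second m′
    ...   | inj₂ m′ = Arc.arc-sound third m′

-- Parity of the lengths in ∞- and θ-graphs

OddInfty EvenTheta : ∀ {n} → SignedGraph n → Set
OddInfty Γ = Σ ℕ λ l → Σ ℕ λ k → Σ ℕ λ x →
  InftyParams l k x × IsoTo Γ (inftyVerts l k x) (inftyEdges l k x) × Odd x
EvenTheta Γ = Σ ℕ λ l′ → Σ ℕ λ x′ → Σ ℕ λ k′ →
  ThetaParams l′ x′ k′ × IsoTo Γ (thetaVerts l′ x′ k′) (thetaEdges l′ x′ k′) × Even l′ × Even x′ × Even k′

parity-gap : ∀ a b {c} → c ≡ a + b → parity b ≡ parity c +ℙ parity a
parity-gap a b refl = trans (cancel (parity a) (parity b)) (cong (_+ℙ parity a) (sym (ℙP.+-homo-+ a b)))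
  where
  cancel : ∀ x y → y ≡ (x +ℙ y) +ℙ x
  cancel 0ℙ 0ℙ = refl
  cancel 0ℙ 1ℙ = refl
  cancel 1ℙ 0ℙ = refl
  cancel 1ℙ 1ℙ = refl

module _ {n} {Γ : SignedGraph n} (S : Spine Γ) (odd : SpineKernel.OddChords S) where
  open SpineKernel S
  open OddChords odd

  -- For i < j the connecting path has j - i + 1 vertices; the θ-lengths are j + 1, i - j and N - i
  -- + 1. Their parities follow from i and j odd and N even, and an even θ-length is not 1.
  spine-shape : OddInfty Γ ⊎ EvenTheta Γ
  spine-shape with ℕP.<-cmp i j
  ... | tri≈ _ i≡j _ = inj₁ (suc i , 3 + e , 1 , (s≤s 2≤i , s≤s (s≤s (s≤s z≤n)) , s≤s z≤n) ,
        labelling⇒iso S (trans (cong suc N≡) (cong (_∸ 2) (total i e)))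
          (subst₂ (λ N j → Labelling N i j (inftyEdges (suc i) (3 + e) 1)) (sym N≡) i≡j (InftyTouching.labelling i e)) ,
        parity⇒Odd {1} refl)
    where
    e = N ∸ (2 + j)
    N≡ : N ≡ i + (2 + e)
    N≡ = trans (sym (ℕP.m∸n+n≡m 2+j≤N)) (trans (rearrange e j) (cong (_+ (2 + e)) (sym i≡j)))
      where
      rearrange : ∀ e j → e + (2 + j) ≡ j + (2 + e)
      rearrange = solve-∀
    total : ∀ i e → 3 + (i + (2 + e)) ≡ suc i + (3 + e) + 1
    total = solve-∀
  ... | tri< i<j _ _ = inj₁ (suc i , 3 + e , 2 + d , (s≤s 2≤i , s≤s (s≤s (s≤s z≤n)) , s≤s z≤n) ,
        labelling⇒iso S (trans (cong suc N≡) (cong (_∸ 2) (total i d e)))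
          (subst₂ (λ N j → Labelling N i j (inftyEdges (suc i) (3 + e) (2 + d))) (sym N≡) (sym j≡) (InftyJoined.labelling i d e)) ,
        parity⇒Odd {2 + d} d-odd)
    where
    d = j ∸ suc i
    e = N ∸ (2 + j)
    j≡ : j ≡ i + suc d
    j≡ = trans (sym (ℕP.m+[n∸m]≡n i<j)) (sym (ℕP.+-suc i d))
    N≡ : N ≡ i + suc d + (2 + e)
    N≡ = trans (sym (ℕP.m∸n+n≡m 2+j≤N)) (trans (rearrange e j) (cong (_+ (2 + e)) j≡))
      where
      rearrange : ∀ e j → e + (2 + j) ≡ j + (2 + e)
      rearrange = solve-∀
    total : ∀ i d e → 3 + (i + suc d + (2 + e)) ≡ suc i + (3 + e) + (2 + d)
    total = solve-∀
    d-odd : parity d ≡ 1ℙ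
    d-odd = trans (parity-gap (suc i) d (sym (ℕP.m+[n∸m]≡n i<j))) (cong₂ _+ℙ_ j-odd (odd-suc i i-odd))
  ... | tri> _ _ j<i = inj₂ (suc j , suc d , suc e ,
        (s≤s z≤n , s≤s z≤n , s≤s z≤n , (λ (x , _) → even≢1 (odd-suc j j-odd) x) , (λ (x , _) → even≢1 (odd-suc j j-odd) x) ,
          (λ (x , _) → even≢1 (odd-suc d d-odd) x)) ,
        labelling⇒iso S (trans (cong suc N≡) (sym (ℕP.+-suc (j + suc d) e)))
          (subst₂ (λ N i → Labelling N i j (thetaEdges (suc j) (suc d) (suc e))) (sym N≡) (sym i≡) (Theta.labelling j d e)) ,
        parity⇒Even _ (odd-suc j j-odd) , parity⇒Even _ (odd-suc d d-odd) , parity⇒Even _ (odd-suc e e-odd))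
    where
    d = i ∸ suc j
    e = N ∸ i
    i≡ : i ≡ j + suc d
    i≡ = trans (sym (ℕP.m+[n∸m]≡n j<i)) (sym (ℕP.+-suc j d))
    N≡ : N ≡ j + suc d + e
    N≡ = trans (sym (ℕP.m+[n∸m]≡n i≤N)) (cong (_+ e) i≡)
    d-odd : parity d ≡ 1ℙ
    d-odd = trans (parity-gap (suc j) d (sym (ℕP.m+[n∸m]≡n j<i))) (cong₂ _+ℙ_ i-odd (odd-suc j j-odd))
    e-odd : parity e ≡ 1ℙ
    e-odd = trans (parity-∸ i≤N) (cong₂ _+ℙ_ N-even i-odd)
    even≢1 : ∀ {k} → parity k ≡ 0ℙ → k ≢ 1
    even≢1 p refl = parity≢ {1} p refl

-- A chain returning to its start in the target graph is pulled back to a cycle of Γ. This is how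
-- nullity 2 makes the cycle lengths of an ∞-graph even.
isoCycle : ∀ {n} {Γ : SignedGraph n} {m es} → IsoTo Γ m es → ∀ a b K → a < b → 2 ≤ K → b + K ≤ m →
  (∀ {xy} → xy ∈ arcEdges a b K a → xy ∈ es) → Σ (Cycle Γ) λ C → len C ≡ suc K
isoCycle {n} {Γ} {m} {es} (f , adj⇔) a b K a<b 2≤K b+K≤m arc⊆es =
  cycleFromPath (λ t → g (label t)) K 2≤K
    (record { injective = injective ; linked = λ {t} t<K → adj (labelled (ℕP.<⇒≤ t<K)) (labelled t<K) (arc⊆es (arc-inner∈ a b K a t t<K)) })
    (adj (labelled ℕP.≤-refl) a<m (arc⊆es (arc-last∈ a b K a))) , refl
  where
  a<m : a < m
  a<m = ℕP.≤-trans a<b (ℕP.≤-trans (ℕP.m≤m+n b K) b+K≤m)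

  label : ℕ → ℕ
  label = arcLabel a (b +_)

  labelled : ∀ {t} → t ≤ K → label t < m
  labelled {zero}  _   = a<m
  labelled {suc t} t<K = ℕP.≤-trans (ℕP.+-monoʳ-< b t<K) b+K≤m

  g : ℕ → Fin n
  g x with x <? m
  ... | yes x<m = Inverse.from f (fromℕ< x<m)
  -- A default that makes `g` total; every label of the arc is below `m`.
  ... | no _    = Inverse.from f (fromℕ< a<m)

  g-label : ∀ {x} → x < m → toℕ (Inverse.to f (g x)) ≡ x
  g-label {x} x<m with x <? m
  ... | yes x<m′ = trans (cong toℕ (Inverse.strictlyInverseˡ f (fromℕ< x<m′))) (toℕ-fromℕ< x<m′)
  ... | no x≮m   = ⊥-elim (x≮m x<m)

  adj : ∀ {x y} → x < m → y < m → (x , y) ∈ es → Adj Γ (g x) (g y)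
  adj {x} {y} x<m y<m e = Equivalence.from (adj⇔ (g x) (g y))
    (inj₁ (subst₂ (λ p q → (p , q) ∈ es) (sym (g-label x<m)) (sym (g-label y<m)) e))

  label-injective : ∀ s t → label s ≡ label t → s ≡ t
  label-injective zero    zero    _  = refl
  label-injective zero    (suc t) eq = ⊥-elim (ℕP.<⇒≢ (ℕP.≤-trans a<b (ℕP.m≤m+n b t)) eq)
  label-injective (suc s) zero    eq = ⊥-elim (ℕP.<⇒≢ (ℕP.≤-trans a<b (ℕP.m≤m+n b s)) (sym eq))
  label-injective (suc s) (suc t) eq = cong suc (ℕP.+-cancelˡ-≡ b s t eq)

  injective : ∀ {s t} → s ≤ K → t ≤ K → g (label s) ≡ g (label t) → s ≡ t
  injective {s} {t} s≤ t≤ eq = label-injective s t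
    (trans (sym (g-label (labelled s≤))) (trans (cong (λ u → toℕ (Inverse.to f u)) eq) (g-label (labelled t≤))))

module _ {n} {Γ : SignedGraph n} (cycles : ∀ C → CycleNullity Γ C 2) where

  even-arc : ∀ {m es} → IsoTo Γ m es → ∀ a b K → a < b → 2 ≤ K → b + K ≤ m →
    (∀ {xy} → xy ∈ arcEdges a b K a → xy ∈ es) → parity (suc K) ≡ 0ℙ
  even-arc iso a b K a<b 2≤K b+K≤m arc⊆es with isoCycle iso a b K a<b 2≤K b+K≤m arc⊆es
  ... | C , len≡ = trans (cong parity (sym len≡)) (CycleKernel.even-length C (proj₁ (cycles C)))

  -- The vertex number is l + k + x - 2, where the cycle lengths l and k are even by nullity 2 and x
  -- is odd.
  infty⇒odd : OddInfty Γ → parity n ≡ 1ℙ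
  infty⇒odd (suc (suc (suc p)) , suc (suc (suc q)) , suc x , (s≤s (s≤s (s≤s _)) , s≤s (s≤s (s≤s _)) , s≤s _) , iso , x-odd) =
    trans (cong parity (↔⇒≡ (proj₁ iso)))
      (trans (ℙP.+-homo-+ (suc p + (3 + q)) (suc x))
        (cong₂ _+ℙ_ (trans (ℙP.+-homo-+ (suc p) (3 + q)) (cong₂ _+ℙ_ p-even (q-even x iso))) (Odd⇒parity (suc x) x-odd)))
    where
    P = 3 + p
    Q = 3 + q
    ≤-by : ∀ {a b c} → a + c ≡ b → a ≤ b
    ≤-by {a} {c = c} eq = subst (a ≤_) eq (ℕP.m≤m+n a c)
    bound₁ : ∀ p q x → 3 + p + (2 + q + x) ≡ suc p + (3 + q) + suc x
    bound₁ = solve-∀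
    bound₂ : ∀ p q → 3 + p + (2 + q) + 0 ≡ suc p + (3 + q) + 1
    bound₂ = solve-∀
    bound₃ : ∀ p q x → 4 + p + (2 + q) + x ≡ suc p + (3 + q) + suc (suc x)
    bound₃ = solve-∀
    p-even : parity (suc p) ≡ 0ℙ
    p-even = first x iso
      where
      first : ∀ x → IsoTo Γ (inftyVerts P Q (suc x)) (inftyEdges P Q (suc x)) → parity (suc p) ≡ 0ℙ
      first zero    iso = even-arc iso 0 1 (2 + p) (s≤s z≤n) (s≤s (s≤s z≤n)) (≤-by (bound₁ p q 0)) ∈-++⁺ˡ
      first (suc x) iso = even-arc iso 0 1 (2 + p) (s≤s z≤n) (s≤s (s≤s z≤n)) (≤-by (bound₁ p q (suc x))) ∈-++⁺ˡ
    q-even : ∀ x → IsoTo Γ (inftyVerts P Q (suc x)) (inftyEdges P Q (suc x)) → parity (suc q) ≡ 0ℙ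
    -- When the path has a single vertex the second cycle is based at 0, otherwise at the vertex
    -- labelled `P`.
    q-even zero    iso = even-arc iso 0 P (2 + q) (s≤s z≤n) (s≤s (s≤s z≤n)) (≤-by (bound₂ p q)) (∈-++⁺ʳ (arcEdges 0 1 (2 + p) 0))
    q-even (suc x) iso = even-arc iso P (suc P) (2 + q) ℕP.≤-refl (s≤s (s≤s z≤n)) (≤-by (bound₃ p q x))
      (λ m → ∈-++⁺ʳ (arcEdges 0 1 (2 + p) 0) (∈-++⁺ˡ m))

  -- The vertex number is one less than the sum of three even lengths.
  theta⇒odd : EvenTheta Γ → parity n ≡ 1ℙ
  theta⇒odd (suc p , q , l , _ , iso , p-even , q-even , l-even) = trans (cong parity (↔⇒≡ (proj₁ iso)))
    (trans (ℙP.+-homo-+ (p + q) l) (cong₂ _+ℙ_ (trans (ℙP.+-homo-+ p q)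
      (cong₂ _+ℙ_ (even-pred p (Even⇒parity p-even)) (Even⇒parity q-even))) (Even⇒parity l-even)))

theorem5p2 : ∀ {n} (Γ : SignedGraph n) → LeafFree Γ → Bicyclic Γ →
    (Nullity Γ 3 ⇔
    ((∀ (C : Cycle Γ) → CycleNullity Γ C 2) ×
    ((Σ ℕ λ l → Σ ℕ λ k → Σ ℕ λ x →
    InftyParams l k x × IsoTo Γ (inftyVerts l k x) (inftyEdges l k x) × Odd x)
    ⊎
    (Σ ℕ λ l′ → Σ ℕ λ x′ → Σ ℕ λ k′ →
    ThetaParams l′ x′ k′ × IsoTo Γ (thetaVerts l′ x′ k′) (thetaEdges l′ x′ k′) ×
    Even l′ × Even x′ × Even k′))))
theorem5p2 Γ leafFree bicyclic = mk⇔
  (λ (dim , _) → cycleNullity Γ leafFree bicyclic dim , spine-shape S (SpineKernel.oddChords S dim))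
  (λ { (cycles , inj₁ infty) → nullity≡3 S cycles (infty⇒odd cycles infty)
     ; (cycles , inj₂ theta) → nullity≡3 S cycles (theta⇒odd cycles theta) })
  where
  open Structure Γ leafFree bicyclic
  S : Spine Γ
  S = SpineAlong.S (spineAlong cycle)
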